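{- Let $n\ge1$ be an integer. For every $c\in\mathbb{R}^n$, $$\sum_{j\ge0}m_j\ \le\ \Bigl(\frac12+\frac1{2\ln2}\Bigr)n^2\ <\ 1.222\,n^2,$$ where, for each integer $j\ge 0$, $m_j:=\min_{\tau\in I_j}D_c(\tau)$.
   Context: For integers $j\ge0$, $I_j:=[2^{ -j-1},2^{ -j}]\subseteq\mathbb{R}$. For $c\in\mathbb{R}^n$ and $\tau\in\mathbb{R}$, $D_c(\tau):=\min_{z\in\mathbb{Z}^n}\lVert\tau c-z\rVert_1$ is the $\ell_1$-distance of $\tau c$ to $\mathbb{Z}^n$. The function $D_c$ is continuous, so the minimum defining $m_j$ over the compact interval $I_j$ exists. The sum is over all integers $j\ge0$; its terms are nonnegative, and the bound includes the assertion that the series converges. -}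

module Defs where

open import Data.Nat.Base as ℕ using (ℕ; zero; suc)
import Data.Nat.Properties as ℕₚ
open import Data.Nat.Tactic.RingSolver using (solve-∀)
open import Data.Integer.Base as ℤ using (ℤ; +_)
import Data.Integer.Properties as ℤₚ
open import Data.Rational.Base as ℚ using (ℚ; 0ℚ; 1ℚ; ½)
import Data.Rational.Properties as ℚₚ
import Data.Rational.Unnormalised.Base as ℚᵘ
import Data.Rational.Unnormalised.Properties as ℚᵘₚ
open import Data.Rational.Solver using (module +-*-Solver)
open import Data.Product.Base using (∃; _×_; _,_; proj₁; proj₂)
open import Data.Sum.Base using (inj₁; inj₂)
open import Data.Vec.Functional using (Vector; foldr)
open import Relation.Binary.PropositionalEquality
open import Relation.Nullary.Negation using (¬_)
open import Relation.Unary using (Pred; U)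
open import Level using (0ℓ)

private
  0<½*_ : ∀ {ε} → 0ℚ ℚ.< ε → 0ℚ ℚ.< ½ ℚ.* ε
  0<½*_ {ε} 0<ε =
    ℚₚ.positive⁻¹ (½ ℚ.* ε) {{ℚₚ.pos*pos⇒pos ½ ε {{ℚ.positive 0<ε}}}}

  halves : ∀ ε → ½ ℚ.* ε ℚ.+ ½ ℚ.* ε ≡ ε
  halves ε = trans (sym (ℚₚ.*-distribʳ-+ ε ½ ½)) (ℚₚ.*-identityˡ ε)

  ∣-∣-swap : ∀ p q → ℚ.∣ p ℚ.- q ∣ ≡ ℚ.∣ q ℚ.- p ∣
  ∣-∣-swap p q = trans (sym (ℚₚ.∣-p∣≡∣p∣ (p ℚ.- q))) (cong ℚ.∣_∣
    (solve 2 (λ p q → :- (p :- q) := q :- p) refl p q))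
    where open +-*-Solver

  *-mono-≤-nonNeg : ∀ {p q r s} → 0ℚ ℚ.≤ r → 0ℚ ℚ.≤ q →
                    p ℚ.≤ q → r ℚ.≤ s → p ℚ.* r ℚ.≤ q ℚ.* s
  *-mono-≤-nonNeg {p} {q} {r} {s} 0≤r 0≤q p≤q r≤s = ℚₚ.≤-trans
    (ℚₚ.*-monoʳ-≤-nonNeg r {{ℚ.nonNegative 0≤r}} p≤q)
    (ℚₚ.*-monoˡ-≤-nonNeg q {{ℚ.nonNegative 0≤q}} r≤s)

  ∣p∣-∣q∣≤∣p-q∣ : ∀ p q → ℚ.∣ p ∣ ℚ.- ℚ.∣ q ∣ ℚ.≤ ℚ.∣ p ℚ.- q ∣
  ∣p∣-∣q∣≤∣p-q∣ p q = begin
    ℚ.∣ p ∣ ℚ.- ℚ.∣ q ∣                          ≡⟨ cong (λ r → ℚ.∣ r ∣ ℚ.- ℚ.∣ q ∣) (solve 2 (λ p q → p := (p :- q) :+ q) refl p q) ⟩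
    ℚ.∣ (p ℚ.- q) ℚ.+ q ∣ ℚ.- ℚ.∣ q ∣            ≤⟨ ℚₚ.+-monoˡ-≤ (ℚ.- ℚ.∣ q ∣) (ℚₚ.∣p+q∣≤∣p∣+∣q∣ (p ℚ.- q) q) ⟩
    (ℚ.∣ p ℚ.- q ∣ ℚ.+ ℚ.∣ q ∣) ℚ.- ℚ.∣ q ∣      ≡⟨ solve 2 (λ a b → (a :+ b) :- b := a) refl ℚ.∣ p ℚ.- q ∣ ℚ.∣ q ∣ ⟩
    ℚ.∣ p ℚ.- q ∣                                ∎
    where open ℚₚ.≤-Reasoning
          open +-*-Solver

  ∣∣p∣-∣q∣∣≤∣p-q∣ : ∀ p q → ℚ.∣ ℚ.∣ p ∣ ℚ.- ℚ.∣ q ∣ ∣ ℚ.≤ ℚ.∣ p ℚ.- q ∣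
  ∣∣p∣-∣q∣∣≤∣p-q∣ p q with ℚₚ.∣p∣≡p∨∣p∣≡-p (ℚ.∣ p ∣ ℚ.- ℚ.∣ q ∣)
  ... | inj₁ eq = subst (ℚ._≤ ℚ.∣ p ℚ.- q ∣) (sym eq) (∣p∣-∣q∣≤∣p-q∣ p q)
  ... | inj₂ eq = subst₂ ℚ._≤_
    (trans (solve 2 (λ a b → b :- a := :- (a :- b)) refl ℚ.∣ p ∣ ℚ.∣ q ∣) (sym eq))
    (∣-∣-swap q p) (∣p∣-∣q∣≤∣p-q∣ q p)
    where open +-*-Solver

  p≤q⇒0≤q-p : ∀ {p q} → p ℚ.≤ q → 0ℚ ℚ.≤ q ℚ.- p
  p≤q⇒0≤q-p {p} {q} p≤q =
    subst (ℚ._≤ q ℚ.- p) (ℚₚ.+-inverseʳ p) (ℚₚ.+-monoˡ-≤ (ℚ.- p) p≤q)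

  recipℚ : ∀ p → 0ℚ ℚ.< p → ℚ
  recipℚ p 0<p = (ℚ.1/ p) {{ℚ.>-nonZero 0<p}}

  recipℚ-pos : ∀ p (0<p : 0ℚ ℚ.< p) → 0ℚ ℚ.< recipℚ p 0<p
  recipℚ-pos p 0<p = ℚₚ.positive⁻¹ _ {{ℚₚ.1/pos⇒pos p {{ℚ.positive 0<p}}}}

  recipℚ-inv : ∀ p (0<p : 0ℚ ℚ.< p) → p ℚ.* recipℚ p 0<p ≡ 1ℚ
  recipℚ-inv p 0<p = ℚₚ.*-inverseʳ p {{ℚ.>-nonZero 0<p}}

  recipℚ-anti : ∀ p q (0<p : 0ℚ ℚ.< p) (0<q : 0ℚ ℚ.< q) → p ℚ.≤ q →
                recipℚ q 0<q ℚ.≤ recipℚ p 0<p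
  recipℚ-anti p q 0<p 0<q p≤q = begin
    q⁻¹                    ≡⟨ sym (ℚₚ.*-identityʳ q⁻¹) ⟩
    q⁻¹ ℚ.* 1ℚ             ≡⟨ cong (q⁻¹ ℚ.*_) (sym (recipℚ-inv p 0<p)) ⟩
    q⁻¹ ℚ.* (p ℚ.* p⁻¹)    ≤⟨ ℚₚ.*-monoˡ-≤-nonNeg q⁻¹ {{≥0 (recipℚ-pos q 0<q)}}
                                (ℚₚ.*-monoʳ-≤-nonNeg p⁻¹ {{≥0 (recipℚ-pos p 0<p)}} p≤q) ⟩
    q⁻¹ ℚ.* (q ℚ.* p⁻¹)    ≡⟨ solve 3 (λ a b c → a :* (b :* c) := (b :* a) :* c) refl q⁻¹ q p⁻¹ ⟩
    (q ℚ.* q⁻¹) ℚ.* p⁻¹    ≡⟨ cong (ℚ._* p⁻¹) (recipℚ-inv q 0<q) ⟩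
    1ℚ ℚ.* p⁻¹             ≡⟨ ℚₚ.*-identityˡ p⁻¹ ⟩
    p⁻¹                    ∎
    where
    open ℚₚ.≤-Reasoning
    open +-*-Solver
    p⁻¹ = recipℚ p 0<p
    q⁻¹ = recipℚ q 0<q
    ≥0 : ∀ {r} → 0ℚ ℚ.< r → ℚ.NonNegative r
    ≥0 0<r = ℚ.nonNegative (ℚₚ.<⇒≤ 0<r)

-- The elements of ℝ are not quotiented: equality of reals is _≈_, not _≡_.
Cauchy : (ℕ → ℚ) → Set
Cauchy s = ∀ ε → 0ℚ ℚ.< ε →
  ∃ λ N → ∀ m n → N ℕ.≤ m → N ℕ.≤ n → ℚ.∣ s m ℚ.- s n ∣ ℚ.< ε

record ℝ : Set where
  constructor mkℝ
  field
    seq    : ℕ → ℚ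
    cauchy : Cauchy seq

open ℝ public

infix 4 _≈_ _≤_ _<_

_≈_ : ℝ → ℝ → Set
x ≈ y = ∀ ε → 0ℚ ℚ.< ε →
  ∃ λ N → ∀ n → N ℕ.≤ n → ℚ.∣ seq x n ℚ.- seq y n ∣ ℚ.< ε

_≤_ : ℝ → ℝ → Set
x ≤ y = ∀ ε → 0ℚ ℚ.< ε →
  ∃ λ N → ∀ n → N ℕ.≤ n → seq x n ℚ.< seq y n ℚ.+ ε

_<_ : ℝ → ℝ → Set
x < y = ∃ λ ε → 0ℚ ℚ.< ε ×
  ∃ λ N → ∀ n → N ℕ.≤ n → seq x n ℚ.+ ε ℚ.≤ seq y n

fromℚ : ℚ → ℝ
fromℚ q = mkℝ (λ _ → q) λ ε 0<ε →
  0 , λ _ _ _ _ → subst (λ r → ℚ.∣ r ∣ ℚ.< ε) (sym (ℚₚ.+-inverseʳ q)) 0<ε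

fromℤ : ℤ → ℝ
fromℤ i = fromℚ (i ℚ./ 1)

fromℕ : ℕ → ℝ
fromℕ n = fromℤ (+ n)

0ℝ 1ℝ : ℝ
0ℝ = fromℕ 0
1ℝ = fromℕ 1

infix  8 -_
infixl 7 _*_
infixl 6 _+_ _-_

_+_ : ℝ → ℝ → ℝ
mkℝ s cs + mkℝ t ct = mkℝ (λ n → s n ℚ.+ t n) c
  where
  open ℚₚ.≤-Reasoning
  open +-*-Solver
  c : Cauchy (λ n → s n ℚ.+ t n)
  c ε 0<ε with cs (½ ℚ.* ε) (0<½* 0<ε) | ct (½ ℚ.* ε) (0<½* 0<ε)
  ... | M , hs | N , ht = M ℕ.⊔ N , λ m n M⊔N≤m M⊔N≤n → begin-strict
    ℚ.∣ (s m ℚ.+ t m) ℚ.- (s n ℚ.+ t n) ∣            ≡⟨ cong ℚ.∣_∣ (solve 4 (λ a b c d → (a :+ b) :- (c :+ d) := (a :- c) :+ (b :- d)) refl (s m) (t m) (s n) (t n)) ⟩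
    ℚ.∣ (s m ℚ.- s n) ℚ.+ (t m ℚ.- t n) ∣            ≤⟨ ℚₚ.∣p+q∣≤∣p∣+∣q∣ (s m ℚ.- s n) (t m ℚ.- t n) ⟩
    ℚ.∣ s m ℚ.- s n ∣ ℚ.+ ℚ.∣ t m ℚ.- t n ∣          <⟨ ℚₚ.+-mono-<
                                                         (hs m n (ℕₚ.m⊔n≤o⇒m≤o M N M⊔N≤m) (ℕₚ.m⊔n≤o⇒m≤o M N M⊔N≤n))
                                                         (ht m n (ℕₚ.m⊔n≤o⇒n≤o M N M⊔N≤m) (ℕₚ.m⊔n≤o⇒n≤o M N M⊔N≤n)) ⟩
    ½ ℚ.* ε ℚ.+ ½ ℚ.* ε                              ≡⟨ halves ε ⟩
    ε                                                ∎

-_ : ℝ → ℝ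
- mkℝ s cs = mkℝ (λ n → ℚ.- s n) λ ε 0<ε →
  let N , h = cs ε 0<ε in
  N , λ m n N≤m N≤n → subst (ℚ._< ε)
    (trans (∣-∣-swap (s m) (s n))
           (cong ℚ.∣_∣ (solve 2 (λ a b → b :- a := (:- a) :- (:- b)) refl (s m) (s n))))
    (h m n N≤m N≤n)
  where open +-*-Solver

_-_ : ℝ → ℝ → ℝ
x - y = x + - y

∣_∣ : ℝ → ℝ
∣ mkℝ s cs ∣ = mkℝ (λ n → ℚ.∣ s n ∣) λ ε 0<ε →
  let N , h = cs ε 0<ε in
  N , λ m n N≤m N≤n → ℚₚ.≤-<-trans (∣∣p∣-∣q∣∣≤∣p-q∣ (s m) (s n)) (h m n N≤m N≤n)

private
  bounded : ∀ s → Cauchy s →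
            ∃ λ B → 0ℚ ℚ.< B × ∃ λ N → ∀ n → N ℕ.≤ n → ℚ.∣ s n ∣ ℚ.≤ B
  bounded s cs with cs 1ℚ (ℚₚ.positive⁻¹ 1ℚ)
  ... | N , h = ℚ.∣ s N ∣ ℚ.+ 1ℚ
              , ℚₚ.+-mono-≤-< (ℚₚ.0≤∣p∣ (s N)) (ℚₚ.positive⁻¹ 1ℚ)
              , N , λ n N≤n → begin
    ℚ.∣ s n ∣                              ≡⟨ cong ℚ.∣_∣ (solve 2 (λ a b → a := b :+ (a :- b)) refl (s n) (s N)) ⟩
    ℚ.∣ s N ℚ.+ (s n ℚ.- s N) ∣            ≤⟨ ℚₚ.∣p+q∣≤∣p∣+∣q∣ (s N) (s n ℚ.- s N) ⟩
    ℚ.∣ s N ∣ ℚ.+ ℚ.∣ s n ℚ.- s N ∣        ≤⟨ ℚₚ.+-monoʳ-≤ ℚ.∣ s N ∣ (ℚₚ.<⇒≤ (h n N N≤n ℕₚ.≤-refl)) ⟩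
    ℚ.∣ s N ∣ ℚ.+ 1ℚ                       ∎
    where open ℚₚ.≤-Reasoning
          open +-*-Solver

_*_ : ℝ → ℝ → ℝ
mkℝ s cs * mkℝ t ct = mkℝ (λ n → s n ℚ.* t n) c
  where
  open ℚₚ.≤-Reasoning
  open +-*-Solver
  c : Cauchy (λ n → s n ℚ.* t n)
  c ε 0<ε = go (bounded s cs) (bounded t ct)
    where
    ε/2C : ∀ C → 0ℚ ℚ.< C → ℚ
    ε/2C C 0<C = ½ ℚ.* ε ℚ.* recipℚ C 0<C
    ε/2C-pos : ∀ C (0<C : 0ℚ ℚ.< C) → 0ℚ ℚ.< ε/2C C 0<C
    ε/2C-pos C 0<C = ℚₚ.positive⁻¹ (ε/2C C 0<C) {{ℚₚ.pos*pos⇒pos (½ ℚ.* ε)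
      {{ℚ.positive (0<½* 0<ε)}} (recipℚ C 0<C) {{ℚ.positive (recipℚ-pos C 0<C)}}}}
    small : ∀ C (0<C : 0ℚ ℚ.< C) a d → ℚ.∣ a ∣ ℚ.≤ C → ℚ.∣ d ∣ ℚ.< ε/2C C 0<C →
            ℚ.∣ a ∣ ℚ.* ℚ.∣ d ∣ ℚ.< ½ ℚ.* ε
    small C 0<C a d a≤C d< = begin-strict
      ℚ.∣ a ∣ ℚ.* ℚ.∣ d ∣                       ≤⟨ ℚₚ.*-monoʳ-≤-nonNeg ℚ.∣ d ∣ {{ℚₚ.∣-∣-nonNeg d}} a≤C ⟩
      C ℚ.* ℚ.∣ d ∣                             <⟨ ℚₚ.*-monoʳ-<-pos C {{ℚ.positive 0<C}} d< ⟩
      C ℚ.* ε/2C C 0<C                          ≡⟨ solve 3 (λ a b c → a :* (b :* c) := b :* (a :* c)) refl C (½ ℚ.* ε) (recipℚ C 0<C) ⟩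
      ½ ℚ.* ε ℚ.* (C ℚ.* recipℚ C 0<C)          ≡⟨ cong (½ ℚ.* ε ℚ.*_) (recipℚ-inv C 0<C) ⟩
      ½ ℚ.* ε ℚ.* 1ℚ                            ≡⟨ ℚₚ.*-identityʳ (½ ℚ.* ε) ⟩
      ½ ℚ.* ε                                   ∎
    Bound : (ℕ → ℚ) → Set
    Bound u = ∃ λ B → 0ℚ ℚ.< B × ∃ λ N → ∀ n → N ℕ.≤ n → ℚ.∣ u n ∣ ℚ.≤ B
    go : Bound s → Bound t →
         ∃ λ N → ∀ m n → N ℕ.≤ m → N ℕ.≤ n → ℚ.∣ s m ℚ.* t m ℚ.- s n ℚ.* t n ∣ ℚ.< ε
    go (A , 0<A , M , hA) (B , 0<B , N , hB) =
      let P , hs = cs (ε/2C B 0<B) (ε/2C-pos B 0<B)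
          Q , ht = ct (ε/2C A 0<A) (ε/2C-pos A 0<A)
          K = (M ℕ.⊔ N) ℕ.⊔ (P ℕ.⊔ Q)
          ≤₁ = λ {k} (h : K ℕ.≤ k) → ℕₚ.m⊔n≤o⇒m≤o M N (ℕₚ.m⊔n≤o⇒m≤o (M ℕ.⊔ N) (P ℕ.⊔ Q) h)
          ≤₂ = λ {k} (h : K ℕ.≤ k) → ℕₚ.m⊔n≤o⇒n≤o M N (ℕₚ.m⊔n≤o⇒m≤o (M ℕ.⊔ N) (P ℕ.⊔ Q) h)
          ≤₃ = λ {k} (h : K ℕ.≤ k) → ℕₚ.m⊔n≤o⇒m≤o P Q (ℕₚ.m⊔n≤o⇒n≤o (M ℕ.⊔ N) (P ℕ.⊔ Q) h)
          ≤₄ = λ {k} (h : K ℕ.≤ k) → ℕₚ.m⊔n≤o⇒n≤o P Q (ℕₚ.m⊔n≤o⇒n≤o (M ℕ.⊔ N) (P ℕ.⊔ Q) h)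
      in K , λ m n K≤m K≤n → begin-strict
      ℚ.∣ s m ℚ.* t m ℚ.- s n ℚ.* t n ∣
        ≡⟨ cong ℚ.∣_∣ (solve 4 (λ a b c d → a :* b :- c :* d := a :* (b :- d) :+ d :* (a :- c)) refl (s m) (t m) (s n) (t n)) ⟩
      ℚ.∣ s m ℚ.* (t m ℚ.- t n) ℚ.+ t n ℚ.* (s m ℚ.- s n) ∣
        ≤⟨ ℚₚ.∣p+q∣≤∣p∣+∣q∣ (s m ℚ.* (t m ℚ.- t n)) (t n ℚ.* (s m ℚ.- s n)) ⟩
      ℚ.∣ s m ℚ.* (t m ℚ.- t n) ∣ ℚ.+ ℚ.∣ t n ℚ.* (s m ℚ.- s n) ∣
        ≡⟨ cong₂ ℚ._+_ (ℚₚ.∣p*q∣≡∣p∣*∣q∣ (s m) (t m ℚ.- t n)) (ℚₚ.∣p*q∣≡∣p∣*∣q∣ (t n) (s m ℚ.- s n)) ⟩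
      ℚ.∣ s m ∣ ℚ.* ℚ.∣ t m ℚ.- t n ∣ ℚ.+ ℚ.∣ t n ∣ ℚ.* ℚ.∣ s m ℚ.- s n ∣
        <⟨ ℚₚ.+-mono-<
             (small A 0<A (s m) (t m ℚ.- t n) (hA m (≤₁ K≤m)) (ht m n (≤₄ K≤m) (≤₄ K≤n)))
             (small B 0<B (t n) (s m ℚ.- s n) (hB n (≤₂ K≤n)) (hs m n (≤₃ K≤m) (≤₃ K≤n))) ⟩
      ½ ℚ.* ε ℚ.+ ½ ℚ.* ε
        ≡⟨ halves ε ⟩
      ε ∎

-- The sequence is shifted past the point where positivity of x is witnessed,
-- so that every term can be inverted.
recip : (x : ℝ) → 0ℝ < x → ℝ
recip (mkℝ s cs) (δ , 0<δ , N , h) = mkℝ (λ n → recipℚ (s (N ℕ.+ n)) (s-pos n)) c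
  where
  open ℚₚ.≤-Reasoning
  open +-*-Solver
  δ≤s : ∀ n → δ ℚ.≤ s (N ℕ.+ n)
  δ≤s n = subst (ℚ._≤ s (N ℕ.+ n)) (ℚₚ.+-identityˡ δ) (h (N ℕ.+ n) (ℕₚ.m≤m+n N n))
  s-pos : ∀ n → 0ℚ ℚ.< s (N ℕ.+ n)
  s-pos n = ℚₚ.<-≤-trans 0<δ (δ≤s n)
  c : Cauchy (λ n → recipℚ (s (N ℕ.+ n)) (s-pos n))
  c ε 0<ε =
    let ε′-pos = ℚₚ.positive⁻¹ (ε ℚ.* (δ ℚ.* δ)) {{ℚₚ.pos*pos⇒pos ε {{ℚ.positive 0<ε}} (δ ℚ.* δ)
                   {{ℚₚ.pos*pos⇒pos δ {{ℚ.positive 0<δ}} δ {{ℚ.positive 0<δ}}}}}}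
        M , hs = cs (ε ℚ.* (δ ℚ.* δ)) ε′-pos
    in M , λ m n M≤m M≤n →
    let a   = s (N ℕ.+ m) ; b   = s (N ℕ.+ n)
        a⁻¹ = recipℚ a (s-pos m) ; b⁻¹ = recipℚ b (s-pos n)
        δ⁻¹ = recipℚ δ 0<δ
        0≤a⁻¹ = ℚₚ.<⇒≤ (recipℚ-pos a (s-pos m))
        0≤b⁻¹ = ℚₚ.<⇒≤ (recipℚ-pos b (s-pos n))
        0<δ⁻¹ = recipℚ-pos δ 0<δ
        instance
          δ⁻²-pos : ℚ.Positive (δ⁻¹ ℚ.* δ⁻¹)
          δ⁻²-pos = ℚₚ.pos*pos⇒pos δ⁻¹ {{ℚ.positive 0<δ⁻¹}} δ⁻¹ {{ℚ.positive 0<δ⁻¹}}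
        a⁻¹b⁻¹≥0 : ℚ.NonNegative (a⁻¹ ℚ.* b⁻¹)
        a⁻¹b⁻¹≥0 = ℚₚ.nonNeg*nonNeg⇒nonNeg a⁻¹ {{ℚ.nonNegative 0≤a⁻¹}} b⁻¹ {{ℚ.nonNegative 0≤b⁻¹}}
    in begin-strict
    ℚ.∣ a⁻¹ ℚ.- b⁻¹ ∣
      ≡⟨ cong ℚ.∣_∣ (cong₂ ℚ._-_ (sym (ℚₚ.*-identityˡ a⁻¹)) (sym (ℚₚ.*-identityˡ b⁻¹))) ⟩
    ℚ.∣ 1ℚ ℚ.* a⁻¹ ℚ.- 1ℚ ℚ.* b⁻¹ ∣
      ≡⟨ cong ℚ.∣_∣ (cong₂ (λ u v → u ℚ.* a⁻¹ ℚ.- v ℚ.* b⁻¹) (sym (recipℚ-inv b (s-pos n))) (sym (recipℚ-inv a (s-pos m)))) ⟩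
    ℚ.∣ b ℚ.* b⁻¹ ℚ.* a⁻¹ ℚ.- a ℚ.* a⁻¹ ℚ.* b⁻¹ ∣
      ≡⟨ cong ℚ.∣_∣ (solve 4 (λ a b x y → b :* y :* x :- a :* x :* y := (b :- a) :* (x :* y)) refl a b a⁻¹ b⁻¹) ⟩
    ℚ.∣ (b ℚ.- a) ℚ.* (a⁻¹ ℚ.* b⁻¹) ∣
      ≡⟨ ℚₚ.∣p*q∣≡∣p∣*∣q∣ (b ℚ.- a) (a⁻¹ ℚ.* b⁻¹) ⟩
    ℚ.∣ b ℚ.- a ∣ ℚ.* ℚ.∣ a⁻¹ ℚ.* b⁻¹ ∣
      ≡⟨ cong (ℚ.∣ b ℚ.- a ∣ ℚ.*_) (ℚₚ.0≤p⇒∣p∣≡p (ℚₚ.nonNegative⁻¹ _ {{a⁻¹b⁻¹≥0}})) ⟩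
    ℚ.∣ b ℚ.- a ∣ ℚ.* (a⁻¹ ℚ.* b⁻¹)
      ≤⟨ ℚₚ.*-monoˡ-≤-nonNeg ℚ.∣ b ℚ.- a ∣ {{ℚₚ.∣-∣-nonNeg (b ℚ.- a)}}
           (*-mono-≤-nonNeg 0≤b⁻¹ (ℚₚ.<⇒≤ 0<δ⁻¹)
             (recipℚ-anti δ a 0<δ (s-pos m) (δ≤s m)) (recipℚ-anti δ b 0<δ (s-pos n) (δ≤s n))) ⟩
    ℚ.∣ b ℚ.- a ∣ ℚ.* (δ⁻¹ ℚ.* δ⁻¹)
      <⟨ ℚₚ.*-monoˡ-<-pos (δ⁻¹ ℚ.* δ⁻¹)
           (hs (N ℕ.+ n) (N ℕ.+ m) (ℕₚ.≤-trans M≤n (ℕₚ.m≤n+m n N)) (ℕₚ.≤-trans M≤m (ℕₚ.m≤n+m m N))) ⟩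
    ε ℚ.* (δ ℚ.* δ) ℚ.* (δ⁻¹ ℚ.* δ⁻¹)
      ≡⟨ solve 3 (λ e d x → e :* (d :* d) :* (x :* x) := e :* ((d :* x) :* (d :* x))) refl ε δ δ⁻¹ ⟩
    ε ℚ.* ((δ ℚ.* δ⁻¹) ℚ.* (δ ℚ.* δ⁻¹))
      ≡⟨ cong (λ u → ε ℚ.* (u ℚ.* u)) (recipℚ-inv δ 0<δ) ⟩
    ε ℚ.* 1ℚ
      ≡⟨ ℚₚ.*-identityʳ ε ⟩
    ε ∎

∑ℚ : ℕ → (ℕ → ℚ) → ℚ
∑ℚ zero    f = 0ℚ
∑ℚ (suc k) f = ∑ℚ k f ℚ.+ f k

∑ : ℕ → (ℕ → ℝ) → ℝ
∑ zero    a = 0ℝ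
∑ (suc k) a = ∑ k a + a k

HasSum : (ℕ → ℝ) → ℝ → Set
HasSum a S = ∀ ε → 0ℚ ℚ.< ε →
  ∃ λ K → ∀ k → K ℕ.≤ k → ∣ ∑ k a - S ∣ < fromℚ ε

-- ln 2 = ∫₁² dt/t.  The right-endpoint Riemann sum over N equal subintervals is
-- ∑_{1≤i≤N} (1/N) · 1/(1 + i/N) = ∑_{i<N} 1/(N + i + 1).
riemannSum : ℕ → ℚ
riemannSum N = ∑ℚ N (λ i → + 1 ℚ./ suc (N ℕ.+ i))

private
  1/suc : ℕ → ℚ
  1/suc n = + 1 ℚ./ suc n

  1/suc-anti : ∀ {m n} → m ℕ.≤ n → 1/suc n ℚ.≤ 1/suc m
  1/suc-anti {m} {n} m≤n = ℚₚ.toℚᵘ-cancel-≤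
    (ℚᵘₚ.≤-respʳ-≃ (ℚᵘₚ.≃-sym (ℚₚ.toℚᵘ-fromℚᵘ (ℚᵘ.mkℚᵘ (+ 1) m)))
    (ℚᵘₚ.≤-respˡ-≃ (ℚᵘₚ.≃-sym (ℚₚ.toℚᵘ-fromℚᵘ (ℚᵘ.mkℚᵘ (+ 1) n)))
    (ℚᵘ.*≤* (subst₂ ℤ._≤_ (sym (ℤₚ.*-identityˡ (+ suc m))) (sym (ℤₚ.*-identityˡ (+ suc n)))
      (ℤ.+≤+ (ℕ.s≤s m≤n))))))

  1/suc-double : ∀ n → 1/suc n ≡ 1/suc (suc (n ℕ.+ n)) ℚ.+ 1/suc (suc (n ℕ.+ n))
  1/suc-double n = ℚₚ.toℚᵘ-injective
    (ℚᵘₚ.≃-trans (ℚₚ.toℚᵘ-fromℚᵘ (ℚᵘ.mkℚᵘ (+ 1) n))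
    (ℚᵘₚ.≃-trans step
    (ℚᵘₚ.≃-sym (ℚᵘₚ.≃-trans (ℚₚ.toℚᵘ-homo-+ (1/suc k) (1/suc k)) (ℚᵘₚ.+-cong eq eq)))))
    where
    k = suc (n ℕ.+ n)
    eq = ℚₚ.toℚᵘ-fromℚᵘ (ℚᵘ.mkℚᵘ (+ 1) k)
    ℕ-eq : ∀ n → 1 ℕ.* ((2 ℕ.+ (n ℕ.+ n)) ℕ.* (2 ℕ.+ (n ℕ.+ n)))
           ≡ (1 ℕ.* (2 ℕ.+ (n ℕ.+ n)) ℕ.+ 1 ℕ.* (2 ℕ.+ (n ℕ.+ n))) ℕ.* (1 ℕ.+ n)
    ℕ-eq = solve-∀
    step : ℚᵘ.mkℚᵘ (+ 1) n ℚᵘ.≃ ℚᵘ.mkℚᵘ (+ 1) k ℚᵘ.+ ℚᵘ.mkℚᵘ (+ 1) k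
    step = ℚᵘ.*≡* (cong +_ (ℕ-eq n))

  1/suc-small : ∀ ε → 0ℚ ℚ.< ε → ∃ λ n → 1/suc n ℚ.< ε
  1/suc-small ε@(ℚ.mkℚ (+ zero)  d _) 0<ε with ℚ.positive 0<ε
  ... | ()
  1/suc-small ε@(ℚ.mkℚ (+ suc p) d _) 0<ε = suc d , ℚₚ.toℚᵘ-cancel-<
    (ℚᵘₚ.<-respˡ-≃ (ℚᵘₚ.≃-sym (ℚₚ.toℚᵘ-fromℚᵘ (ℚᵘ.mkℚᵘ (+ 1) (suc d))))
    (ℚᵘ.*<* (ℤ.+<+ (subst (ℕ._< suc p ℕ.* suc (suc d)) (sym (ℕₚ.*-identityˡ (suc d)))
      (ℕₚ.<-≤-trans (ℕₚ.n<1+n (suc d)) (ℕₚ.m≤n*m (suc (suc d)) (suc p)))))))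
  1/suc-small ε@(ℚ.mkℚ ℤ.-[1+ _ ] d _) 0<ε with ℚ.positive 0<ε
  ... | ()

  harmonic : ℕ → ℚ
  harmonic n = ∑ℚ n 1/suc

  riemannSum-harmonic : ∀ N → riemannSum N ≡ harmonic (N ℕ.+ N) ℚ.- harmonic N
  riemannSum-harmonic N = go N
    where
    open ≡-Reasoning
    open +-*-Solver
    go : ∀ k → ∑ℚ k (λ i → 1/suc (N ℕ.+ i)) ≡ harmonic (N ℕ.+ k) ℚ.- harmonic N
    go zero    = sym (trans (cong (λ m → harmonic m ℚ.- harmonic N) (ℕₚ.+-identityʳ N))
                            (ℚₚ.+-inverseʳ (harmonic N)))
    go (suc k) = begin
      ∑ℚ k (λ i → 1/suc (N ℕ.+ i)) ℚ.+ 1/suc (N ℕ.+ k)              ≡⟨ cong (ℚ._+ 1/suc (N ℕ.+ k)) (go k) ⟩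
      (harmonic (N ℕ.+ k) ℚ.- harmonic N) ℚ.+ 1/suc (N ℕ.+ k)       ≡⟨ solve 3 (λ a b c → (a :- b) :+ c := (a :+ c) :- b) refl (harmonic (N ℕ.+ k)) (harmonic N) (1/suc (N ℕ.+ k)) ⟩
      harmonic (suc (N ℕ.+ k)) ℚ.- harmonic N                       ≡⟨ cong (λ m → harmonic m ℚ.- harmonic N) (sym (ℕₚ.+-suc N k)) ⟩
      harmonic (N ℕ.+ suc k) ℚ.- harmonic N                         ∎

  riemannSum-suc : ∀ N → riemannSum (suc N) ≡
                   riemannSum N ℚ.+ (1/suc (N ℕ.+ N) ℚ.- 1/suc (suc (N ℕ.+ N)))
  riemannSum-suc N = begin
    riemannSum (suc N)
      ≡⟨ riemannSum-harmonic (suc N) ⟩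
    harmonic (suc (N ℕ.+ suc N)) ℚ.- harmonic (suc N)
      ≡⟨ cong (λ m → harmonic (suc m) ℚ.- harmonic (suc N)) (ℕₚ.+-suc N N) ⟩
    (harmonic (N ℕ.+ N) ℚ.+ b ℚ.+ a) ℚ.- (harmonic N ℚ.+ 1/suc N)
      ≡⟨ cong (λ u → (harmonic (N ℕ.+ N) ℚ.+ b ℚ.+ a) ℚ.- (harmonic N ℚ.+ u)) (1/suc-double N) ⟩
    (harmonic (N ℕ.+ N) ℚ.+ b ℚ.+ a) ℚ.- (harmonic N ℚ.+ (a ℚ.+ a))
      ≡⟨ solve 4 (λ h k a b → (h :+ b :+ a) :- (k :+ (a :+ a)) := (h :- k) :+ (b :- a)) refl (harmonic (N ℕ.+ N)) (harmonic N) a b ⟩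
    (harmonic (N ℕ.+ N) ℚ.- harmonic N) ℚ.+ (b ℚ.- a)
      ≡⟨ cong (ℚ._+ (b ℚ.- a)) (sym (riemannSum-harmonic N)) ⟩
    riemannSum N ℚ.+ (b ℚ.- a) ∎
    where
    open ≡-Reasoning
    open +-*-Solver
    a = 1/suc (suc (N ℕ.+ N))
    b = 1/suc (N ℕ.+ N)

  upperSum : ℕ → ℚ
  upperSum N = riemannSum N ℚ.+ 1/suc (N ℕ.+ N)

  riemannSum-step : ∀ N → riemannSum N ℚ.≤ riemannSum (suc N)
  riemannSum-step N = begin
    riemannSum N                  ≡⟨ sym (ℚₚ.+-identityʳ _) ⟩
    riemannSum N ℚ.+ 0ℚ           ≤⟨ ℚₚ.+-monoʳ-≤ (riemannSum N) (p≤q⇒0≤q-p (1/suc-anti (ℕₚ.n≤1+n (N ℕ.+ N)))) ⟩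
    _                             ≡⟨ sym (riemannSum-suc N) ⟩
    riemannSum (suc N)            ∎
    where open ℚₚ.≤-Reasoning

  upperSum-step : ∀ N → upperSum (suc N) ℚ.≤ upperSum N
  upperSum-step N = begin
    upperSum (suc N)
      ≡⟨ cong (ℚ._+ 1/suc (suc N ℕ.+ suc N)) (riemannSum-suc N) ⟩
    (riemannSum N ℚ.+ (b ℚ.- a)) ℚ.+ 1/suc (suc N ℕ.+ suc N)
      ≤⟨ ℚₚ.+-monoʳ-≤ (riemannSum N ℚ.+ (b ℚ.- a)) (1/suc-anti (ℕ.s≤s (ℕₚ.+-monoʳ-≤ N (ℕₚ.n≤1+n N)))) ⟩
    (riemannSum N ℚ.+ (b ℚ.- a)) ℚ.+ a
      ≡⟨ solve 3 (λ r a b → (r :+ (b :- a)) :+ a := r :+ b) refl (riemannSum N) a b ⟩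
    upperSum N ∎
    where
    open ℚₚ.≤-Reasoning
    open +-*-Solver
    a = 1/suc (suc (N ℕ.+ N))
    b = 1/suc (N ℕ.+ N)

  riemannSum-mono : ∀ {m n} → m ℕ.≤′ n → riemannSum m ℚ.≤ riemannSum n
  riemannSum-mono (ℕ.≤′-reflexive refl) = ℚₚ.≤-refl
  riemannSum-mono (ℕ.≤′-step {n} m≤n) = ℚₚ.≤-trans (riemannSum-mono m≤n) (riemannSum-step n)

  upperSum-anti : ∀ {m n} → m ℕ.≤′ n → upperSum n ℚ.≤ upperSum m
  upperSum-anti (ℕ.≤′-reflexive refl) = ℚₚ.≤-refl
  upperSum-anti (ℕ.≤′-step {n} m≤n) = ℚₚ.≤-trans (upperSum-step n) (upperSum-anti m≤n)

  riemannSum≤upperSum : ∀ N → riemannSum N ℚ.≤ upperSum N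
  riemannSum≤upperSum N = subst (ℚ._≤ upperSum N) (ℚₚ.+-identityʳ (riemannSum N))
    (ℚₚ.+-monoʳ-≤ (riemannSum N) (ℚₚ.nonNegative⁻¹ _ {{ℚₚ.normalize-nonNeg 1 (suc (N ℕ.+ N))}}))

  riemannSum-close : ∀ {m n} → m ℕ.≤ n →
                     ℚ.∣ riemannSum m ℚ.- riemannSum n ∣ ℚ.≤ 1/suc (m ℕ.+ m)
  riemannSum-close {m} {n} m≤n = begin
    ℚ.∣ riemannSum m ℚ.- riemannSum n ∣  ≡⟨ ∣-∣-swap (riemannSum m) (riemannSum n) ⟩
    ℚ.∣ riemannSum n ℚ.- riemannSum m ∣  ≡⟨ ℚₚ.0≤p⇒∣p∣≡p (p≤q⇒0≤q-p (riemannSum-mono (ℕₚ.≤⇒≤′ m≤n))) ⟩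
    riemannSum n ℚ.- riemannSum m        ≤⟨ ℚₚ.+-monoˡ-≤ (ℚ.- riemannSum m) (ℚₚ.≤-trans (riemannSum≤upperSum n) (upperSum-anti (ℕₚ.≤⇒≤′ m≤n))) ⟩
    upperSum m ℚ.- riemannSum m          ≡⟨ solve 2 (λ r x → (r :+ x) :- r := x) refl (riemannSum m) (1/suc (m ℕ.+ m)) ⟩
    1/suc (m ℕ.+ m)                      ∎
    where open ℚₚ.≤-Reasoning
          open +-*-Solver

  riemannSum-cauchy : Cauchy riemannSum
  riemannSum-cauchy ε 0<ε with 1/suc-small ε 0<ε
  ... | N , 1/N<ε = N , λ m n N≤m N≤n → go m n N≤m N≤n (ℕₚ.≤-total m n)
    where
    bound : ∀ {m n} → N ℕ.≤ m → m ℕ.≤ n → ℚ.∣ riemannSum m ℚ.- riemannSum n ∣ ℚ.< ε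
    bound {m} N≤m m≤n = ℚₚ.≤-<-trans (riemannSum-close m≤n)
      (ℚₚ.≤-<-trans (1/suc-anti (ℕₚ.≤-trans N≤m (ℕₚ.m≤m+n m m))) 1/N<ε)
    go : ∀ m n → N ℕ.≤ m → N ℕ.≤ n → _ → ℚ.∣ riemannSum m ℚ.- riemannSum n ∣ ℚ.< ε
    go m n N≤m N≤n (inj₁ m≤n) = bound N≤m m≤n
    go m n N≤m N≤n (inj₂ n≤m) = subst (ℚ._< ε) (∣-∣-swap (riemannSum n) (riemannSum m)) (bound N≤n n≤m)

ln2 : ℝ
ln2 = mkℝ riemannSum riemannSum-cauchy

0<2ln2 : 0ℝ < fromℕ 2 * ln2
0<2ln2 = 1ℚ , ℚₚ.positive⁻¹ 1ℚ , 1 , λ n 1≤n →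
  ℚₚ.*-monoˡ-≤-nonNeg (+ 2 ℚ./ 1) (riemannSum-mono (ℕₚ.≤⇒≤′ 1≤n))

-- m = min { f a ∣ a ∈ P }.  Attainment is stated as ¬ ¬ ∃, the classical
-- existential: which a attains the minimum cannot be computed in general.
record IsMin {A : Set} (P : Pred A 0ℓ) (f : A → ℝ) (m : ℝ) : Set where
  field
    lowerBound : ∀ a → P a → m ≤ f a
    attained   : ¬ ¬ (∃ λ a → P a × f a ≈ m)

2^-_ : ℕ → ℚ
2^- zero  = 1ℚ
2^- suc j = ½ ℚ.* 2^- j

I : ℕ → Pred ℝ 0ℓ
I j τ = fromℚ (2^- suc j) ≤ τ × τ ≤ fromℚ (2^- j)

‖_‖₁ : ∀ {n} → Vector ℝ n → ℝ
‖ v ‖₁ = foldr _+_ 0ℝ (λ i → ∣ v i ∣)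

infixl 7 _•_
infixl 6 _⊖_

_•_ : ∀ {n} → ℝ → Vector ℝ n → Vector ℝ n
(τ • c) i = τ * c i

_⊖_ : ∀ {n} → Vector ℝ n → Vector ℤ n → Vector ℝ n
(v ⊖ z) i = v i - fromℤ (z i)

IsDist : ∀ {n} → Vector ℝ n → (ℝ → ℝ) → Set
IsDist {n} c D = ∀ τ → IsMin {Vector ℤ n} U (λ z → ‖ τ • c ⊖ z ‖₁) (D τ)

C : ℝ
C = fromℚ ½ + recip (fromℕ 2 * ln2) 0<2ln2

{-# OPTIONS --safe #-}
module Submission where

-- Write m j for the minimum of the distance function over I j.  The theorem
-- holds with the constant 6/5 in place of C: since 2 ln 2 < 10/7, C exceeds 6/5.
--
-- Convergence.  Taking the lattice point 0 gives m j <= 2^-j times the l1-norm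
-- of c, so the partial sums are nondecreasing with an explicit geometric bound
-- on their growth, and they have a constructive limit (converges).  What remains
-- is the bound 6/5 n^2 for each partial sum over j < K (partial-bound).  The
-- lower bounds that define the minima suffice for it, and up to a small error
-- they can be stated for rational approximations of c and of the minima, where
-- all comparisons are decidable.  After multiplication by a common denominator
-- the statement concerns the multiples d b of a vector b in the torus (Z/Q)^n,
-- where tau = d / 2^K, and the interval I j becomes the window [2^e, 2^(e+1)] of
-- d, with e = K - 1 - j.
--
-- Counting.  Let k >= 1 of these windows be selected, those whose minimum exceeds
-- a threshold r.  There is a set S of naturals of size at least
-- (5/3) 3^(k/2) all of whose differences lie in selected windows
-- (large-separated): in a run of consecutive selected windows, equally spaced
-- copies of the set built for the windows below the run have this property.  So
-- the points d b with d in S are pairwise at l1-distance more than r Q.  On the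
-- other hand some box of side l contains at least a proportion (l/Q)^n of them
-- (crowded-box), and three points of such a box have pairwise distances of sum at
-- most 2 n l.  With r = (2/3) n (l/Q) the box holds at most two of the points, so
-- |S| (l/Q)^n <= 2 (packing).
--
-- Summation.  For the thresholds (n/3) (5/6)^i, so l/Q = (1/2) (5/6)^i, this gives
-- 15 k <= 19 n + 5 (i n + 1) (count-bound); the numbers are chosen so that
-- 4^15 <= 3^19 and (36/25)^3 <= 3.  No minimum exceeds n/3, because a point x of
-- the circle R/Z satisfies 2 |x| + |2x| <= 1 (below-cap).  Summing the parts of
-- the minima that lie between consecutive thresholds yields at most
-- (n/45) (5 + 49 n) <= 6/5 n^2 (minima-sum).

open import Data.Product.Base using (∃; _×_; _,_; proj₁; proj₂)
open import Data.Sum.Base using (_⊎_; inj₁; inj₂; [_,_]′)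
open import Data.Fin.Base using (Fin; zero; suc)
open import Data.Nat.Tactic.RingSolver using (solve-∀)
open import Data.Vec.Functional using (Vector; foldr; tail)
open import Function.Base using (_∘_)
open import Level using (0ℓ)
open import Relation.Binary.PropositionalEquality
open import Relation.Nullary using (Dec; yes; no; ¬_)
open import Relation.Nullary.Negation using (contradiction)
open import Relation.Unary using (Pred; Decidable)

-- Point sets on a line with differences in prescribed dyadic windows

module SeparatedSets where

  open import Data.Nat.Base
  open import Data.Nat.Properties
  open import Data.List.Base using (List; []; _∷_; _++_; map; length)
  open import Data.List.Properties using (length-++; length-map)
  open import Data.List.Relation.Unary.All as All using (All; []; _∷_)
  import Data.List.Relation.Unary.All.Properties as Allₚ
  open import Data.List.Relation.Unary.AllPairs as AllPairs using (AllPairs; []; _∷_)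
  import Data.List.Relation.Unary.AllPairs.Properties as AllPairsₚ

  -- A number d lies in a selected window below K: in [2^e, 2^(e+1)] for some
  -- e < K with P e.
  Window : Pred ℕ 0ℓ → ℕ → Pred ℕ 0ℓ
  Window P K d = ∃ λ e → e < K × P e × 2 ^ e ≤ d × d ≤ 2 ^ suc e

  -- 1 or 0, according to whether P holds.
  indicator : {P : Set} → Dec P → ℕ
  indicator (yes _) = 1
  indicator (no  _) = 0

  -- The number of e < K with P e.
  count : ∀ {P : Pred ℕ 0ℓ} → Decidable P → ℕ → ℕ
  count P? zero    = 0
  count P? (suc k) = indicator (P? k) + count P? k

  -- y exceeds x by an amount that satisfies G.
  Apart : Pred ℕ 0ℓ → ℕ → ℕ → Set
  Apart G x y = ∃ λ d → G d × y ≡ x + d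

  -- All points lie in [0, w], and y - x satisfies G whenever x is listed
  -- before y.
  Separated : Pred ℕ 0ℓ → ℕ → List ℕ → Set
  Separated G w xs = AllPairs (Apart G) xs × All (_≤ w) xs

  -- The union of M translates of xs by 0, D, 2D, ...
  copies : ℕ → List ℕ → ℕ → List ℕ
  copies D xs zero    = []
  copies D xs (suc M) = xs ++ map (D +_) (copies D xs M)

  length-copies : ∀ D xs M → length (copies D xs M) ≡ M * length xs
  length-copies D xs zero    = refl
  length-copies D xs (suc M) = trans (length-++ xs)
    (cong (length xs +_) (trans (length-map (D +_) (copies D xs M)) (length-copies D xs M)))

  -- The bound is M * D + w - D, written without subtraction.
  copies-bounded : ∀ D w xs → All (_≤ w) xs → ∀ M →
                   All (λ y → y + D ≤ M * D + w) (copies D xs M)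
  copies-bounded D w xs b zero    = []
  copies-bounded D w xs b (suc M) = Allₚ.++⁺
    (All.map (λ {x} x≤w → begin
      x + D          ≡⟨ +-comm x D ⟩
      D + x          ≤⟨ +-mono-≤ (m≤m+n D (M * D)) x≤w ⟩
      suc M * D + w  ∎) b)
    (Allₚ.map⁺ (All.map (λ {y} y≤ → begin
      D + y + D        ≡⟨ +-assoc D y D ⟩
      D + (y + D)      ≤⟨ +-monoʳ-≤ D y≤ ⟩
      D + (M * D + w)  ≡⟨ +-assoc D (M * D) w ⟨
      suc M * D + w    ∎) (copies-bounded D w xs b M)))
    where open ≤-Reasoning

  -- A difference between points of different copies is between D - w and
  -- (M - 1) D + w.
  copies-apart : ∀ (G : Pred ℕ 0ℓ) D w xs → w ≤ D → Separated G w xs → ∀ M →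
                 (∀ d → D ≤ d + w → d + D ≤ M * D + w → G d) →
                 AllPairs (Apart G) (copies D xs M)
  copies-apart G D w xs w≤D (ap , b) zero    good = []
  copies-apart G D w xs w≤D (ap , b) (suc M) good = AllPairsₚ.++⁺ ap
    (AllPairsₚ.map⁺ (AllPairs.map shift (copies-apart G D w xs w≤D (ap , b) M good′)))
    (All.map cross b)
    where
    open ≤-Reasoning
    good′ : ∀ d → D ≤ d + w → d + D ≤ M * D + w → G d
    good′ d l u = good d l (≤-trans u (+-monoˡ-≤ w (m≤n+m (M * D) D)))
    shift : ∀ {x y} → Apart G x y → Apart G (D + x) (D + y)
    shift {x} (d , g , refl) = d , g , sym (+-assoc D x d)
    cross : ∀ {x} → x ≤ w → All (Apart G x) (map (D +_) (copies D xs M))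
    cross {x} x≤w = Allₚ.map⁺ (All.map one (copies-bounded D w xs b M))
      where
      one : ∀ {y} → y + D ≤ M * D + w → Apart G x (D + y)
      one {y} y≤ = d , good d lower upper , sym x+d≡
        where
        d = D + y ∸ x
        x+d≡ : x + d ≡ D + y
        x+d≡ = m+[n∸m]≡n (≤-trans x≤w (≤-trans w≤D (m≤m+n D y)))
        lower : D ≤ d + w
        lower = begin
          D      ≤⟨ m≤m+n D y ⟩
          D + y  ≡⟨ x+d≡ ⟨
          x + d  ≤⟨ +-monoˡ-≤ d x≤w ⟩
          w + d  ≡⟨ +-comm w d ⟩
          d + w  ∎
        upper : d + D ≤ suc M * D + w
        upper = begin
          d + D            ≤⟨ +-monoˡ-≤ D (m∸n≤m (D + y) x) ⟩
          D + y + D        ≡⟨ +-assoc D y D ⟩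
          D + (y + D)      ≤⟨ +-monoʳ-≤ D y≤ ⟩
          D + (M * D + w)  ≡⟨ +-assoc D (M * D) w ⟨
          suc M * D + w    ∎

  window-mono : ∀ {P K K′ d} → K ≤ K′ → Window P K d → Window P K′ d
  window-mono K≤K′ (e , e<K , rest) = e , <-≤-trans e<K K≤K′ , rest

  -- The consecutive windows p, ..., p + L cover the interval [2^p, 2^(p+L+1)].
  run-covers : ∀ (P : Pred ℕ 0ℓ) p L → (∀ i → i ≤ L → P (p + i)) → ∀ d →
               2 ^ p ≤ d → d ≤ 2 ^ (p + suc L) → Window P (p + suc L) d
  run-covers P p zero    run d lo hi =
    p , m<m+n p (s≤s z≤n) , subst P (+-identityʳ p) (run 0 z≤n) , lo ,
    subst (λ q → d ≤ 2 ^ q) (+-comm p 1) hi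
  run-covers P p (suc L) run d lo hi with ≤-total d (2 ^ (p + suc L))
  ... | inj₁ d≤ = window-mono (+-monoʳ-≤ p (n≤1+n (suc L)))
                    (run-covers P p L (λ i i≤L → run i (m≤n⇒m≤1+n i≤L)) d lo d≤)
  ... | inj₂ ≤d = p + suc L , +-monoʳ-< p (n<1+n (suc L)) , run (suc L) ≤-refl , ≤d ,
                  subst (λ q → d ≤ 2 ^ q) (+-suc p (suc L)) hi

  -- Let the windows p + 1, ..., p + L be selected, and let a separated set be
  -- given in [0, h] with h = 2^p.  Copies of it at spacing 3h stay within
  -- [0, 2^(L+1) h] exactly if their number satisfies the condition fits.  The
  -- largest such number is 1, 2, 3, 6, 11, 22, 43, ... for L = 0, 1, 2, ...
  record Copies (L : ℕ) : Set where
    field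
      size   : ℕ
      fits   : 3 * size ≤ 2 ^ suc L + 2
      enough : 3 ^ L ≤ size * size

  -- At even L the terms m satisfy 3m = 2^(L+1) + 1; they are followed by 2m at
  -- L + 1 and by 4m - 1 at L + 2.
  copiesFor : ∀ L → Copies L
  copiesFor L = [ fromEven , fromOdd ]′ (evenOrOdd L)
    where
    -- The term is suc m at even L, and twice suc m at odd L.
    Even Odd : ℕ → Set
    Even L = ∃ λ m → 3 * suc m ≡ 2 ^ suc L + 1 × 3 ^ L ≤ suc m * suc m
    Odd  L = ∃ λ m → 3 * suc (m + suc m) ≡ 2 ^ suc L + 2 × 3 ^ L ≤ 3 * (suc m * suc m)

    even-odd : ∀ L → Even L → Odd (suc L)
    even-odd L (m , fit , big) = m ,
      trans (ring m) (trans (cong (2 *_) fit) (*-distribˡ-+ 2 (2 ^ suc L) 1)) , *-monoʳ-≤ 3 big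
      where
      ring : ∀ m → 3 * suc (m + suc m) ≡ 2 * (3 * suc m)
      ring = solve-∀

    odd-even : ∀ L → Odd L → Even (suc L)
    odd-even L (m , fit , big) = suc m + (m + (suc m + m)) , +-cancelʳ-≡ 3 _ _
        (trans (ring₁ m) (trans (cong (2 *_) fit) (ring₂ (2 ^ suc L)))) ,
      (begin
        3 * 3 ^ L                            ≤⟨ *-monoʳ-≤ 3 big ⟩
        3 * (3 * (suc m * suc m))            ≤⟨ m≤m+n _ (m * (7 * m + 6)) ⟩
        3 * (3 * (suc m * suc m)) + m * (7 * m + 6)  ≡⟨ ring₃ m ⟩
        suc (suc m + (m + (suc m + m))) * suc (suc m + (m + (suc m + m)))  ∎)
      where
      open ≤-Reasoning
      ring₁ : ∀ m → 3 * suc (suc m + (m + (suc m + m))) + 3 ≡ 2 * (3 * suc (m + suc m))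
      ring₁ = solve-∀
      ring₂ : ∀ x → 2 * (x + 2) ≡ 2 * x + 1 + 3
      ring₂ = solve-∀
      ring₃ : ∀ m → 3 * (3 * (suc m * suc m)) + m * (7 * m + 6) ≡
                    suc (suc m + (m + (suc m + m))) * suc (suc m + (m + (suc m + m)))
      ring₃ = solve-∀

    fromEven : ∀ {L} → Even L → Copies L
    fromEven {L} (m , fit , big) = record
      { size = suc m ; enough = big
      ; fits = ≤-trans (≤-reflexive fit) (+-monoʳ-≤ (2 ^ suc L) (n≤1+n 1)) }

    fromOdd : ∀ {L} → Odd L → Copies L
    fromOdd (m , fit , big) = record
      { size = suc (m + suc m) ; fits = ≤-reflexive fit
      ; enough = ≤-trans big (≤-trans (m≤m+n _ (suc m * suc m)) (≤-reflexive (ring m))) }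
      where
      ring : ∀ m → 3 * (suc m * suc m) + suc m * suc m ≡ suc (m + suc m) * suc (m + suc m)
      ring = solve-∀

    evenOrOdd : ∀ L → Even L ⊎ Odd L
    evenOrOdd zero    = inj₁ (0 , refl , ≤-refl)
    evenOrOdd (suc L) with evenOrOdd L
    ... | inj₁ even = inj₂ (even-odd L even)
    ... | inj₂ odd  = inj₁ (odd-even L odd)

  -- A separated set for the k selected windows below e, of size at least
  -- (5/3) 3^(k/2).
  record Large (P : Pred ℕ 0ℓ) (e k : ℕ) : Set where
    constructor large
    field
      points    : List ℕ
      separated : Separated (Window P e) (2 ^ e) points
      size      : 25 * 3 ^ k ≤ 9 * (length points * length points)

  -- The state after scanning the windows below e, of which k are selected:
  -- there are no selected ones; or they form a single run, of length L + 1, from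
  -- p to e - 1; or there is a run of length L, possibly 0, from p + 1 to e - 1
  -- above the unselected window p, and a set for the windows below p.
  -- The set for the last run is built only when the run has ended, because
  -- the number of copies does not double with every further window.
  data Shape (P : Pred ℕ 0ℓ) : (e k : ℕ) → Set where
    empty  : ∀ {e} → Shape P e 0
    lowest : ∀ {e k} p L → (∀ i → i ≤ L → P (p + i)) →
             e ≡ p + suc L → k ≡ suc L → Shape P e k
    higher : ∀ {e k} p k′ L → Large P p k′ → (∀ i → i < L → P (suc p + i)) →
             e ≡ suc p + L → k ≡ k′ + L → Shape P e k

  -- A lowest run of length L + 1 carries 2^(L+1) + 1 equally spaced points; this
  -- is where the factor 5/3 comes from.  Equality holds for L = 1.
  run-size : ∀ L → 25 * 3 ^ suc L ≤ 9 * ((2 ^ suc L + 1) * (2 ^ suc L + 1))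
  run-size 0 = ≤ᵇ⇒≤ _ _ _
  run-size 1 = ≤ᵇ⇒≤ _ _ _
  run-size (suc (suc L)) = begin
    25 * (3 * 3 ^ suc (suc L))              ≡⟨ swap 25 3 (3 ^ suc (suc L)) ⟩
    3 * (25 * 3 ^ suc (suc L))              ≤⟨ *-monoʳ-≤ 3 (run-size (suc L)) ⟩
    3 * (9 * ((x + 1) * (x + 1)))           ≡⟨ swap 3 9 ((x + 1) * (x + 1)) ⟩
    9 * (3 * ((x + 1) * (x + 1)))           ≤⟨ *-monoʳ-≤ 9 step ⟩
    9 * ((2 * x + 1) * (2 * x + 1))         ∎
    where
    open ≤-Reasoning
    x = 2 ^ suc (suc L)
    swap : ∀ a b c → a * (b * c) ≡ b * (a * c)
    swap = solve-∀
    4≤x : 4 ≤ x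
    4≤x = ^-monoʳ-≤ 2 {2} {suc (suc L)} (s≤s (s≤s z≤n))
    ring : ∀ x → 3 * ((x + 1) * (x + 1)) + x * x ≡ (2 * x + 1) * (2 * x + 1) + (2 * x + 2)
    ring = solve-∀
    2x+2≤x² : 2 * x + 2 ≤ x * x
    2x+2≤x² = begin
      2 * x + 2      ≤⟨ +-monoʳ-≤ (2 * x) (≤-trans (m≤m+n 2 2) (≤-trans 4≤x (m≤m+n x (x + 0)))) ⟩
      2 * x + 2 * x  ≡⟨ *-distribʳ-+ x 2 2 ⟨
      4 * x          ≤⟨ *-monoˡ-≤ x 4≤x ⟩
      x * x          ∎
    step : 3 * ((x + 1) * (x + 1)) ≤ (2 * x + 1) * (2 * x + 1)
    step = +-cancelʳ-≤ (x * x) _ _ (begin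
      3 * ((x + 1) * (x + 1)) + x * x        ≡⟨ ring x ⟩
      (2 * x + 1) * (2 * x + 1) + (2 * x + 2) ≤⟨ +-monoʳ-≤ ((2 * x + 1) * (2 * x + 1)) 2x+2≤x² ⟩
      (2 * x + 1) * (2 * x + 1) + x * x      ∎)

  -- A lowest run from p carries multiples of 2^p; a higher run carries copies, at
  -- spacing 3 2^p, of the set for the windows below p, which lies in [0, 2^p].
  realise : ∀ {P e k} → Shape P e (suc k) → Large P e (suc k)
  realise {P} (lowest p L run refl refl) = large
    (copies D (0 ∷ []) M)
    (copies-apart _ D 0 (0 ∷ []) z≤n (([] ∷ []) , (z≤n ∷ [])) M good , bounded)
    (subst (λ m → 25 * 3 ^ suc L ≤ 9 * (m * m))
      (sym (trans (length-copies D (0 ∷ []) M) (*-identityʳ M))) (run-size L))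
    where
    open ≤-Reasoning
    D = 2 ^ p
    M = 2 ^ suc L + 1
    MD≡ : M * D + 0 ≡ 2 ^ (p + suc L) + D
    MD≡ = trans (ring (2 ^ suc L) D) (cong (_+ D) (sym (^-distribˡ-+-* 2 p (suc L))))
      where
      ring : ∀ x d → (x + 1) * d + 0 ≡ d * x + d
      ring = solve-∀
    good : ∀ d → D ≤ d + 0 → d + D ≤ M * D + 0 → Window P (p + suc L) d
    good d lo hi = run-covers P p L run d (subst (D ≤_) (+-identityʳ d) lo)
      (+-cancelʳ-≤ D d _ (≤-trans hi (≤-reflexive MD≡)))
    bounded : All (_≤ 2 ^ (p + suc L)) (copies D (0 ∷ []) M)
    bounded = All.map (λ {y} y≤ → +-cancelʳ-≤ D y _ (≤-trans y≤ (≤-reflexive MD≡)))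
      (copies-bounded D 0 (0 ∷ []) (z≤n ∷ []) M)
  realise {P} {k = k} (higher p k′ zero (large xs (ap , b) sz) run refl k≡) = large xs
    ( AllPairs.map (λ { (d , g , eq) → d , window-mono p≤ g , eq }) ap
    , All.map (λ x≤ → ≤-trans x≤ (^-monoʳ-≤ 2 p≤)) b )
    (subst (λ j → 25 * 3 ^ j ≤ 9 * (length xs * length xs)) (sym (trans k≡ (+-identityʳ k′))) sz)
    where
    p≤ : p ≤ suc p + 0
    p≤ = ≤-trans (n≤1+n p) (m≤m+n (suc p) 0)
  realise {P} {k = k} (higher p k′ (suc L) (large xs (ap , b) sz) run refl k≡) = large
    (copies D xs M)
    (copies-apart _ D h xs (m≤m+n h _) (AllPairs.map (λ { (d , g , eq) → d , window-mono p≤ g , eq }) ap , b) M good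
      , bounded)
    big
    where
    open ≤-Reasoning
    open Copies (copiesFor (suc L)) renaming (size to M)
    h = 2 ^ p
    D = 3 * h
    p≤ : p ≤ suc p + suc L
    p≤ = ≤-trans (n≤1+n p) (m≤m+n (suc p) (suc L))
    MD≤ : M * D + h ≤ 2 ^ (suc p + suc L) + D
    MD≤ = begin
      M * (3 * h) + h                  ≡⟨ ring₁ M h ⟩
      3 * M * h + h                    ≤⟨ +-monoˡ-≤ h (*-monoˡ-≤ h fits) ⟩
      (2 ^ suc (suc L) + 2) * h + h    ≡⟨ ring₂ (2 ^ suc L) h ⟩
      2 * h * 2 ^ suc L + 3 * h        ≡⟨ cong (_+ D) (sym (^-distribˡ-+-* 2 (suc p) (suc L))) ⟩
      2 ^ (suc p + suc L) + D          ∎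
      where
      ring₁ : ∀ m h → m * (3 * h) + h ≡ 3 * m * h + h
      ring₁ = solve-∀
      ring₂ : ∀ x h → (2 * x + 2) * h + h ≡ 2 * h * x + 3 * h
      ring₂ = solve-∀
    good : ∀ d → D ≤ d + h → d + D ≤ M * D + h → Window P (suc p + suc L) d
    good d lo hi = run-covers P (suc p) L (λ i i≤L → run i (s≤s i≤L)) d
      (+-cancelʳ-≤ h (2 * h) d (≤-trans (≤-reflexive (ring h)) lo))
      (+-cancelʳ-≤ D d _ (≤-trans hi MD≤))
      where
      ring : ∀ h → 2 * h + h ≡ 3 * h
      ring = solve-∀
    bounded : All (_≤ 2 ^ (suc p + suc L)) (copies D xs M)
    bounded = All.map (λ {y} y≤ → +-cancelʳ-≤ D y _ (≤-trans y≤ MD≤)) (copies-bounded D h xs b M)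
    big : 25 * 3 ^ suc k ≤ 9 * (length (copies D xs M) * length (copies D xs M))
    big = begin
      25 * 3 ^ suc k                       ≡⟨ cong (λ j → 25 * 3 ^ j) k≡ ⟩
      25 * 3 ^ (k′ + suc L)                ≡⟨ cong (25 *_) (^-distribˡ-+-* 3 k′ (suc L)) ⟩
      25 * (3 ^ k′ * 3 ^ suc L)            ≡⟨ *-assoc 25 (3 ^ k′) (3 ^ suc L) ⟨
      25 * 3 ^ k′ * 3 ^ suc L              ≤⟨ *-mono-≤ sz enough ⟩
      9 * (ℓ * ℓ) * (M * M)                ≡⟨ ring ℓ M ⟩
      9 * ((M * ℓ) * (M * ℓ))              ≡⟨ cong (λ j → 9 * (j * j)) (sym (length-copies D xs M)) ⟩
      9 * (length (copies D xs M) * length (copies D xs M))  ∎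
      where
      ℓ = length xs
      ring : ∀ l m → 9 * (l * l) * (m * m) ≡ 9 * ((m * l) * (m * l))
      ring = solve-∀

  -- The next window is not selected, respectively selected.
  shape-skip : ∀ {P e k} → Shape P e k → Shape P (suc e) k
  shape-skip {k = zero}          s = empty
  shape-skip {e = e} {k = suc k} s = higher e (suc k) 0 (realise s) (λ i ())
    (cong suc (sym (+-identityʳ e))) (cong suc (sym (+-identityʳ k)))

  shape-take : ∀ {P e k} → P e → Shape P e k → Shape P (suc e) (suc k)
  shape-take {P} {e} Pe empty = lowest e 0
    (λ { zero _ → subst P (sym (+-identityʳ e)) Pe }) (+-comm 1 e) refl
  shape-take {P} {e} Pe (lowest p L run refl refl) = lowest p (suc L) run′ (sym (+-suc p (suc L))) refl
    where
    run′ : ∀ i → i ≤ suc L → P (p + i)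
    run′ i i≤ with m≤n⇒m<n∨m≡n i≤
    ... | inj₁ (s≤s i≤L) = run i i≤L
    ... | inj₂ refl      = Pe
  shape-take {P} {e} Pe (higher p k′ L base run refl k≡) =
    higher p k′ (suc L) base run′ (sym (+-suc (suc p) L)) (trans (cong suc k≡) (sym (+-suc k′ L)))
    where
    run′ : ∀ i → i < suc L → P (suc p + i)
    run′ i (s≤s i≤) with m≤n⇒m<n∨m≡n i≤
    ... | inj₁ i<L  = run i i<L
    ... | inj₂ refl = Pe

  shape : ∀ {P : Pred ℕ 0ℓ} (P? : Decidable P) e → Shape P e (count P? e)
  shape P? zero    = empty
  shape P? (suc e) with P? e
  ... | yes Pe = shape-take Pe (shape P? e)
  ... | no  _  = shape-skip (shape P? e)

  large-separated : ∀ {P : Pred ℕ 0ℓ} (P? : Decidable P) K {k} → count P? K ≡ suc k →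
                    Large P K (suc k)
  large-separated {P} P? K eq = realise (subst (Shape P K) eq (shape P? K))

-- Packing in the torus

module Torus where

  open SeparatedSets
  open import Data.Nat.Base
  open import Data.Nat.Properties
  open import Data.Nat.DivMod using (_/_; _%_; m<n⇒m%n≡m; [m+n]%n≡m%n; m≡m%n+[m/n]*n; m%n<n)
  open import Data.List.Base using (List; []; _∷_; length; filter)
  open import Data.List.Relation.Unary.All as All using (All; []; _∷_)
  import Data.List.Relation.Unary.All.Properties as Allₚ
  open import Data.List.Relation.Unary.AllPairs using (AllPairs; []; _∷_)
  import Data.List.Relation.Unary.AllPairs.Properties as AllPairsₚ

  -- The sum f 0 + ... + f (k - 1).
  sumUpTo : ℕ → (ℕ → ℕ) → ℕ
  sumUpTo zero    f = 0
  sumUpTo (suc k) f = sumUpTo k f + f k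

  sumUpTo-cong : ∀ k {f g} → (∀ t → t < k → f t ≡ g t) → sumUpTo k f ≡ sumUpTo k g
  sumUpTo-cong zero    eq = refl
  sumUpTo-cong (suc k) eq = cong₂ _+_ (sumUpTo-cong k (λ t t<k → eq t (m<n⇒m<1+n t<k))) (eq k ≤-refl)

  sumUpTo-+ : ∀ k f g → sumUpTo k (λ t → f t + g t) ≡ sumUpTo k f + sumUpTo k g
  sumUpTo-+ zero    f g = refl
  sumUpTo-+ (suc k) f g = trans (cong (_+ (f k + g k)) (sumUpTo-+ k f g))
    (ring (sumUpTo k f) (sumUpTo k g) (f k) (g k))
    where
    ring : ∀ a b c d → a + b + (c + d) ≡ a + c + (b + d)
    ring = solve-∀

  sumUpTo-0 : ∀ k → sumUpTo k (λ _ → 0) ≡ 0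
  sumUpTo-0 zero    = refl
  sumUpTo-0 (suc k) = trans (+-identityʳ _) (sumUpTo-0 k)

  sumUpTo-shift : ∀ k h → sumUpTo k (h ∘ suc) + h 0 ≡ sumUpTo k h + h k
  sumUpTo-shift zero    h = refl
  sumUpTo-shift (suc k) h = begin
    sumUpTo k (h ∘ suc) + h (suc k) + h 0    ≡⟨ ring (sumUpTo k (h ∘ suc)) (h (suc k)) (h 0) ⟩
    sumUpTo k (h ∘ suc) + h 0 + h (suc k)    ≡⟨ cong (_+ h (suc k)) (sumUpTo-shift k h) ⟩
    sumUpTo k h + h k + h (suc k)            ∎
    where
    open ≡-Reasoning
    ring : ∀ a b c → a + b + c ≡ a + c + b
    ring = solve-∀

  -- Some term is at least the average.
  above-average : ∀ k .{{_ : NonZero k}} f → ∃ λ t → sumUpTo k f ≤ k * f t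
  above-average 1             f = 0 , ≤-reflexive (sym (*-identityˡ (f 0)))
  above-average (suc (suc k)) f with above-average (suc k) f
  ... | t , avg with ≤-total (f t) (f (suc k))
  ...   | inj₁ ft≤ = suc k , (begin
    sumUpTo (suc k) f + f (suc k)       ≤⟨ +-monoˡ-≤ (f (suc k)) (≤-trans avg (*-monoʳ-≤ (suc k) ft≤)) ⟩
    suc k * f (suc k) + f (suc k)       ≡⟨ +-comm _ (f (suc k)) ⟩
    suc (suc k) * f (suc k)             ∎)
    where open ≤-Reasoning
  ...   | inj₂ ≤ft = t , (begin
    sumUpTo (suc k) f + f (suc k)       ≤⟨ +-mono-≤ avg ≤ft ⟩
    suc k * f t + f t                   ≡⟨ +-comm _ (f t) ⟩
    suc (suc k) * f t                   ∎)
    where open ≤-Reasoning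

  -- The residues x + t with t < Q run through all residues modulo Q.
  sumUpTo-% : ∀ Q .{{_ : NonZero Q}} g x → sumUpTo Q (λ t → g ((x + t) % Q)) ≡ sumUpTo Q g
  sumUpTo-% Q g zero    = sumUpTo-cong Q (λ t t<Q → cong g (m<n⇒m%n≡m t<Q))
  sumUpTo-% Q g (suc x) = begin
    sumUpTo Q (λ t → g ((suc x + t) % Q))  ≡⟨ sumUpTo-cong Q (λ t _ → cong (λ y → g (y % Q)) (sym (+-suc x t))) ⟩
    sumUpTo Q (h ∘ suc)                    ≡⟨ +-cancelʳ-≡ (h 0) _ _ (trans (sumUpTo-shift Q h) (cong (sumUpTo Q h +_) hQ≡h0)) ⟩
    sumUpTo Q h                            ≡⟨ sumUpTo-% Q g x ⟩
    sumUpTo Q g                            ∎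
    where
    open ≡-Reasoning
    h = λ t → g ((x + t) % Q)
    hQ≡h0 : h Q ≡ h 0
    hQ≡h0 = cong g (trans ([m+n]%n≡m%n x Q) (cong (_% Q) (sym (+-identityʳ x))))

  length-filter-∷ : ∀ {P : Pred ℕ 0ℓ} (P? : Decidable P) x xs →
                    length (filter P? (x ∷ xs)) ≡ length (filter P? xs) + indicator (P? x)
  length-filter-∷ P? x xs with P? x
  ... | yes _ = +-comm 1 _
  ... | no  _ = sym (+-identityʳ _)

  sumUpTo-<? : ∀ l k → k ⊓ l ≤ sumUpTo k (λ t → indicator (t <? l))
  sumUpTo-<? l zero    = z≤n
  sumUpTo-<? l (suc k) with k <? l
  ... | yes k<l = begin
    suc k ⊓ l      ≤⟨ m⊓n≤m (suc k) l ⟩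
    suc k          ≡⟨ cong suc (m≤n⇒m⊓n≡m (<⇒≤ k<l)) ⟨
    suc (k ⊓ l)    ≤⟨ s≤s (sumUpTo-<? l k) ⟩
    suc _          ≡⟨ +-comm 1 _ ⟩
    _ + 1          ∎
    where open ≤-Reasoning
  ... | no k≮l = begin
    suc k ⊓ l      ≤⟨ m⊓n≤n (suc k) l ⟩
    l              ≡⟨ m≥n⇒m⊓n≡n (≮⇒≥ k≮l) ⟨
    k ⊓ l          ≤⟨ sumUpTo-<? l k ⟩
    _              ≡⟨ +-identityʳ _ ⟨
    _ + 0          ∎
    where open ≤-Reasoning

  -- Among the Q translates of an interval of l residues modulo Q, some one
  -- contains at least the proportion l / Q of the given points.
  module _ (Q : ℕ) .{{_ : NonZero Q}} (l : ℕ) (l≤Q : l ≤ Q) where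

    -- φ x lies in the translate of [0, l) by - t.
    InArc : (ℕ → ℕ) → ℕ → Pred ℕ 0ℓ
    InArc φ t x = (φ x + t) % Q < l

    inArc? : ∀ φ t → Decidable (InArc φ t)
    inArc? φ t x = (φ x + t) % Q <? l

    arcs-total : ∀ φ xs → length xs * l ≤ sumUpTo Q (λ t → length (filter (inArc? φ t) xs))
    arcs-total φ []       = z≤n
    arcs-total φ (x ∷ xs) = begin
      l + length xs * l
        ≡⟨ +-comm l _ ⟩
      length xs * l + l
        ≡⟨ cong (length xs * l +_) (sym (m≥n⇒m⊓n≡n l≤Q)) ⟩
      length xs * l + Q ⊓ l
        ≤⟨ +-mono-≤ (arcs-total φ xs) (sumUpTo-<? l Q) ⟩
      sumUpTo Q (λ t → length (filter (inArc? φ t) xs)) + sumUpTo Q (λ v → indicator (v <? l))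
        ≡⟨ cong (_ +_) (sumUpTo-% Q (λ v → indicator (v <? l)) (φ x)) ⟨
      sumUpTo Q (λ t → length (filter (inArc? φ t) xs)) + sumUpTo Q (λ t → indicator (inArc? φ t x))
        ≡⟨ sumUpTo-+ Q _ _ ⟨
      sumUpTo Q (λ t → length (filter (inArc? φ t) xs) + indicator (inArc? φ t x))
        ≡⟨ sumUpTo-cong Q (λ t _ → sym (length-filter-∷ (inArc? φ t) x xs)) ⟩
      sumUpTo Q (λ t → length (filter (inArc? φ t) (x ∷ xs)))
        ∎
      where open ≤-Reasoning

    -- Applied to each of n coordinates in turn, this finds a box of side l in
    -- the n-dimensional torus that contains at least the proportion (l / Q)^n of
    -- the points.  The filtering preserves any relation R between the points.
    crowded-box : ∀ {R : ℕ → ℕ → Set} n (φ : Fin n → ℕ → ℕ) xs → AllPairs R xs →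
      ∃ λ (t : Vector ℕ n) → ∃ λ ys → AllPairs R ys ×
        All (λ y → ∀ i → InArc (φ i) (t i) y) ys × length xs * l ^ n ≤ Q ^ n * length ys
    crowded-box zero    φ xs ap =
      (λ ()) , xs , ap , All.universal (λ _ ()) xs ,
      ≤-reflexive (*-comm (length xs) 1)
    crowded-box (suc n) φ xs ap with crowded-box n (φ ∘ suc) xs ap
    ... | t , ys , apy , box , dense
      with above-average Q (λ t₀ → length (filter (inArc? (φ zero) t₀) ys))
    ...   | t₀ , avg =
      (λ { zero → t₀ ; (suc i) → t i }) , zs , AllPairsₚ.filter⁺ (inArc? (φ zero) t₀) apy ,
      All.zipWith (λ { (p₀ , p) zero → p₀ ; (p₀ , p) (suc i) → p i })
        (Allₚ.all-filter (inArc? (φ zero) t₀) ys , Allₚ.filter⁺ (inArc? (φ zero) t₀) box) ,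
      (begin
        length xs * (l * l ^ n)      ≡⟨ swap (length xs) l (l ^ n) ⟩
        length xs * l ^ n * l        ≤⟨ *-monoˡ-≤ l dense ⟩
        Q ^ n * length ys * l        ≡⟨ *-assoc (Q ^ n) (length ys) l ⟩
        Q ^ n * (length ys * l)      ≤⟨ *-monoʳ-≤ (Q ^ n) (≤-trans (arcs-total (φ zero) ys) avg) ⟩
        Q ^ n * (Q * length zs)      ≡⟨ swap′ (Q ^ n) Q (length zs) ⟩
        Q * Q ^ n * length zs        ∎)
      where
      open ≤-Reasoning
      zs = filter (inArc? (φ zero) t₀) ys
      swap : ∀ a b c → a * (b * c) ≡ a * c * b
      swap = solve-∀
      swap′ : ∀ a b c → a * (b * c) ≡ b * a * c
      swap′ = solve-∀

  -- The two shorter of the three distances add up to the longest.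
  spread₃ : ∀ l {a b c} → a ≤ l → b ≤ l → c ≤ l →
            ∣ a - b ∣ + ∣ b - c ∣ + ∣ a - c ∣ ≤ 2 * l
  spread₃ l {a} {b} {c} a≤l b≤l c≤l = go (≤-total a b) (≤-total b c) (≤-total a c)
    where
    open ≤-Reasoning
    sorted : ∀ {a b c} → c ≤ l → a ≤ b → b ≤ c → ∣ a - b ∣ + ∣ b - c ∣ + ∣ a - c ∣ ≤ 2 * l
    sorted {a} {b} {c} c≤l a≤b b≤c = begin
      ∣ a - b ∣ + ∣ b - c ∣ + ∣ a - c ∣
        ≡⟨ cong₂ _+_ (cong₂ _+_ (m≤n⇒∣m-n∣≡n∸m a≤b) (m≤n⇒∣m-n∣≡n∸m b≤c)) (m≤n⇒∣m-n∣≡n∸m (≤-trans a≤b b≤c)) ⟩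
      b ∸ a + (c ∸ b) + (c ∸ a)
        ≡⟨ cong (_+ (c ∸ a)) (+-cancelʳ-≡ a _ _ telescope) ⟩
      c ∸ a + (c ∸ a)
        ≤⟨ +-mono-≤ (≤-trans (m∸n≤m c a) c≤l) (≤-trans (m∸n≤m c a) c≤l) ⟩
      l + l
        ≡⟨ cong (l +_) (sym (+-identityʳ l)) ⟩
      2 * l ∎
      where
      swap : ∀ x y z → x + y + z ≡ y + (x + z)
      swap = solve-∀
      telescope : b ∸ a + (c ∸ b) + a ≡ c ∸ a + a
      telescope = trans (swap (b ∸ a) (c ∸ b) a)
        (trans (cong (c ∸ b +_) (m∸n+n≡m a≤b))
          (trans (m∸n+n≡m b≤c) (sym (m∸n+n≡m (≤-trans a≤b b≤c)))))
    via : ∀ {x y} → x ≡ y → y ≤ 2 * l → x ≤ 2 * l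
    via eq = subst (_≤ 2 * l) (sym eq)
    ab = ∣-∣-comm a b
    bc = ∣-∣-comm b c
    ac = ∣-∣-comm a c
    p₁ : ∀ x y z → x + y + z ≡ z + y + x
    p₁ = solve-∀
    p₂ : ∀ x y z → x + y + z ≡ z + x + y
    p₂ = solve-∀
    p₃ : ∀ x y z → x + y + z ≡ x + z + y
    p₃ = solve-∀
    p₄ : ∀ x y z → x + y + z ≡ y + z + x
    p₄ = solve-∀
    p₅ : ∀ x y z → x + y + z ≡ y + x + z
    p₅ = solve-∀
    go : a ≤ b ⊎ b ≤ a → b ≤ c ⊎ c ≤ b → a ≤ c ⊎ c ≤ a → _
    go (inj₁ a≤b) (inj₁ b≤c) _          = sorted c≤l a≤b b≤c
    go (inj₁ a≤b) (inj₂ c≤b) (inj₁ a≤c) = via (trans (cong (λ z → ∣ a - b ∣ + z + ∣ a - c ∣) bc) (p₁ ∣ a - b ∣ ∣ c - b ∣ ∣ a - c ∣)) (sorted b≤l a≤c c≤b)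
    go (inj₁ a≤b) (inj₂ c≤b) (inj₂ c≤a) = via (trans (cong₂ (λ y z → ∣ a - b ∣ + y + z) bc ac) (p₂ ∣ a - b ∣ ∣ c - b ∣ ∣ c - a ∣)) (sorted b≤l c≤a a≤b)
    go (inj₂ b≤a) (inj₁ b≤c) (inj₁ a≤c) = via (trans (cong (λ x → x + ∣ b - c ∣ + ∣ a - c ∣) ab) (p₃ ∣ b - a ∣ ∣ b - c ∣ ∣ a - c ∣)) (sorted c≤l b≤a a≤c)
    go (inj₂ b≤a) (inj₁ b≤c) (inj₂ c≤a) = via (trans (cong₂ (λ x z → x + ∣ b - c ∣ + z) ab ac) (p₄ ∣ b - a ∣ ∣ b - c ∣ ∣ c - a ∣)) (sorted a≤l b≤c c≤a)
    go (inj₂ b≤a) (inj₂ c≤b) _          = via (trans (cong₂ _+_ (cong₂ _+_ ab bc) ac) (p₅ ∣ b - a ∣ ∣ c - b ∣ ∣ c - a ∣)) (sorted a≤l c≤b b≤a)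

  -- The l1-distance between two vectors of naturals.
  dist₁ : ∀ {n} → Vector ℕ n → Vector ℕ n → ℕ
  dist₁ u v = foldr _+_ 0 (λ i → ∣ u i - v i ∣)

  dist₁-spread₃ : ∀ l n {u v w : Vector ℕ n} → (∀ i → u i ≤ l) → (∀ i → v i ≤ l) → (∀ i → w i ≤ l) →
                  dist₁ u v + dist₁ v w + dist₁ u w ≤ n * (2 * l)
  dist₁-spread₃ l zero    hu hv hw = z≤n
  dist₁-spread₃ l (suc n) {u} {v} {w} hu hv hw = begin
    dist₁ u v + dist₁ v w + dist₁ u w
      ≡⟨ ring (∣ u zero - v zero ∣) (dist₁ (tail u) (tail v)) (∣ v zero - w zero ∣) (dist₁ (tail v) (tail w)) (∣ u zero - w zero ∣) (dist₁ (tail u) (tail w)) ⟩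
    (∣ u zero - v zero ∣ + ∣ v zero - w zero ∣ + ∣ u zero - w zero ∣) +
    (dist₁ (tail u) (tail v) + dist₁ (tail v) (tail w) + dist₁ (tail u) (tail w))
      ≤⟨ +-mono-≤ (spread₃ l (hu zero) (hv zero) (hw zero)) (dist₁-spread₃ l n (hu ∘ suc) (hv ∘ suc) (hw ∘ suc)) ⟩
    2 * l + n * (2 * l) ∎
    where
    open ≤-Reasoning
    ring : ∀ a a′ b b′ c c′ → (a + a′) + (b + b′) + (c + c′) ≡ (a + b + c) + (a′ + b′ + c′)
    ring = solve-∀

  -- Congruence modulo Q.
  infix 4 _≡_mod_
  _≡_mod_ : ℕ → ℕ → ℕ → Set
  x ≡ y mod Q = ∃ λ w → ∃ λ w′ → x + w * Q ≡ y + w′ * Q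

  -- The vectors u and v differ by d b modulo Q.  The l1-distance of d b from the
  -- multiples of Q is the least distance of such u and v.
  Represents : ∀ {n} → ℕ → Vector ℕ n → ℕ → Vector ℕ n → Vector ℕ n → Set
  Represents Q b d u v = ∀ i → v i ≡ u i + d * b i mod Q

  residue-step : ∀ Q .{{_ : NonZero Q}} b t x d →
                 ((x + d) * b + t) % Q ≡ (x * b + t) % Q + d * b mod Q
  residue-step Q b t x d = ((x + d) * b + t) / Q , (x * b + t) / Q , (begin
    ((x + d) * b + t) % Q + ((x + d) * b + t) / Q * Q   ≡⟨ m≡m%n+[m/n]*n ((x + d) * b + t) Q ⟨
    (x + d) * b + t                                     ≡⟨ ring x d b t ⟩
    x * b + t + d * b                                   ≡⟨ cong (_+ d * b) (m≡m%n+[m/n]*n (x * b + t) Q) ⟩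
    (x * b + t) % Q + (x * b + t) / Q * Q + d * b       ≡⟨ ring′ ((x * b + t) % Q) ((x * b + t) / Q * Q) (d * b) ⟩
    (x * b + t) % Q + d * b + (x * b + t) / Q * Q       ∎)
    where
    open ≡-Reasoning
    ring : ∀ x d b t → (x + d) * b + t ≡ x * b + t + d * b
    ring = solve-∀
    ring′ : ∀ a b c → a + b + c ≡ a + c + b
    ring′ = solve-∀

  module _ {n} (Q : ℕ) .{{_ : NonZero Q}} (l : ℕ) (l≤Q : l ≤ Q) (b : Vector ℕ n) (G : Pred ℕ 0ℓ)
    (far : ∀ d → G d → ∀ u v → Represents Q b d u v → n * (2 * l) < 3 * dist₁ u v) where

    -- A box contains no three points that are pairwise apart, because their
    -- pairwise distances would add up to more than 2 n l.
    no-three : ∀ (t : Vector ℕ n) {x y z} → Apart G x y → Apart G y z → Apart G x z →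
               (∀ i → (x * b i + t i) % Q < l) → (∀ i → (y * b i + t i) % Q < l) →
               ¬ (∀ i → (z * b i + t i) % Q < l)
    no-three t {x} {y} {z} (d₁ , g₁ , y≡) (d₂ , g₂ , z≡) (d₃ , g₃ , z≡′) hx hy hz =
      <-irrefl refl (begin-strict
        3 * (n * (2 * l))
          ≡⟨ ring₁ (n * (2 * l)) ⟩
        n * (2 * l) + n * (2 * l) + n * (2 * l)
          <⟨ +-mono-< (+-mono-< (far d₁ g₁ u v (rep {x} {y} {d₁} y≡)) (far d₂ g₂ v w (rep {y} {z} {d₂} z≡))) (far d₃ g₃ u w (rep {x} {z} {d₃} z≡′)) ⟩
        3 * dist₁ u v + 3 * dist₁ v w + 3 * dist₁ u w
          ≡⟨ ring₂ (dist₁ u v) (dist₁ v w) (dist₁ u w) ⟩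
        3 * (dist₁ u v + dist₁ v w + dist₁ u w)
          ≤⟨ *-monoʳ-≤ 3 (dist₁-spread₃ l n (<⇒≤ ∘ hx) (<⇒≤ ∘ hy) (<⇒≤ ∘ hz)) ⟩
        3 * (n * (2 * l)) ∎)
      where
      open ≤-Reasoning
      u v w : Vector ℕ n
      u i = (x * b i + t i) % Q
      v i = (y * b i + t i) % Q
      w i = (z * b i + t i) % Q
      rep : ∀ {x y d} → y ≡ x + d →
            Represents Q b d (λ i → (x * b i + t i) % Q) (λ i → (y * b i + t i) % Q)
      rep {x} {d = d} refl i = residue-step Q (b i) (t i) x d
      ring₁ : ∀ x → 3 * x ≡ x + x + x
      ring₁ = solve-∀
      ring₂ : ∀ x y z → 3 * x + 3 * y + 3 * z ≡ 3 * (x + y + z)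
      ring₂ = solve-∀

    packing : ∀ xs → AllPairs (Apart G) xs → length xs * l ^ n ≤ Q ^ n * 2
    packing xs ap with crowded-box Q l l≤Q n (λ i x → x * b i) xs ap
    ... | t , ys , apy , box , dense = ≤-trans dense (*-monoʳ-≤ (Q ^ n) (atMostTwo ys apy box))
      where
      atMostTwo : ∀ ys → AllPairs (Apart G) ys → All (λ y → ∀ i → (y * b i + t i) % Q < l) ys →
                  length ys ≤ 2
      atMostTwo []          _ _ = z≤n
      atMostTwo (_ ∷ [])     _ _ = s≤s z≤n
      atMostTwo (_ ∷ _ ∷ []) _ _ = s≤s (s≤s z≤n)
      atMostTwo (x ∷ y ∷ z ∷ _) ((xy ∷ xz ∷ _) ∷ (yz ∷ _) ∷ _) (bx ∷ by ∷ bz ∷ _) =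
        contradiction bz (no-three t xy yz xz bx by)

  ^-distribʳ-* : ∀ n x y → (x * y) ^ n ≡ x ^ n * y ^ n
  ^-distribʳ-* zero    x y = refl
  ^-distribʳ-* (suc n) x y = trans (cong (x * y *_) (^-distribʳ-* n x y))
    (*-interchange x y (x ^ n) (y ^ n))
    where
    *-interchange : ∀ a b c d → a * b * (c * d) ≡ a * c * (b * d)
    *-interchange = solve-∀

  -- Taking logarithms, with log 4 <= (19/15) log 3 and
  -- log (36/25) <= (1/3) log 3, both used in the form of their 15th powers.
  log-bound : ∀ k n m → 3 ^ k * 25 ^ m ≤ 4 ^ n * 36 ^ m → 15 * k ≤ 19 * n + 5 * m
  log-bound k n m le = ≮⇒≥ λ lt → <-irrefl refl (begin-strict
    3 ^ (19 * n + 5 * m) * 25 ^ (15 * m)              <⟨ *-monoˡ-< (25 ^ (15 * m)) (^-monoʳ-< 3 (s≤s (s≤s z≤n)) lt) ⟩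
    3 ^ (15 * k) * 25 ^ (15 * m)                      ≡⟨ cong₂ _*_ (pow 3 15 k) (pow 25 15 m) ⟩
    (3 ^ k) ^ 15 * (25 ^ m) ^ 15                      ≡⟨ ^-distribʳ-* 15 (3 ^ k) (25 ^ m) ⟨
    (3 ^ k * 25 ^ m) ^ 15                             ≤⟨ ^-monoˡ-≤ 15 le ⟩
    (4 ^ n * 36 ^ m) ^ 15                             ≡⟨ ^-distribʳ-* 15 (4 ^ n) (36 ^ m) ⟩
    (4 ^ n) ^ 15 * (36 ^ m) ^ 15                      ≡⟨ cong₂ _*_ (swap 4 15 n) (swap 36 15 m) ⟩
    (4 ^ 15) ^ n * (36 ^ 15) ^ m                      ≤⟨ *-mono-≤ (^-monoˡ-≤ n (≤ᵇ⇒≤ (4 ^ 15) (3 ^ 19) _)) (^-monoˡ-≤ m (≤ᵇ⇒≤ (36 ^ 15) (3 ^ 5 * 25 ^ 15) _)) ⟩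
    (3 ^ 19) ^ n * (3 ^ 5 * 25 ^ 15) ^ m              ≡⟨ cong ((3 ^ 19) ^ n *_) (^-distribʳ-* m (3 ^ 5) (25 ^ 15)) ⟩
    (3 ^ 19) ^ n * ((3 ^ 5) ^ m * (25 ^ 15) ^ m)      ≡⟨ cong₂ _*_ (^-*-assoc 3 19 n) (cong₂ _*_ (^-*-assoc 3 5 m) (^-*-assoc 25 15 m)) ⟩
    3 ^ (19 * n) * (3 ^ (5 * m) * 25 ^ (15 * m))      ≡⟨ *-assoc (3 ^ (19 * n)) (3 ^ (5 * m)) (25 ^ (15 * m)) ⟨
    3 ^ (19 * n) * 3 ^ (5 * m) * 25 ^ (15 * m)        ≡⟨ cong (_* 25 ^ (15 * m)) (^-distribˡ-+-* 3 (19 * n) (5 * m)) ⟨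
    3 ^ (19 * n + 5 * m) * 25 ^ (15 * m)              ∎)
    where
    open ≤-Reasoning
    instance
      25^≢0 : NonZero (25 ^ (15 * m))
      25^≢0 = m^n≢0 25 (15 * m)
    pow : ∀ a c k → a ^ (c * k) ≡ (a ^ k) ^ c
    pow a c k = trans (cong (a ^_) (*-comm c k)) (sym (^-*-assoc a k c))
    swap : ∀ a c k → (a ^ k) ^ c ≡ (a ^ c) ^ k
    swap a c k = trans (sym (pow a c k)) (sym (^-*-assoc a c k))

  module _ {n} (g : ℕ) .{{_ : NonZero g}} (i : ℕ) (b : Vector ℕ n)
    {P : Pred ℕ 0ℓ} (P? : Decidable P) (K : ℕ) where

    private
      l Q : ℕ
      l = g * 5 ^ i
      Q = g * (2 * 6 ^ i)

    -- Here l / Q = (1/2) (5/6)^i.  Squaring the packing bound, with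
    -- 9 |S|^2 >= 25 3^k, gives 3^k <= (36/25)^(i n + 1) 4^n.
    count-bound : (∀ d → Window P K d → ∀ u v → Represents Q b d u v → n * (2 * l) < 3 * dist₁ u v) →
                  15 * count P? K ≤ 19 * n + 5 * (i * n + 1)
    count-bound far with count P? K in eq
    ... | zero  = z≤n
    ... | suc k with large-separated P? K eq
    ...   | large xs (ap , _) size = log-bound (suc k) n (i * n + 1)
      (*-cancelʳ-≤ _ _ (g ^ n * g ^ n) (begin
        3 ^ suc k * 25 ^ (i * n + 1) * (g ^ n * g ^ n)
          ≡⟨ cong (λ y → 3 ^ suc k * y * (g ^ n * g ^ n)) (^-distribˡ-+-* 25 (i * n) 1) ⟩
        3 ^ suc k * (25 ^ (i * n) * 25) * (g ^ n * g ^ n)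
          ≡⟨ cong (λ y → 3 ^ suc k * (y * 25) * (g ^ n * g ^ n)) (^-distribʳ-* (i * n) 5 5) ⟩
        3 ^ suc k * (5 ^ (i * n) * 5 ^ (i * n) * 25) * (g ^ n * g ^ n)
          ≡⟨ ring₁ (3 ^ suc k) (5 ^ (i * n)) (g ^ n) ⟩
        25 * 3 ^ suc k * ((g ^ n * 5 ^ (i * n)) * (g ^ n * 5 ^ (i * n)))
          ≡⟨ cong (λ y → 25 * 3 ^ suc k * (y * y)) (lⁿ 5) ⟨
        25 * 3 ^ suc k * (l ^ n * l ^ n)
          ≤⟨ *-monoˡ-≤ (l ^ n * l ^ n) size ⟩
        9 * (M * M) * (l ^ n * l ^ n)
          ≡⟨ ring₂ M (l ^ n) ⟩
        9 * ((M * l ^ n) * (M * l ^ n))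
          ≤⟨ *-monoʳ-≤ 9 (*-mono-≤ few few) ⟩
        9 * ((Q ^ n * 2) * (Q ^ n * 2))
          ≡⟨ cong (λ y → 9 * ((y * 2) * (y * 2))) Qⁿ ⟩
        9 * ((2 ^ n * (g ^ n * 6 ^ (i * n)) * 2) * (2 ^ n * (g ^ n * 6 ^ (i * n)) * 2))
          ≡⟨ ring₃ (2 ^ n) (g ^ n) (6 ^ (i * n)) ⟩
        2 ^ n * 2 ^ n * (6 ^ (i * n) * 6 ^ (i * n) * 36) * (g ^ n * g ^ n)
          ≡⟨ cong₂ (λ x y → x * (y * 36) * (g ^ n * g ^ n)) (^-distribʳ-* n 2 2) (^-distribʳ-* (i * n) 6 6) ⟨
        4 ^ n * (36 ^ (i * n) * 36) * (g ^ n * g ^ n)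
          ≡⟨ cong (λ y → 4 ^ n * y * (g ^ n * g ^ n)) (^-distribˡ-+-* 36 (i * n) 1) ⟨
        4 ^ n * 36 ^ (i * n + 1) * (g ^ n * g ^ n) ∎))
      where
      open ≤-Reasoning
      M = length xs
      instance
        6^≢0 : NonZero (6 ^ i)
        6^≢0 = m^n≢0 6 i
        2*6^≢0 : NonZero (2 * 6 ^ i)
        2*6^≢0 = m*n≢0 2 (6 ^ i)
        Q≢0 : NonZero Q
        Q≢0 = m*n≢0 g (2 * 6 ^ i)
        gⁿ≢0 : NonZero (g ^ n)
        gⁿ≢0 = m^n≢0 g n
        gⁿgⁿ≢0 : NonZero (g ^ n * g ^ n)
        gⁿgⁿ≢0 = m*n≢0 (g ^ n) (g ^ n)
      l≤Q : l ≤ Q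
      l≤Q = *-monoʳ-≤ g (≤-trans (^-monoˡ-≤ i (n≤1+n 5)) (m≤n*m (6 ^ i) 2))
      few : M * l ^ n ≤ Q ^ n * 2
      few = packing Q l l≤Q b (Window P K) far xs ap
      lⁿ : ∀ a → (g * a ^ i) ^ n ≡ g ^ n * a ^ (i * n)
      lⁿ a = trans (^-distribʳ-* n g (a ^ i)) (cong (g ^ n *_) (^-*-assoc a i n))
      Qⁿ : Q ^ n ≡ 2 ^ n * (g ^ n * 6 ^ (i * n))
      Qⁿ = trans (cong (_^ n) (swap g 2 (6 ^ i)))
        (trans (^-distribʳ-* n 2 (g * 6 ^ i)) (cong (2 ^ n *_) (lⁿ 6)))
        where
        swap : ∀ a b c → a * (b * c) ≡ b * (a * c)
        swap = solve-∀
      ring₁ : ∀ t f g → t * (f * f * 25) * (g * g) ≡ 25 * t * ((g * f) * (g * f))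
      ring₁ = solve-∀
      ring₂ : ∀ m l → 9 * (m * m) * (l * l) ≡ 9 * ((m * l) * (m * l))
      ring₂ = solve-∀
      ring₃ : ∀ t g s → 9 * ((t * (g * s) * 2) * (t * (g * s) * 2)) ≡ t * t * (s * s * 36) * (g * g)
      ring₃ = solve-∀

  -- With x the residue of d b modulo Q, d b has distance min(x, Q - x) from the
  -- multiples of Q, and 2 d b has distance at most |Q - 2x|.  Twice the former
  -- plus the latter is Q.
  double-arc : ∀ Q .{{_ : NonZero Q}} d b → ∃ λ u → ∃ λ v → ∃ λ u′ → ∃ λ v′ →
               v ≡ u + d * b mod Q × v′ ≡ u′ + 2 * d * b mod Q × 2 * ∣ u - v ∣ + ∣ u′ - v′ ∣ ≡ Q
  double-arc Q d b with ≤-total (2 * ((d * b) % Q)) Q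
  ... | inj₁ 2x≤Q = 0 , x , Q , 2 * x , (w , 0 , rep) , (2 * w + 1 , 0 , rep′) ,
    trans (cong (2 * x +_) (trans (∣-∣-comm Q (2 * x)) (m≤n⇒∣m-n∣≡n∸m 2x≤Q))) (m+[n∸m]≡n 2x≤Q)
    where
    x = (d * b) % Q
    w = (d * b) / Q
    rep : x + w * Q ≡ d * b + 0
    rep = trans (sym (m≡m%n+[m/n]*n (d * b) Q)) (sym (+-identityʳ (d * b)))
    rep′ : 2 * x + (2 * w + 1) * Q ≡ Q + 2 * d * b + 0
    rep′ = trans (ring₁ x w Q) (trans (cong (λ y → 2 * y + Q) (sym (m≡m%n+[m/n]*n (d * b) Q))) (ring₂ d b Q))
      where
      ring₁ : ∀ x w Q → 2 * x + (2 * w + 1) * Q ≡ 2 * (x + w * Q) + Q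
      ring₁ = solve-∀
      ring₂ : ∀ d b Q → 2 * (d * b) + Q ≡ Q + 2 * d * b + 0
      ring₂ = solve-∀
  ... | inj₂ Q≤2x = Q , x , Q , 2 * x , (w + 1 , 0 , rep) , (2 * w + 1 , 0 , rep′) ,
    +-cancelʳ-≡ Q _ _ (trans (cong₂ (λ y z → 2 * y + z + Q) (trans (∣-∣-comm Q x) (m≤n⇒∣m-n∣≡n∸m x≤Q)) (m≤n⇒∣m-n∣≡n∸m Q≤2x))
      (trans (+-assoc (2 * (Q ∸ x)) (2 * x ∸ Q) Q) (trans (cong (2 * (Q ∸ x) +_) (m∸n+n≡m Q≤2x))
        (trans (sym (*-distribˡ-+ 2 (Q ∸ x) x)) (trans (cong (2 *_) (m∸n+n≡m x≤Q)) (cong (Q +_) (+-identityʳ Q)))))))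
    where
    x = (d * b) % Q
    w = (d * b) / Q
    x≤Q : x ≤ Q
    x≤Q = <⇒≤ (m%n<n (d * b) Q)
    rep : x + (w + 1) * Q ≡ Q + d * b + 0
    rep = trans (ring₁ x w Q) (trans (cong (λ y → Q + y + 0) (sym (m≡m%n+[m/n]*n (d * b) Q))) refl)
      where
      ring₁ : ∀ x w Q → x + (w + 1) * Q ≡ Q + (x + w * Q) + 0
      ring₁ = solve-∀
    rep′ : 2 * x + (2 * w + 1) * Q ≡ Q + 2 * d * b + 0
    rep′ = trans (ring₁ x w Q) (trans (cong (λ y → 2 * y + Q) (sym (m≡m%n+[m/n]*n (d * b) Q))) (ring₂ d b Q))
      where
      ring₁ : ∀ x w Q → 2 * x + (2 * w + 1) * Q ≡ 2 * (x + w * Q) + Q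
      ring₁ = solve-∀
      ring₂ : ∀ d b Q → 2 * (d * b) + Q ≡ Q + 2 * d * b + 0
      ring₂ = solve-∀

  double-arcs : ∀ {n} Q .{{_ : NonZero Q}} d (b : Vector ℕ n) → ∃ λ u → ∃ λ v → ∃ λ u′ → ∃ λ v′ →
                Represents Q b d u v × Represents Q b (2 * d) u′ v′ ×
                2 * dist₁ u v + dist₁ u′ v′ ≡ n * Q
  double-arcs {n} Q d b =
    u , v , u′ , v′ , (λ i → proj₁ (rest i)) , (λ i → proj₁ (proj₂ (rest i))) ,
    total n u v u′ v′ (λ i → proj₂ (proj₂ (rest i)))
    where
    arc = λ i → double-arc Q d (b i)
    u v u′ v′ : Vector ℕ n
    u  i = proj₁ (arc i)
    v  i = proj₁ (proj₂ (arc i))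
    u′ i = proj₁ (proj₂ (proj₂ (arc i)))
    v′ i = proj₁ (proj₂ (proj₂ (proj₂ (arc i))))
    rest = λ i → proj₂ (proj₂ (proj₂ (proj₂ (arc i))))
    total : ∀ n (u v u′ v′ : Vector ℕ n) → (∀ i → 2 * ∣ u i - v i ∣ + ∣ u′ i - v′ i ∣ ≡ Q) →
            2 * dist₁ u v + dist₁ u′ v′ ≡ n * Q
    total zero    u v u′ v′ eq = refl
    total (suc n) u v u′ v′ eq = trans
      (ring ∣ u zero - v zero ∣ (dist₁ (tail u) (tail v)) ∣ u′ zero - v′ zero ∣ (dist₁ (tail u′) (tail v′)))
      (cong₂ _+_ (eq zero) (total n (tail u) (tail v) (tail u′) (tail v′) (eq ∘ suc)))
      where
      ring : ∀ a a′ b b′ → 2 * (a + a′) + (b + b′) ≡ 2 * a + b + (2 * a′ + b′)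
      ring = solve-∀

-- Rational arithmetic

open import Data.Nat.Base as ℕ using (ℕ; zero; suc)
import Data.Nat.Properties as ℕₚ
open import Data.Integer.Base as ℤ using (ℤ; +_)
import Data.Integer.Properties as ℤₚ
import Data.Rational.Unnormalised.Base as ℚᵘ
import Data.Rational.Unnormalised.Properties as ℚᵘₚ

module Rationals where

  open import Data.Rational.Base
  open import Data.Rational.Properties
  open import Data.Rational.Solver using (module +-*-Solver)
  open import Defs using (∑ℚ)

  open +-*-Solver public using (solve; _:=_; _:+_; _:*_; _:-_; :-_; con)

  -- The embedding of the integers.
  ιℤ : ℤ → ℚ
  ιℤ i = i / 1

  ι : ℕ → ℚ
  ι n = ιℤ (+ n)

  private
    ≃1 : ∀ i → toℚᵘ (ιℤ i) ℚᵘ.≃ ℚᵘ.mkℚᵘ i 0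
    ≃1 i = toℚᵘ-fromℚᵘ (ℚᵘ.mkℚᵘ i 0)

  ιℤ-+ : ∀ i j → ιℤ (i ℤ.+ j) ≡ ιℤ i + ιℤ j
  ιℤ-+ i j = toℚᵘ-injective (ℚᵘₚ.≃-trans (≃1 (i ℤ.+ j)) (ℚᵘₚ.≃-trans
    (ℚᵘ.*≡* (cong (ℤ._* + 1) (sym (cong₂ ℤ._+_ (ℤₚ.*-identityʳ i) (ℤₚ.*-identityʳ j)))))
    (ℚᵘₚ.≃-sym (ℚᵘₚ.≃-trans (toℚᵘ-homo-+ (ιℤ i) (ιℤ j)) (ℚᵘₚ.+-cong (≃1 i) (≃1 j))))))

  ιℤ-* : ∀ i j → ιℤ (i ℤ.* j) ≡ ιℤ i * ιℤ j
  ιℤ-* i j = toℚᵘ-injective (ℚᵘₚ.≃-trans (≃1 (i ℤ.* j))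
    (ℚᵘₚ.≃-sym (ℚᵘₚ.≃-trans (toℚᵘ-homo-* (ιℤ i) (ιℤ j)) (ℚᵘₚ.*-cong (≃1 i) (≃1 j)))))

  ιℤ-neg : ∀ i → ιℤ (ℤ.- i) ≡ - ιℤ i
  ιℤ-neg i = toℚᵘ-injective (ℚᵘₚ.≃-trans (≃1 (ℤ.- i))
    (ℚᵘₚ.≃-sym (ℚᵘₚ.≃-trans (toℚᵘ-homo‿- (ιℤ i)) (ℚᵘₚ.-‿cong (≃1 i)))))

  ι-+ : ∀ m n → ι (m ℕ.+ n) ≡ ι m + ι n
  ι-+ m n = ιℤ-+ (+ m) (+ n)

  ι-* : ∀ m n → ι (m ℕ.* n) ≡ ι m * ι n
  ι-* m n = trans (cong ιℤ (ℤₚ.pos-* m n)) (ιℤ-* (+ m) (+ n))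

  ι-mono-≤ : ∀ {m n} → m ℕ.≤ n → ι m ≤ ι n
  ι-mono-≤ {m} {n} m≤n = toℚᵘ-cancel-≤
    (ℚᵘₚ.≤-respʳ-≃ (ℚᵘₚ.≃-sym (≃1 (+ n))) (ℚᵘₚ.≤-respˡ-≃ (ℚᵘₚ.≃-sym (≃1 (+ m)))
      (ℚᵘ.*≤* (ℤₚ.*-monoʳ-≤-nonNeg (+ 1) (ℤ.+≤+ m≤n)))))

  ι-cancel-< : ∀ {m n} → ι m < ι n → m ℕ.< n
  ι-cancel-< {m} {n} lt = ℕₚ.≰⇒> λ n≤m → <-irrefl refl (<-≤-trans lt (ι-mono-≤ n≤m))

  0≤ι : ∀ n → 0ℚ ≤ ι n
  0≤ι n = ι-mono-≤ (ℕ.z≤n {n})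

  ι-suc : ∀ n → ι (suc n) ≡ 1ℚ + ι n
  ι-suc n = ι-+ 1 n

  0<ι : ∀ n .{{_ : ℕ.NonZero n}} → 0ℚ < ι n
  0<ι n = <-≤-trans (positive⁻¹ 1ℚ) (ι-mono-≤ {1} {n} (ℕ.>-nonZero⁻¹ n))

  -- An inequality, from its slack.
  ≤-by : ∀ {a b} x → 0ℚ ≤ x → a + x ≡ b → a ≤ b
  ≤-by {a} {b} x 0≤x eq = subst₂ _≤_ (+-identityʳ a) eq (+-monoʳ-≤ a 0≤x)

  p≤q⇒0≤q-p : ∀ {p q} → p ≤ q → 0ℚ ≤ q - p
  p≤q⇒0≤q-p {p} {q} p≤q = subst (_≤ q - p) (+-inverseʳ p) (+-monoˡ-≤ (- p) p≤q)

  p≤q⇒p-q≤0 : ∀ {p q} → p ≤ q → p - q ≤ 0ℚ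
  p≤q⇒p-q≤0 {p} {q} p≤q = subst (p - q ≤_) (+-inverseʳ q) (+-monoˡ-≤ (- q) p≤q)

  0≤* : ∀ {p q} → 0ℚ ≤ p → 0ℚ ≤ q → 0ℚ ≤ p * q
  0≤* {p} {q} 0≤p 0≤q = nonNegative⁻¹ (p * q)
    {{nonNeg*nonNeg⇒nonNeg p {{nonNegative 0≤p}} q {{nonNegative 0≤q}}}}

  0<* : ∀ {p q} → 0ℚ < p → 0ℚ < q → 0ℚ < p * q
  0<* {p} {q} 0<p 0<q = positive⁻¹ (p * q) {{pos*pos⇒pos p {{positive 0<p}} q {{positive 0<q}}}}

  0≤+ : ∀ {p q} → 0ℚ ≤ p → 0ℚ ≤ q → 0ℚ ≤ p + q
  0≤+ = +-mono-≤

  *-monoˡ : ∀ r {p q} → 0ℚ ≤ r → p ≤ q → r * p ≤ r * q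
  *-monoˡ r 0≤r = *-monoˡ-≤-nonNeg r {{nonNegative 0≤r}}

  *-monoʳ : ∀ r {p q} → 0ℚ ≤ r → p ≤ q → p * r ≤ q * r
  *-monoʳ r 0≤r = *-monoʳ-≤-nonNeg r {{nonNegative 0≤r}}

  *-cancel : ∀ r {p q} → 0ℚ < r → p * r ≤ q * r → p ≤ q
  *-cancel r 0<r = *-cancelʳ-≤-pos r {{positive 0<r}}

  ∑ℚ-mono : ∀ k {f g} → (∀ e → e ℕ.< k → f e ≤ g e) → ∑ℚ k f ≤ ∑ℚ k g
  ∑ℚ-mono zero    le = ≤-refl
  ∑ℚ-mono (suc k) le = +-mono-≤ (∑ℚ-mono k (λ e e<k → le e (ℕₚ.m<n⇒m<1+n e<k))) (le k ℕₚ.≤-refl)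

  ∑ℚ-+ : ∀ k f g → ∑ℚ k (λ e → f e + g e) ≡ ∑ℚ k f + ∑ℚ k g
  ∑ℚ-+ zero    f g = refl
  ∑ℚ-+ (suc k) f g = trans (cong (_+ (f k + g k)) (∑ℚ-+ k f g))
    (solve 4 (λ a b c d → a :+ b :+ (c :+ d) := a :+ c :+ (b :+ d)) refl (∑ℚ k f) (∑ℚ k g) (f k) (g k))

  ∑ℚ-const : ∀ k c → ∑ℚ k (λ _ → c) ≡ ι k * c
  ∑ℚ-const zero    c = sym (*-zeroˡ c)
  ∑ℚ-const (suc k) c = trans (cong (_+ c) (∑ℚ-const k c))
    (trans (solve 2 (λ x c → x :* c :+ c := (con 1ℚ :+ x) :* c) refl (ι k) c)
           (cong (_* c) (sym (ι-suc k))))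

  ∑ℚ-cong : ∀ k {f g} → (∀ i → i ℕ.< k → f i ≡ g i) → ∑ℚ k f ≡ ∑ℚ k g
  ∑ℚ-cong zero    eq = refl
  ∑ℚ-cong (suc k) eq = cong₂ _+_ (∑ℚ-cong k (λ i i<k → eq i (ℕₚ.m<n⇒m<1+n i<k))) (eq k ℕₚ.≤-refl)

  ∑ℚ-shift : ∀ k h → ∑ℚ k (h ∘ suc) + h 0 ≡ ∑ℚ k h + h k
  ∑ℚ-shift zero    h = refl
  ∑ℚ-shift (suc k) h = trans
    (solve 3 (λ s x y → s :+ x :+ y := s :+ y :+ x) refl (∑ℚ k (h ∘ suc)) (h (suc k)) (h 0))
    (cong (_+ h (suc k)) (∑ℚ-shift k h))

  ∑ℚ-reverse : ∀ K f → ∑ℚ K (λ e → f (K ℕ.∸ suc e)) ≡ ∑ℚ K f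
  ∑ℚ-reverse zero    f = refl
  ∑ℚ-reverse (suc K) f = begin
    ∑ℚ K (λ e → f (K ℕ.∸ e)) + f (K ℕ.∸ K)
      ≡⟨ cong₂ _+_ (∑ℚ-cong K (λ e e<K → cong f (ℕₚ.+-∸-assoc 1 e<K))) (cong f (ℕₚ.n∸n≡0 K)) ⟩
    ∑ℚ K (λ e → f (suc (K ℕ.∸ suc e))) + f 0
      ≡⟨ cong (_+ f 0) (∑ℚ-reverse K (f ∘ suc)) ⟩
    ∑ℚ K (f ∘ suc) + f 0
      ≡⟨ ∑ℚ-shift K f ⟩
    ∑ℚ K f + f K ∎
    where
    open ≡-Reasoning

  1/suc : ℕ → ℚ
  1/suc n = + 1 / suc n

  0≤1/suc : ∀ n → 0ℚ ≤ 1/suc n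
  0≤1/suc n = nonNegative⁻¹ _ {{normalize-nonNeg 1 (suc n)}}

  *-1/suc : ∀ n → ι (suc n) * 1/suc n ≡ 1ℚ
  *-1/suc n = toℚᵘ-injective (ℚᵘₚ.≃-trans (toℚᵘ-homo-* (ι (suc n)) (1/suc n))
    (ℚᵘₚ.≃-trans (ℚᵘₚ.*-cong (toℚᵘ-fromℚᵘ (ℚᵘ.mkℚᵘ (+ suc n) 0)) (toℚᵘ-fromℚᵘ (ℚᵘ.mkℚᵘ (+ 1) n)))
      (ℚᵘ.*≡* (cong +_ (ring n)))))
    where
    ring : ∀ n → (suc n ℕ.* 1) ℕ.* 1 ≡ 1 ℕ.* (1 ℕ.* suc n)
    ring = solve-∀

  0<1/suc : ∀ k → 0ℚ < 1/suc k
  0<1/suc k = *-cancelˡ-<-nonNeg (ι (suc k)) {{nonNegative (0≤ι (suc k))}}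
    (subst₂ _<_ (sym (*-zeroʳ (ι (suc k)))) (sym (*-1/suc k)) (positive⁻¹ 1ℚ))

  ι*1/suc≤1 : ∀ k → ι k * 1/suc k ≤ 1ℚ
  ι*1/suc≤1 k = ≤-by (1/suc k) (0≤1/suc k) (trans
    (solve 2 (λ k x → k :* x :+ x := (con 1ℚ :+ k) :* x) refl (ι k) (1/suc k))
    (trans (cong (_* 1/suc k) (sym (ι-suc k))) (*-1/suc k)))

  clear-denominator : ∀ p → p * ι (↧ₙ p) ≡ ιℤ (↥ p)
  clear-denominator p@(mkℚ a d c) = toℚᵘ-injective (ℚᵘₚ.≃-trans (toℚᵘ-homo-* p (ι (suc d)))
    (ℚᵘₚ.≃-trans (ℚᵘₚ.*-cong (ℚᵘₚ.≃-refl {toℚᵘ p}) (toℚᵘ-fromℚᵘ (ℚᵘ.mkℚᵘ (+ suc d) 0)))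
    (ℚᵘₚ.≃-trans (ℚᵘ.*≡* (trans (ℤₚ.*-assoc a (+ suc d) (+ 1)) (cong (a ℤ.*_) (ℤₚ.*-comm (+ suc d) (+ 1))) ⟨trans⟩ cong (λ k → a ℤ.* (+ k)) (ring d)))
      (ℚᵘₚ.≃-sym (toℚᵘ-fromℚᵘ (ℚᵘ.mkℚᵘ a 0))))))
    where
    infixl 1 _⟨trans⟩_
    _⟨trans⟩_ = trans
    ring : ∀ d → 1 ℕ.* suc d ≡ suc d ℕ.* 1
    ring = solve-∀

  archimedean : ∀ p → ∃ λ n → p ≤ ι n
  archimedean p@(mkℚ (+ a) d c) = a , (begin
    p                  ≡⟨ *-identityʳ p ⟨
    p * 1ℚ           ≤⟨ *-monoˡ p (nonNegative⁻¹ p) (ι-mono-≤ {1} {suc d} (ℕ.s≤s ℕ.z≤n)) ⟩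
    p * ι (suc d)    ≡⟨ clear-denominator p ⟩
    ι a                ∎)
    where open ≤-Reasoning
  archimedean p@(mkℚ ℤ.-[1+ a ] d c) = 0 , <⇒≤ (negative⁻¹ p)

-- The sum of the minima, for rational data

module Minima where

  open SeparatedSets
  open Torus
  open Rationals
  open import Data.Rational.Base
  open import Data.Rational.Properties
  open import Defs using (∑ℚ)

  ∑ℚ-indicator : ∀ {P : Pred ℕ 0ℓ} (P? : Decidable P) k c →
                 ∑ℚ k (λ e → c * ι (indicator (P? e))) ≡ c * ι (count P? k)
  ∑ℚ-indicator P? zero    c = sym (*-zeroʳ c)
  ∑ℚ-indicator P? (suc k) c = trans (cong (_+ c * ι (indicator (P? k))) (∑ℚ-indicator P? k c))
    (trans (solve 3 (λ c x y → c :* x :+ c :* y := c :* (y :+ x)) refl c (ι (count P? k)) (ι (indicator (P? k))))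
           (cong (c *_) (sym (ι-+ (indicator (P? k)) (count P? k)))))

  -- The part of q above the threshold r.
  excess : ℚ → ℚ → ℚ
  excess q r = (q - r) ⊔ 0ℚ

  0≤excess : ∀ q r → 0ℚ ≤ excess q r
  0≤excess q r = p≤q⊔p (q - r) 0ℚ

  ≤excess+ : ∀ q r → q ≤ excess q r + r
  ≤excess+ q r = subst (_≤ excess q r + r) (solve 2 (λ q r → q :- r :+ r := q) refl q r)
    (+-monoˡ-≤ r (p≤p⊔q (q - r) 0ℚ))

  -- Lowering the threshold from r to r′ adds at most r - r′, and only if q
  -- exceeds r′.
  excess-step : ∀ q {r r′} → r′ ≤ r →
                excess q r′ ≤ excess q r + (r - r′) * ι (indicator (r′ <? q))
  excess-step q {r} {r′} r′≤r with r′ <? q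
  ... | yes r′<q = ⊔-lub
    (subst (_≤ excess q r + (r - r′) * 1ℚ)
      (solve 3 (λ q r r′ → q :- r :+ (r :- r′) :* con 1ℚ := q :- r′) refl q r r′)
      (+-monoˡ-≤ ((r - r′) * 1ℚ) (p≤p⊔q (q - r) 0ℚ)))
    (0≤+ (0≤excess q r) (0≤* (p≤q⇒0≤q-p r′≤r) (0≤ι 1)))
  ... | no r′≮q = ⊔-lub (≤-trans (p≤q⇒p-q≤0 (≮⇒≥ r′≮q)) rest) rest
    where
    rest : 0ℚ ≤ excess q r + (r - r′) * 0ℚ
    rest = 0≤+ (0≤excess q r) (≤-reflexive (sym (*-zeroʳ (r - r′))))

  ⅓ ⅚ : ℚ
  ⅓ = + 1 / 3
  ⅚ = + 5 / 6

  -- The thresholds (n / 3) (5 / 6)^i.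
  level : ℕ → ℕ → ℚ
  level n zero    = ι n * ⅓
  level n (suc i) = ⅚ * level n i

  0≤level : ∀ n i → 0ℚ ≤ level n i
  0≤level n zero    = 0≤* (0≤ι n) (nonNegative⁻¹ ⅓)
  0≤level n (suc i) = 0≤* (nonNegative⁻¹ ⅚) (0≤level n i)

  -- The hypothesis says that q e is a lower bound for the distances of the
  -- points d b / Q₀ of the torus R^n/Z^n from 0, for all d in the window e.  The
  -- factor F refines the grid (1/Q₀) Z^n, so that the boxes of side
  -- (1/2) (5/6)^i have their corners on it.
  module _ (n Q₀ K : ℕ) .{{_ : ℕ.NonZero Q₀}} (b : Vector ℕ n) (q : ℕ → ℚ)
    (below : ∀ F .{{_ : ℕ.NonZero F}} e → e ℕ.< K → ∀ d → 2 ℕ.^ e ℕ.≤ d → d ℕ.≤ 2 ℕ.^ suc e →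
             ∀ u v → Represents (Q₀ ℕ.* F) (λ i → F ℕ.* b i) d u v →
             q e * ι (Q₀ ℕ.* F) ≤ ι (dist₁ u v)) where

    level-anti : ∀ i → level n (suc i) ≤ level n i
    level-anti i = ≤-by ((+ 1 / 6) * level n i) (0≤* (nonNegative⁻¹ (+ 1 / 6)) (0≤level n i))
      (solve 1 (λ r → con ⅚ :* r :+ con (+ 1 / 6) :* r := r) refl (level n i))

    level-6^ : ∀ i → ι 3 * (level n i * ι (6 ℕ.^ i)) ≡ ι (n ℕ.* 5 ℕ.^ i)
    level-6^ zero    = trans
      (solve 1 (λ x → con (ι 3) :* (x :* con ⅓ :* con (ι 1)) := x) refl (ι n))
      (cong ι (sym (ℕₚ.*-identityʳ n)))
    level-6^ (suc i) = begin
      ι 3 * (⅚ * level n i * ι (6 ℕ.^ suc i))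
        ≡⟨ cong (λ y → ι 3 * (⅚ * level n i * y)) (ι-* 6 (6 ℕ.^ i)) ⟩
      ι 3 * (⅚ * level n i * (ι 6 * ι (6 ℕ.^ i)))
        ≡⟨ solve 2 (λ r s → con (ι 3) :* (con ⅚ :* r :* (con (ι 6) :* s)) := con (ι 5) :* (con (ι 3) :* (r :* s))) refl (level n i) (ι (6 ℕ.^ i)) ⟩
      ι 5 * (ι 3 * (level n i * ι (6 ℕ.^ i)))
        ≡⟨ cong (ι 5 *_) (level-6^ i) ⟩
      ι 5 * ι (n ℕ.* 5 ℕ.^ i)
        ≡⟨ ι-* 5 (n ℕ.* 5 ℕ.^ i) ⟨
      ι (5 ℕ.* (n ℕ.* 5 ℕ.^ i))
        ≡⟨ cong ι (swap n (5 ℕ.^ i)) ⟩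
      ι (n ℕ.* 5 ℕ.^ suc i) ∎
      where
      open ≡-Reasoning
      swap : ∀ n x → 5 ℕ.* (n ℕ.* x) ≡ n ℕ.* (5 ℕ.* x)
      swap = solve-∀

    below-cap : ∀ e → e ℕ.< K → q e ≤ level n 0
    below-cap e e<K with double-arcs (Q₀ ℕ.* 1) {{ℕₚ.m*n≢0 Q₀ 1}} (2 ℕ.^ e) (λ i → 1 ℕ.* b i)
    ... | u , v , u′ , v′ , rep , rep′ , total = *-cancel (ι Q) 0<Q (*-cancel (ι 3) (0<ι 3) (begin
      q e * ι Q * ι 3
        ≡⟨ solve 1 (λ x → x :* con (ι 3) := con (ι 2) :* x :+ x) refl (q e * ι Q) ⟩
      ι 2 * (q e * ι Q) + q e * ι Q
        ≤⟨ +-mono-≤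
             (*-monoˡ (ι 2) (0≤ι 2) (below 1 e e<K (2 ℕ.^ e) ℕₚ.≤-refl (ℕₚ.m≤m+n _ _) u v rep))
             (below 1 e e<K (2 ℕ.* 2 ℕ.^ e) (ℕₚ.m≤m+n _ _) ℕₚ.≤-refl u′ v′ rep′) ⟩
      ι 2 * ι (dist₁ u v) + ι (dist₁ u′ v′)
        ≡⟨ cong (_+ ι (dist₁ u′ v′)) (ι-* 2 (dist₁ u v)) ⟨
      ι (2 ℕ.* dist₁ u v) + ι (dist₁ u′ v′)
        ≡⟨ ι-+ (2 ℕ.* dist₁ u v) (dist₁ u′ v′) ⟨
      ι (2 ℕ.* dist₁ u v ℕ.+ dist₁ u′ v′)
        ≡⟨ trans (cong ι total) (ι-* n Q) ⟩
      ι n * ι Q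
        ≡⟨ solve 2 (λ n Q → n :* Q := n :* con ⅓ :* Q :* con (ι 3)) refl (ι n) (ι Q) ⟩
      ι n * ⅓ * ι Q * ι 3 ∎))
      where
      open ≤-Reasoning
      Q = Q₀ ℕ.* 1
      0<Q : 0ℚ < ι Q
      0<Q = 0<ι Q {{ℕₚ.m*n≢0 Q₀ 1}}

    above? : ∀ i → Decidable (λ e → level n i < q e)
    above? i e = level n i <? q e

    -- The bound of count-bound on the number of e with q e above level n i.
    above-count : ∀ i → ι 15 * ι (count (above? i) K) ≤ ι 19 * ι n + ι 5 * (ι i * ι n + 1ℚ)
    above-count i = subst₂ _≤_ (ι-* 15 (count (above? i) K)) eq
      (ι-mono-≤ (count-bound Q₀ i (λ j → F ℕ.* b j) (above? i) K far))
      where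
      F = 2 ℕ.* 6 ℕ.^ i
      instance
        6^≢0 : ℕ.NonZero (6 ℕ.^ i)
        6^≢0 = ℕₚ.m^n≢0 6 i
        F≢0 : ℕ.NonZero F
        F≢0 = ℕₚ.m*n≢0 2 (6 ℕ.^ i)
        QF≢0 : ℕ.NonZero (Q₀ ℕ.* F)
        QF≢0 = ℕₚ.m*n≢0 Q₀ F
      eq : ι (19 ℕ.* n ℕ.+ 5 ℕ.* (i ℕ.* n ℕ.+ 1)) ≡ ι 19 * ι n + ι 5 * (ι i * ι n + 1ℚ)
      eq = trans (ι-+ (19 ℕ.* n) (5 ℕ.* (i ℕ.* n ℕ.+ 1))) (cong₂ _+_ (ι-* 19 n)
        (trans (ι-* 5 (i ℕ.* n ℕ.+ 1)) (cong (ι 5 *_) (trans (ι-+ (i ℕ.* n) 1) (cong (_+ 1ℚ) (ι-* i n))))))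
      -- The threshold is (2/3) n (l / Q).
      boxside : ι 3 * (level n i * ι (Q₀ ℕ.* F)) ≡ ι (n ℕ.* (2 ℕ.* (Q₀ ℕ.* 5 ℕ.^ i)))
      boxside = begin
        ι 3 * (level n i * ι (Q₀ ℕ.* F))
          ≡⟨ cong (λ y → ι 3 * (level n i * y)) (trans (ι-* Q₀ F) (cong (ι Q₀ *_) (ι-* 2 (6 ℕ.^ i)))) ⟩
        ι 3 * (level n i * (ι Q₀ * (ι 2 * ι (6 ℕ.^ i))))
          ≡⟨ solve 3 (λ r Q s → con (ι 3) :* (r :* (Q :* (con (ι 2) :* s))) := Q :* con (ι 2) :* (con (ι 3) :* (r :* s))) refl (level n i) (ι Q₀) (ι (6 ℕ.^ i)) ⟩
        ι Q₀ * ι 2 * (ι 3 * (level n i * ι (6 ℕ.^ i)))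
          ≡⟨ cong₂ _*_ (sym (ι-* Q₀ 2)) (level-6^ i) ⟩
        ι (Q₀ ℕ.* 2) * ι (n ℕ.* 5 ℕ.^ i)
          ≡⟨ ι-* (Q₀ ℕ.* 2) (n ℕ.* 5 ℕ.^ i) ⟨
        ι (Q₀ ℕ.* 2 ℕ.* (n ℕ.* 5 ℕ.^ i))
          ≡⟨ cong ι (swap Q₀ n (5 ℕ.^ i)) ⟩
        ι (n ℕ.* (2 ℕ.* (Q₀ ℕ.* 5 ℕ.^ i))) ∎
        where
        open ≡-Reasoning
        swap : ∀ Q n x → Q ℕ.* 2 ℕ.* (n ℕ.* x) ≡ n ℕ.* (2 ℕ.* (Q ℕ.* x))
        swap = solve-∀
      far : ∀ d → Window (λ e → level n i < q e) K d → ∀ u v → Represents (Q₀ ℕ.* F) (λ j → F ℕ.* b j) d u v →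
            n ℕ.* (2 ℕ.* (Q₀ ℕ.* 5 ℕ.^ i)) ℕ.< 3 ℕ.* dist₁ u v
      far d (e , e<K , above , lo , hi) u v rep = ι-cancel-< (begin-strict
        ι (n ℕ.* (2 ℕ.* (Q₀ ℕ.* 5 ℕ.^ i)))   ≡⟨ boxside ⟨
        ι 3 * (level n i * ι (Q₀ ℕ.* F))       <⟨ *-monoʳ-<-pos (ι 3) (*-monoˡ-<-pos (ι (Q₀ ℕ.* F)) {{positive (0<ι (Q₀ ℕ.* F))}} above) ⟩
        ι 3 * (q e * ι (Q₀ ℕ.* F))           ≤⟨ *-monoˡ (ι 3) (0≤ι 3) (below F e e<K d lo hi u v rep) ⟩
        ι 3 * ι (dist₁ u v)                  ≡⟨ ι-* 3 (dist₁ u v) ⟨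
        ι (3 ℕ.* dist₁ u v)                  ∎)
        where open ≤-Reasoning

    -- Its decrease from i to i + 1 is level n i - level n (i + 1) times the
    -- bound of above-count (i + 1) on the number of q e above level n (i + 1).
    potential : ℕ → ℚ
    potential i = level n i * ((ι 5 + ι 49 * ι n) * (+ 1 / 15) + ι n * ι i * ⅓)

    0≤potential : ∀ i → 0ℚ ≤ potential i
    0≤potential i = 0≤* (0≤level n i) (0≤+
      (0≤* (0≤+ (0≤ι 5) (0≤* (0≤ι 49) (0≤ι n))) (nonNegative⁻¹ (+ 1 / 15)))
      (0≤* (0≤* (0≤ι n) (0≤ι i)) (nonNegative⁻¹ ⅓)))

    total-excess : ∀ i → ∑ℚ K (λ e → excess (q e) (level n i)) + potential i ≤ potential 0
    total-excess zero    = subst (_≤ potential 0) (sym (trans (cong (_+ potential 0) no-excess) (+-identityˡ (potential 0)))) ≤-refl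
      where
      no-excess : ∑ℚ K (λ e → excess (q e) (level n 0)) ≡ 0ℚ
      no-excess = ≤-antisym
        (≤-trans (∑ℚ-mono K (λ e e<K → ⊔-lub (p≤q⇒p-q≤0 (below-cap e e<K)) ≤-refl))
          (≤-reflexive (trans (∑ℚ-const K 0ℚ) (*-zeroʳ (ι K)))))
        (≤-trans (≤-reflexive (sym (trans (∑ℚ-const K 0ℚ) (*-zeroʳ (ι K)))))
          (∑ℚ-mono K (λ e _ → 0≤excess (q e) (level n 0))))
    total-excess (suc i) = begin
      ∑ℚ K (λ e → excess (q e) r′) + potential (suc i)
        ≤⟨ +-monoˡ-≤ (potential (suc i)) (∑ℚ-mono K (λ e _ → excess-step (q e) (level-anti i))) ⟩
      ∑ℚ K (λ e → excess (q e) r + (r - r′) * ι (indicator (r′ <? q e))) + potential (suc i)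
        ≡⟨ cong (_+ potential (suc i)) (trans (∑ℚ-+ K _ _) (cong (λ y → ∑ℚ K (λ e → excess (q e) r) + y) (∑ℚ-indicator (above? (suc i)) K (r - r′)))) ⟩
      ∑ℚ K (λ e → excess (q e) r) + (r - r′) * ι N + potential (suc i)
        ≡⟨ +-assoc (∑ℚ K (λ e → excess (q e) r)) _ _ ⟩
      ∑ℚ K (λ e → excess (q e) r) + ((r - r′) * ι N + potential (suc i))
        ≤⟨ +-monoʳ-≤ (∑ℚ K (λ e → excess (q e) r)) step ⟩
      ∑ℚ K (λ e → excess (q e) r) + potential i
        ≤⟨ total-excess i ⟩
      potential 0 ∎
      where
      open ≤-Reasoning
      r  = level n i
      r′ = level n (suc i)
      N  = count (above? (suc i)) K
      step : (r - r′) * ι N + potential (suc i) ≤ potential i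
      step = begin
        (r - r′) * ι N + potential (suc i)
          ≡⟨ cong (_+ potential (suc i)) (solve 2 (λ x N → x :* N := x :* con (+ 1 / 15) :* (con (ι 15) :* N)) refl (r - r′) (ι N)) ⟩
        (r - r′) * (+ 1 / 15) * (ι 15 * ι N) + potential (suc i)
          ≤⟨ +-monoˡ-≤ (potential (suc i)) (*-monoˡ ((r - r′) * (+ 1 / 15)) (0≤* (p≤q⇒0≤q-p (level-anti i)) (nonNegative⁻¹ (+ 1 / 15))) (above-count (suc i))) ⟩
        (r - r′) * (+ 1 / 15) * (ι 19 * ι n + ι 5 * (ι (suc i) * ι n + 1ℚ)) + potential (suc i)
          ≡⟨ cong (λ y → (r - r′) * (+ 1 / 15) * (ι 19 * ι n + ι 5 * (y * ι n + 1ℚ)) + r′ * ((ι 5 + ι 49 * ι n) * (+ 1 / 15) + ι n * y * ⅓)) (ι-suc i) ⟩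
        (r - r′) * (+ 1 / 15) * (ι 19 * ι n + ι 5 * ((1ℚ + ι i) * ι n + 1ℚ)) + r′ * ((ι 5 + ι 49 * ι n) * (+ 1 / 15) + ι n * (1ℚ + ι i) * ⅓)
          ≡⟨ solve 3 (λ r n i →
               (r :- con ⅚ :* r) :* con (+ 1 / 15) :* (con (ι 19) :* n :+ con (ι 5) :* ((con 1ℚ :+ i) :* n :+ con 1ℚ))
                 :+ (con ⅚ :* r) :* ((con (ι 5) :+ con (ι 49) :* n) :* con (+ 1 / 15) :+ n :* (con 1ℚ :+ i) :* con ⅓)
               := r :* ((con (ι 5) :+ con (ι 49) :* n) :* con (+ 1 / 15) :+ n :* i :* con ⅓)) refl r (ι n) (ι i) ⟩
        potential i ∎

    potential-0 : potential 0 ≤ (+ 6 / 5) * (ι n * ι n)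
    potential-0 = ≤-by ((+ 1 / 9) * (ι n * ι n - ι n)) (0≤* (nonNegative⁻¹ (+ 1 / 9)) (p≤q⇒0≤q-p n≤n²))
      (solve 1 (λ n → n :* con ⅓ :* ((con (ι 5) :+ con (ι 49) :* n) :* con (+ 1 / 15) :+ n :* con (ι 0) :* con ⅓)
                        :+ con (+ 1 / 9) :* (n :* n :- n)
                      := con (+ 6 / 5) :* (n :* n)) refl (ι n))
      where
      n≤n*n : ∀ n → n ℕ.≤ n ℕ.* n
      n≤n*n zero    = ℕ.z≤n
      n≤n*n (suc n) = ℕₚ.m≤m+n (suc n) _
      n≤n² : ι n ≤ ι n * ι n
      n≤n² = subst (ι n ≤_) (ι-* n n) (ι-mono-≤ (n≤n*n n))

    minima-sum : ∀ i → ∑ℚ K q ≤ (+ 6 / 5) * (ι n * ι n) + ι K * level n i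
    minima-sum i = begin
      ∑ℚ K q
        ≤⟨ ∑ℚ-mono K (λ e _ → ≤excess+ (q e) (level n i)) ⟩
      ∑ℚ K (λ e → excess (q e) (level n i) + level n i)
        ≡⟨ trans (∑ℚ-+ K _ _) (cong (λ y → ∑ℚ K (λ e → excess (q e) (level n i)) + y) (∑ℚ-const K (level n i))) ⟩
      ∑ℚ K (λ e → excess (q e) (level n i)) + ι K * level n i
        ≤⟨ +-monoˡ-≤ (ι K * level n i) (≤-by {∑ℚ K (λ e → excess (q e) (level n i))} (potential i) (0≤potential i) refl) ⟩
      ∑ℚ K (λ e → excess (q e) (level n i)) + potential i + ι K * level n i
        ≤⟨ +-monoˡ-≤ (ι K * level n i) (≤-trans (total-excess i) potential-0) ⟩
      (+ 6 / 5) * (ι n * ι n) + ι K * level n i ∎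
      where open ≤-Reasoning

-- Bounds on ln 2

module LogTwo where

  open Rationals
  open import Data.Rational.Base
  open import Data.Rational.Properties
  open import Defs using (∑ℚ; riemannSum)

  -- 1/k = 1/(k+1) + 1/(k (k+1))
  1/suc-step : ∀ n → 1/suc n ≡ 1/suc (suc n) + 1/suc n * 1/suc (suc n)
  1/suc-step n = begin
    x                            ≡⟨ *-identityʳ x ⟨
    x * 1ℚ                       ≡⟨ cong (x *_) (*-1/suc (suc n)) ⟨
    x * (ι (suc (suc n)) * y)    ≡⟨ cong (λ z → x * (z * y)) (ι-suc (suc n)) ⟩
    x * ((1ℚ + ι (suc n)) * y)   ≡⟨ solve 3 (λ x y a → x :* ((con 1ℚ :+ a) :* y) := a :* x :* y :+ x :* y) refl x y (ι (suc n)) ⟩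
    ι (suc n) * x * y + x * y    ≡⟨ cong (λ z → z * y + x * y) (*-1/suc n) ⟩
    1ℚ * y + x * y               ≡⟨ cong (_+ x * y) (*-identityˡ y) ⟩
    y + x * y                    ∎
    where
    open ≡-Reasoning
    x = 1/suc n
    y = 1/suc (suc n)

  1/suc-anti-step : ∀ n → 1/suc (suc n) ≤ 1/suc n
  1/suc-anti-step n = ≤-by (1/suc n * 1/suc (suc n)) (0≤* (0≤1/suc n) (0≤1/suc (suc n))) (sym (1/suc-step n))

  1/suc-anti : ∀ {m n} → m ℕ.≤′ n → 1/suc n ≤ 1/suc m
  1/suc-anti (ℕ.≤′-reflexive refl) = ≤-refl
  1/suc-anti (ℕ.≤′-step {n} m≤n) = ≤-trans (1/suc-anti-step n) (1/suc-anti m≤n)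

  1/suc-convex : ∀ n → ι 2 * 1/suc (suc n) ≤ 1/suc n + 1/suc (suc (suc n))
  1/suc-convex n = ≤-by (y * (x - z)) (0≤* (0≤1/suc (suc n)) (p≤q⇒0≤q-p (≤-trans (1/suc-anti-step (suc n)) (1/suc-anti-step n)))) (begin
    ι 2 * y + y * (x - z)               ≡⟨ solve 3 (λ x y z → con (ι 2) :* y :+ y :* (x :- z) := (y :+ x :* y) :+ (y :- y :* z)) refl x y z ⟩
    (y + x * y) + (y - y * z)           ≡⟨ cong₂ (λ a b → a + (b - y * z)) (sym (1/suc-step n)) (1/suc-step (suc n)) ⟩
    x + (z + y * z - y * z)             ≡⟨ cong (_+_ x) (solve 2 (λ z w → z :+ w :- w := z) refl z (y * z)) ⟩
    x + z                               ∎)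
    where
    open ≡-Reasoning
    x = 1/suc n
    y = 1/suc (suc n)
    z = 1/suc (suc (suc n))

  1/suc-double : ∀ n → 1/suc n ≡ ι 2 * 1/suc (suc (n ℕ.+ n))
  1/suc-double n = begin
    x                              ≡⟨ *-identityʳ x ⟨
    x * 1ℚ                         ≡⟨ cong (x *_) (*-1/suc m) ⟨
    x * (ι (suc m) * y)            ≡⟨ cong (λ a → x * (a * y)) (trans (cong ι (ring n)) (ι-* 2 (suc n))) ⟩
    x * (ι 2 * ι (suc n) * y)      ≡⟨ solve 3 (λ x y a → x :* (con (ι 2) :* a :* y) := con (ι 2) :* (a :* x :* y)) refl x y (ι (suc n)) ⟩
    ι 2 * (ι (suc n) * x * y)      ≡⟨ cong (λ z → ι 2 * (z * y)) (*-1/suc n) ⟩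
    ι 2 * (1ℚ * y)                 ≡⟨ cong (ι 2 *_) (*-identityˡ y) ⟩
    ι 2 * y                        ∎
    where
    open ≡-Reasoning
    m = suc (n ℕ.+ n)
    x = 1/suc n
    y = 1/suc m
    ring : ∀ n → suc (suc (n ℕ.+ n)) ≡ 2 ℕ.* suc n
    ring = solve-∀

  riemannSum-suc : ∀ N → riemannSum (suc N) ≡ riemannSum N + 1/suc (N ℕ.+ N) - 1/suc (suc (N ℕ.+ N))
  riemannSum-suc N = begin
    R′                                  ≡⟨ solve 2 (λ r x → r := r :+ x :- x) refl R′ (1/suc N) ⟩
    R′ + 1/suc N - 1/suc N              ≡⟨ cong₂ _-_ eq (1/suc-double N) ⟩
    riemannSum N + x + y - ι 2 * y      ≡⟨ solve 3 (λ r x y → r :+ x :+ y :- con (ι 2) :* y := r :+ x :- y) refl (riemannSum N) x y ⟩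
    riemannSum N + x - y                ∎
    where
    open ≡-Reasoning
    R′ = riemannSum (suc N)
    x = 1/suc (N ℕ.+ N)
    y = 1/suc (suc (N ℕ.+ N))
    h : ℕ → ℚ
    h i = 1/suc (N ℕ.+ i)
    eq : R′ + 1/suc N ≡ riemannSum N + x + y
    eq = begin
      ∑ℚ (suc N) (λ i → 1/suc (suc N ℕ.+ i)) + 1/suc N
        ≡⟨ cong₂ _+_ (∑ℚ-cong (suc N) (λ i _ → cong 1/suc (sym (ℕₚ.+-suc N i)))) (cong 1/suc (sym (ℕₚ.+-identityʳ N))) ⟩
      ∑ℚ (suc N) (h ∘ suc) + h 0
        ≡⟨ ∑ℚ-shift (suc N) h ⟩
      ∑ℚ N h + h N + h (suc N)
        ≡⟨ cong (λ k → riemannSum N + x + 1/suc k) (ℕₚ.+-suc N N) ⟩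
      riemannSum N + x + y ∎

  -- The right-endpoint sums riemannSum N increase to ln 2, with error about
  -- 1/(4N).  Adding 1/(2N+1) makes them decrease, and adding half of this still
  -- leaves them increasing.
  upper lower : ℕ → ℚ
  upper N = riemannSum N + 1/suc (N ℕ.+ N)
  lower N = riemannSum N + ½ * 1/suc (N ℕ.+ N)

  private
    next : ∀ N → 1/suc (suc N ℕ.+ suc N) ≡ 1/suc (suc (suc (N ℕ.+ N)))
    next N = cong (λ k → 1/suc (suc k)) (ℕₚ.+-suc N N)

  upper-step : ∀ N → upper (suc N) ≤ upper N
  upper-step N = ≤-by (y - z) (p≤q⇒0≤q-p (1/suc-anti-step (suc (N ℕ.+ N)))) (trans
    (cong₂ (λ r w → r + w + (y - z)) (riemannSum-suc N) (next N))
    (solve 4 (λ r x y z → r :+ x :- y :+ z :+ (y :- z) := r :+ x) refl (riemannSum N) (1/suc (N ℕ.+ N)) y z))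
    where
    y = 1/suc (suc (N ℕ.+ N))
    z = 1/suc (suc (suc (N ℕ.+ N)))

  lower-step : ∀ N → lower N ≤ lower (suc N)
  lower-step N = ≤-by (½ * (x + z - ι 2 * y)) (0≤* (nonNegative⁻¹ ½) (p≤q⇒0≤q-p (1/suc-convex (N ℕ.+ N)))) (sym (trans
    (cong₂ (λ r w → r + ½ * w) (riemannSum-suc N) (next N))
    (solve 4 (λ r x y z → r :+ x :- y :+ con ½ :* z := r :+ con ½ :* x :+ con ½ :* (x :+ z :- con (ι 2) :* y)) refl (riemannSum N) x y z)))
    where
    x = 1/suc (N ℕ.+ N)
    y = 1/suc (suc (N ℕ.+ N))
    z = 1/suc (suc (suc (N ℕ.+ N)))

  upper-anti : ∀ {M N} → M ℕ.≤′ N → upper N ≤ upper M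
  upper-anti (ℕ.≤′-reflexive refl) = ≤-refl
  upper-anti (ℕ.≤′-step {N} M≤N) = ≤-trans (upper-step N) (upper-anti M≤N)

  lower-mono : ∀ {M N} → M ℕ.≤′ N → lower M ≤ lower N
  lower-mono (ℕ.≤′-reflexive refl) = ≤-refl
  lower-mono (ℕ.≤′-step {N} M≤N) = ≤-trans (lower-mono M≤N) (lower-step N)

  -- upper 12 is below 5/7.
  riemannSum-≤ : ∀ N → 12 ℕ.≤ N → riemannSum N ≤ + 5 / 7
  riemannSum-≤ N 12≤N = ≤-trans
    (≤-by (1/suc (N ℕ.+ N)) (0≤1/suc (N ℕ.+ N)) refl)
    (≤-trans (upper-anti (ℕₚ.≤⇒≤′ 12≤N)) (≤ᵇ⇒≤ _))

  -- lower 16 exceeds the bound by more than half of 1/2001, which for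
  -- N >= 1000 is at least the term added in lower N.
  riemannSum-≥ : ∀ N → 1000 ℕ.≤ N → + 3463 / 5000 ≤ riemannSum N
  riemannSum-≥ N 1000≤N = begin
    + 3463 / 5000                          ≤⟨ ≤ᵇ⇒≤ {+ 3463 / 5000} {lower 16 - ½ * 1/suc 2000} _ ⟩
    lower 16 - ½ * 1/suc 2000              ≤⟨ +-mono-≤ (lower-mono (ℕₚ.≤⇒≤′ (ℕₚ.≤-trans (ℕₚ.≤ᵇ⇒≤ 16 1000 _) 1000≤N)))
                                               (neg-antimono-≤ (*-monoˡ ½ (nonNegative⁻¹ ½) (1/suc-anti (ℕₚ.≤⇒≤′ (ℕₚ.+-mono-≤ 1000≤N 1000≤N))))) ⟩
    lower N - ½ * 1/suc (N ℕ.+ N)          ≡⟨ solve 2 (λ r x → r :+ x :- x := r) refl (riemannSum N) (½ * 1/suc (N ℕ.+ N)) ⟩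
    riemannSum N                           ∎
    where open ≤-Reasoning

-- The order on the reals, and convergence

open import Defs
open import Data.Nat.Base using (NonZero; _^_)
open import Data.Integer.DivMod using (_/ℕ_; _%ℕ_; a≡a%ℕn+[a/ℕn]*n)
open import Data.Rational.Base as ℚ using (ℚ; 0ℚ; 1ℚ; ½; _/_)
import Data.Rational.Properties as ℚₚ
open Torus using (Represents; dist₁; _≡_mod_)
open Rationals
open Minima using (⅚; level; 0≤level; minima-sum)
open LogTwo using (riemannSum-≤; riemannSum-≥)

0<½* : ∀ {ε} → 0ℚ ℚ.< ε → 0ℚ ℚ.< ½ ℚ.* ε
0<½* = 0<* (ℚₚ.positive⁻¹ ½)

½+½ : ∀ ε → ½ ℚ.* ε ℚ.+ ½ ℚ.* ε ≡ ε
½+½ = solve 1 (λ e → con ½ :* e :+ con ½ :* e := e) refl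

p<p+ε : ∀ p {ε} → 0ℚ ℚ.< ε → p ℚ.< p ℚ.+ ε
p<p+ε p {ε} 0<ε = subst (ℚ._< p ℚ.+ ε) (ℚₚ.+-identityʳ p) (ℚₚ.+-monoʳ-< p 0<ε)

p≤∣p∣ : ∀ p → p ℚ.≤ ℚ.∣ p ∣
p≤∣p∣ p with ℚₚ.≤-total 0ℚ p
... | inj₁ 0≤p = ℚₚ.≤-reflexive (sym (ℚₚ.0≤p⇒∣p∣≡p 0≤p))
... | inj₂ p≤0 = ℚₚ.≤-trans p≤0 (ℚₚ.0≤∣p∣ p)

∣p∣≤⇒≤ : ∀ p {r} → ℚ.∣ p ∣ ℚ.≤ r → p ℚ.≤ r
∣p∣≤⇒≤ p = ℚₚ.≤-trans (p≤∣p∣ p)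

∣∣-lub : ∀ {p r} → p ℚ.≤ r → ℚ.- p ℚ.≤ r → ℚ.∣ p ∣ ℚ.≤ r
∣∣-lub {p} {r} p≤r -p≤r with ℚₚ.∣p∣≡p∨∣p∣≡-p p
... | inj₁ eq = subst (ℚ._≤ r) (sym eq) p≤r
... | inj₂ eq = subst (ℚ._≤ r) (sym eq) -p≤r

∣p-q∣≡∣q-p∣ : ∀ p q → ℚ.∣ p ℚ.- q ∣ ≡ ℚ.∣ q ℚ.- p ∣
∣p-q∣≡∣q-p∣ p q = trans (sym (ℚₚ.∣-p∣≡∣p∣ (p ℚ.- q)))
  (cong ℚ.∣_∣ (solve 2 (λ p q → :- (p :- q) := q :- p) refl p q))

near⇒≤ : ∀ p q {r} → ℚ.∣ p ℚ.- q ∣ ℚ.≤ r → p ℚ.≤ q ℚ.+ r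
near⇒≤ p q {r} le = subst (ℚ._≤ q ℚ.+ r) (solve 2 (λ p q → q :+ (p :- q) := p) refl p q)
  (ℚₚ.+-monoʳ-≤ q (∣p∣≤⇒≤ (p ℚ.- q) le))

eventually-≤ : ∀ {x y} N → (∀ n → N ℕ.≤ n → seq x n ℚ.≤ seq y n) → x ≤ y
eventually-≤ {x} {y} N le ε 0<ε = N , λ n N≤n → ℚₚ.≤-<-trans (le n N≤n) (p<p+ε (seq y n) 0<ε)

≤-refl : ∀ {x} → x ≤ x
≤-refl {x} = eventually-≤ {x} {x} 0 (λ _ _ → ℚₚ.≤-refl)

≤-trans : ∀ {x y z} → x ≤ y → y ≤ z → x ≤ z
≤-trans {x} {y} {z} x≤y y≤z ε 0<ε with x≤y (½ ℚ.* ε) (0<½* 0<ε) | y≤z (½ ℚ.* ε) (0<½* 0<ε)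
... | M , f | N , g = M ℕ.⊔ N , λ n le → begin-strict
  seq x n                              <⟨ f n (ℕₚ.m⊔n≤o⇒m≤o M N le) ⟩
  seq y n ℚ.+ h                        <⟨ ℚₚ.+-monoˡ-< h (g n (ℕₚ.m⊔n≤o⇒n≤o M N le)) ⟩
  seq z n ℚ.+ h ℚ.+ h                  ≡⟨ ℚₚ.+-assoc (seq z n) h h ⟩
  seq z n ℚ.+ (h ℚ.+ h)                ≡⟨ cong (λ e → seq z n ℚ.+ e) (½+½ ε) ⟩
  seq z n ℚ.+ ε                        ∎
  where
  open ℚₚ.≤-Reasoning
  h = ½ ℚ.* ε

+-mono-≤ : ∀ {x y u v} → x ≤ y → u ≤ v → x + u ≤ y + v
+-mono-≤ {x} {y} {u} {v} x≤y u≤v ε 0<ε with x≤y (½ ℚ.* ε) (0<½* 0<ε) | u≤v (½ ℚ.* ε) (0<½* 0<ε)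
... | M , f | N , g = M ℕ.⊔ N , λ n le → begin-strict
  seq x n ℚ.+ seq u n                  <⟨ ℚₚ.+-mono-< (f n (ℕₚ.m⊔n≤o⇒m≤o M N le)) (g n (ℕₚ.m⊔n≤o⇒n≤o M N le)) ⟩
  seq y n ℚ.+ h ℚ.+ (seq v n ℚ.+ h)    ≡⟨ solve 3 (λ y v h → y :+ h :+ (v :+ h) := y :+ v :+ (h :+ h)) refl (seq y n) (seq v n) h ⟩
  seq y n ℚ.+ seq v n ℚ.+ (h ℚ.+ h)    ≡⟨ cong (λ e → seq y n ℚ.+ seq v n ℚ.+ e) (½+½ ε) ⟩
  seq y n ℚ.+ seq v n ℚ.+ ε            ∎
  where
  open ℚₚ.≤-Reasoning
  h = ½ ℚ.* ε

fromℚ-mono : ∀ {a b} → a ℚ.≤ b → fromℚ a ≤ fromℚ b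
fromℚ-mono {a} {b} a≤b = eventually-≤ {fromℚ a} {fromℚ b} 0 (λ _ _ → a≤b)

fromℚ-cancel : ∀ {a b} → fromℚ a ≤ fromℚ b → a ℚ.≤ b
fromℚ-cancel {a} {b} le with a ℚₚ.≤? b
... | yes a≤b = a≤b
... | no  a≰b with le (a ℚ.- b) (subst (ℚ._< a ℚ.- b) (ℚₚ.+-inverseʳ b) (ℚₚ.+-monoˡ-< (ℚ.- b) (ℚₚ.≰⇒> a≰b)))
...   | N , f = contradiction (f N ℕₚ.≤-refl)
  (ℚₚ.<-irrefl (solve 2 (λ a b → a := b :+ (a :- b)) refl a b))

≤-by-eps : ∀ {x y} → (∀ η → 0ℚ ℚ.< η → x ≤ y + fromℚ η) → x ≤ y
≤-by-eps {x} {y} le ε 0<ε with le (½ ℚ.* ε) (0<½* 0<ε) (½ ℚ.* ε) (0<½* 0<ε)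
... | N , f = N , λ n N≤n → subst (seq x n ℚ.<_)
  (trans (ℚₚ.+-assoc (seq y n) (½ ℚ.* ε) (½ ℚ.* ε)) (cong (λ e → seq y n ℚ.+ e) (½+½ ε))) (f n N≤n)

≈⇒≤ : ∀ {x y} → x ≈ y → x ≤ y
≈⇒≤ {x} {y} x≈y ε 0<ε with x≈y ε 0<ε
... | N , f = N , λ n N≤n → subst (ℚ._< seq y n ℚ.+ ε)
  (solve 2 (λ a b → b :+ (a :- b) := a) refl (seq x n) (seq y n))
  (ℚₚ.+-monoʳ-< (seq y n) (ℚₚ.≤-<-trans (p≤∣p∣ (seq x n ℚ.- seq y n)) (f n N≤n)))

-- The terms of x are eventually within δ of a.
Near : ℝ → ℚ → ℚ → Set
Near x a δ = ∃ λ N → ∀ p → N ℕ.≤ p → ℚ.∣ seq x p ℚ.- a ∣ ℚ.≤ δ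

-- These two choices are abstract: nothing depends on which rational is chosen.
abstract
  nearby : ∀ x δ → 0ℚ ℚ.< δ → ∃ λ a → Near x a δ
  nearby x δ 0<δ with cauchy x δ 0<δ
  ... | N , f = seq x N , N , λ n N≤n → ℚₚ.<⇒≤ (f n N N≤n ℕₚ.≤-refl)

  bracket : ∀ x η → 0ℚ ℚ.< η → ∃ λ a → fromℚ a ≤ x × x ≤ fromℚ (a ℚ.+ η)
  bracket x η 0<η with nearby x (½ ℚ.* η) (0<½* 0<η)
  ... | b , N , near = b ℚ.- h ,
    eventually-≤ {fromℚ (b ℚ.- h)} {x} N (λ n N≤n → ℚₚ.≤-trans
      (ℚₚ.+-monoˡ-≤ (ℚ.- h) (near⇒≤ b (seq x n) (subst (ℚ._≤ h) (∣p-q∣≡∣q-p∣ (seq x n) b) (near n N≤n))))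
      (ℚₚ.≤-reflexive (solve 2 (λ x h → x :+ h :- h := x) refl (seq x n) h))) ,
    eventually-≤ {x} {fromℚ (b ℚ.- h ℚ.+ η)} N (λ n N≤n → ℚₚ.≤-trans (near⇒≤ (seq x n) b (near n N≤n))
      (ℚₚ.≤-reflexive (solve 2 (λ b e → b :+ con ½ :* e := b :- con ½ :* e :+ e) refl b η)))
    where
    h : ℚ
    h = ½ ℚ.* η

-- The order is a negative statement, so classical arguments may prove it.
≤-stable : ∀ {x y} → ¬ ¬ (x ≤ y) → x ≤ y
≤-stable {x} {y} ¬¬x≤y = ≤-by-eps {x} {y} λ η 0<η →
  compare η (bracket x (½ ℚ.* η) (0<½* 0<η)) (bracket y (½ ℚ.* η) (0<½* 0<η))
  where
  decide : ∀ η a b → fromℚ a ≤ x → x ≤ fromℚ (a ℚ.+ ½ ℚ.* η) →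
           fromℚ b ≤ y → y ≤ fromℚ (b ℚ.+ ½ ℚ.* η) →
           Dec (a ℚ.≤ b ℚ.+ ½ ℚ.* η) → x ≤ y + fromℚ η
  decide η a b a≤x x≤a+ b≤y y≤b+ (yes a≤) =
    ≤-trans {x} {fromℚ (a ℚ.+ ½ ℚ.* η)} {y + fromℚ η} x≤a+
      (≤-trans {fromℚ (a ℚ.+ ½ ℚ.* η)} {fromℚ (b ℚ.+ η)} {y + fromℚ η}
        (fromℚ-mono (ℚₚ.≤-trans (ℚₚ.+-monoˡ-≤ (½ ℚ.* η) a≤)
          (ℚₚ.≤-reflexive (solve 2 (λ b e → b :+ con ½ :* e :+ con ½ :* e := b :+ e) refl b η))))
        (+-mono-≤ {fromℚ b} {y} {fromℚ η} {fromℚ η} b≤y (≤-refl {fromℚ η})))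
  decide η a b a≤x x≤a+ b≤y y≤b+ (no a≰) = contradiction
    (λ x≤y → a≰ (fromℚ-cancel (≤-trans {fromℚ a} {x} {fromℚ (b ℚ.+ ½ ℚ.* η)} a≤x
      (≤-trans {x} {y} {fromℚ (b ℚ.+ ½ ℚ.* η)} x≤y y≤b+))))
    ¬¬x≤y
  compare : ∀ η → (∃ λ a → fromℚ a ≤ x × x ≤ fromℚ (a ℚ.+ ½ ℚ.* η)) →
            (∃ λ b → fromℚ b ≤ y × y ≤ fromℚ (b ℚ.+ ½ ℚ.* η)) → x ≤ y + fromℚ η
  compare η (a , a≤x , x≤a+) (b , b≤y , y≤b+) =
    decide η a b a≤x x≤a+ b≤y y≤b+ (a ℚₚ.≤? b ℚ.+ ½ ℚ.* η)

-- For nonnegative t this says that t converges to 0.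
Null : (ℕ → ℚ) → Set
Null t = ∀ ε → 0ℚ ℚ.< ε → ∃ λ K → ∀ k → K ℕ.≤ k → t k ℚ.< ε

-- A nondecreasing sequence with an explicit bound on its future growth
-- converges.
module _ (s : ℕ → ℝ) (t : ℕ → ℚ) (0<t : ∀ k → 0ℚ ℚ.< t k) (null : Null t)
  (mono : ∀ {k l} → k ℕ.≤ l → s k ≤ s l)
  (growth : ∀ {k l} → k ℕ.≤ l → s l ≤ s k + fromℚ (t k)) where

  private
    a : ℕ → ℚ
    a k = proj₁ (bracket (s k) (t k) (0<t k))

    a≤s : ∀ k → fromℚ (a k) ≤ s k
    a≤s k = proj₁ (proj₂ (bracket (s k) (t k) (0<t k)))

    s≤a+t : ∀ k → s k ≤ fromℚ (a k ℚ.+ t k)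
    s≤a+t k = proj₂ (proj₂ (bracket (s k) (t k) (0<t k)))

    up : ∀ {k l} → k ℕ.≤ l → a k ℚ.≤ a l ℚ.+ t l
    up {k} {l} k≤l = fromℚ-cancel (≤-trans {fromℚ (a k)} {s k} {fromℚ (a l ℚ.+ t l)} (a≤s k)
      (≤-trans {s k} {s l} {fromℚ (a l ℚ.+ t l)} (mono k≤l) (s≤a+t l)))

    down : ∀ {k l} → k ℕ.≤ l → a l ℚ.≤ a k ℚ.+ t k ℚ.+ t k
    down {k} {l} k≤l = fromℚ-cancel (≤-trans {fromℚ (a l)} {s l} {fromℚ (a k ℚ.+ t k ℚ.+ t k)} (a≤s l)
      (≤-trans {s l} {s k + fromℚ (t k)} {fromℚ (a k ℚ.+ t k ℚ.+ t k)} (growth k≤l)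
        (+-mono-≤ {s k} {fromℚ (a k ℚ.+ t k)} {fromℚ (t k)} {fromℚ (t k)} (s≤a+t k) (≤-refl {fromℚ (t k)}))))

    a-cauchy : Cauchy a
    a-cauchy ε 0<ε with null (½ ℚ.* ε) (0<½* 0<ε)
    ... | K , small = K , λ k l K≤k K≤l → ordered k l K≤k K≤l (ℕₚ.≤-total k l)
      where
      open ℚₚ.≤-Reasoning
      close : ∀ {k l} → K ℕ.≤ k → k ℕ.≤ l → ℚ.∣ a k ℚ.- a l ∣ ℚ.< ε
      close {k} {l} K≤k k≤l = ℚₚ.≤-<-trans (∣∣-lub lo hi) mid
        where
        r = t k ℚ.+ t k ℚ.+ t l
        r′ = (t k ℚ.⊔ t l) ℚ.+ (t k ℚ.⊔ t l)
        lo : a k ℚ.- a l ℚ.≤ r′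
        lo = begin
          a k ℚ.- a l           ≤⟨ ℚₚ.+-monoˡ-≤ (ℚ.- a l) (up k≤l) ⟩
          a l ℚ.+ t l ℚ.- a l   ≡⟨ solve 2 (λ a t → a :+ t :- a := con 0ℚ :+ t) refl (a l) (t l) ⟩
          0ℚ ℚ.+ t l            ≤⟨ ℚₚ.+-mono-≤ (ℚₚ.≤-trans (ℚₚ.<⇒≤ (0<t l)) (ℚₚ.p≤q⊔p (t k) (t l))) (ℚₚ.p≤q⊔p (t k) (t l)) ⟩
          r′                    ∎
        hi : ℚ.- (a k ℚ.- a l) ℚ.≤ r′
        hi = begin
          ℚ.- (a k ℚ.- a l)             ≡⟨ solve 2 (λ a b → :- (a :- b) := b :- a) refl (a k) (a l) ⟩
          a l ℚ.- a k                   ≤⟨ ℚₚ.+-monoˡ-≤ (ℚ.- a k) (down k≤l) ⟩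
          a k ℚ.+ t k ℚ.+ t k ℚ.- a k   ≡⟨ solve 2 (λ a t → a :+ t :+ t :- a := t :+ t) refl (a k) (t k) ⟩
          t k ℚ.+ t k                   ≤⟨ ℚₚ.+-mono-≤ (ℚₚ.p≤p⊔q (t k) (t l)) (ℚₚ.p≤p⊔q (t k) (t l)) ⟩
          r′                            ∎
        max< : t k ℚ.⊔ t l ℚ.< ½ ℚ.* ε
        max< with ℚₚ.⊔-sel (t k) (t l)
        ... | inj₁ eq = subst (ℚ._< ½ ℚ.* ε) (sym eq) (small k K≤k)
        ... | inj₂ eq = subst (ℚ._< ½ ℚ.* ε) (sym eq) (small l (ℕₚ.≤-trans K≤k k≤l))
        mid : r′ ℚ.< ε
        mid = subst (r′ ℚ.<_) (½+½ ε) (ℚₚ.+-mono-< max< max<)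
      ordered : ∀ k l → K ℕ.≤ k → K ℕ.≤ l → _ → ℚ.∣ a k ℚ.- a l ∣ ℚ.< ε
      ordered k l K≤k K≤l (inj₁ k≤l) = close K≤k k≤l
      ordered k l K≤k K≤l (inj₂ l≤k) = subst (ℚ._< ε) (∣p-q∣≡∣q-p∣ (a l) (a k)) (close K≤l l≤k)

  -- Its n-th term is a rational approximation from below of s n, up to t n.
  limit : ℝ
  limit = mkℝ a a-cauchy

  below-limit : ∀ k → s k ≤ limit
  below-limit k = ≤-by-eps {s k} {limit} go
    where
    go : ∀ η → 0ℚ ℚ.< η → s k ≤ limit + fromℚ η
    go η 0<η with null (½ ℚ.* η) (0<½* 0<η) | bracket (s k) (½ ℚ.* η) (0<½* 0<η)
    ... | K , small | b , b≤s , s≤b+ = ≤-trans {s k} {fromℚ (b ℚ.+ ½ ℚ.* η)} {limit + fromℚ η} s≤b+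
      (eventually-≤ {fromℚ (b ℚ.+ ½ ℚ.* η)} {limit + fromℚ η} (K ℕ.⊔ k) λ n le → begin
        b ℚ.+ ½ ℚ.* η
          ≤⟨ ℚₚ.+-monoˡ-≤ (½ ℚ.* η) (fromℚ-cancel {b} {a n ℚ.+ t n} (≤-trans {fromℚ b} {s k} {fromℚ (a n ℚ.+ t n)} b≤s
               (≤-trans {s k} {s n} {fromℚ (a n ℚ.+ t n)} (mono (ℕₚ.m⊔n≤o⇒n≤o K k le)) (s≤a+t n)))) ⟩
        a n ℚ.+ t n ℚ.+ ½ ℚ.* η
          ≤⟨ ℚₚ.+-monoˡ-≤ (½ ℚ.* η) (ℚₚ.+-monoʳ-≤ (a n) (ℚₚ.<⇒≤ (small n (ℕₚ.m⊔n≤o⇒m≤o K k le)))) ⟩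
        a n ℚ.+ ½ ℚ.* η ℚ.+ ½ ℚ.* η
          ≡⟨ trans (ℚₚ.+-assoc (a n) _ _) (cong (λ e → a n ℚ.+ e) (½+½ η)) ⟩
        a n ℚ.+ η ∎)
      where open ℚₚ.≤-Reasoning

  limit-below : ∀ k → limit ≤ s k + fromℚ (t k)
  limit-below k = ≤-by-eps {limit} {s k + fromℚ (t k)} λ η 0<η → go η (bracket (s k) η 0<η)
    where
    go : ∀ η → (∃ λ b → fromℚ b ≤ s k × s k ≤ fromℚ (b ℚ.+ η)) → limit ≤ s k + fromℚ (t k) + fromℚ η
    go η (b , b≤ , ≤b+) = ≤-trans {limit} {fromℚ (b ℚ.+ η ℚ.+ t k)} {s k + fromℚ (t k) + fromℚ η}
      (eventually-≤ {limit} {fromℚ (b ℚ.+ η ℚ.+ t k)} k λ n k≤n → fromℚ-cancel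
        (≤-trans {fromℚ (a n)} {s n} {fromℚ (b ℚ.+ η ℚ.+ t k)} (a≤s n)
          (≤-trans {s n} {s k + fromℚ (t k)} {fromℚ (b ℚ.+ η ℚ.+ t k)} (growth k≤n)
            (+-mono-≤ {s k} {fromℚ (b ℚ.+ η)} {fromℚ (t k)} {fromℚ (t k)} ≤b+ (≤-refl {fromℚ (t k)})))))
      (≤-trans {fromℚ (b ℚ.+ η ℚ.+ t k)} {fromℚ (b ℚ.+ t k ℚ.+ η)} {s k + fromℚ (t k) + fromℚ η}
        (fromℚ-mono (ℚₚ.≤-reflexive (solve 3 (λ b e t → b :+ e :+ t := b :+ t :+ e) refl b η (t k))))
        (+-mono-≤ {fromℚ (b ℚ.+ t k)} {s k + fromℚ (t k)} {fromℚ η} {fromℚ η}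
          (+-mono-≤ {fromℚ b} {s k} {fromℚ (t k)} {fromℚ (t k)} b≤ (≤-refl {fromℚ (t k)}))
          (≤-refl {fromℚ η})))

  limit-lub : ∀ {x} → (∀ k → s k ≤ x) → limit ≤ x
  limit-lub {x} s≤x = ≤-by-eps {limit} {x} go
    where
    go : ∀ η → 0ℚ ℚ.< η → limit ≤ x + fromℚ η
    go η 0<η with null η 0<η
    ... | K , small = ≤-trans {limit} {s K + fromℚ (t K)} {x + fromℚ η} (limit-below K)
      (+-mono-≤ {s K} {x} {fromℚ (t K)} {fromℚ η} (s≤x K) (fromℚ-mono (ℚₚ.<⇒≤ (small K ℕₚ.≤-refl))))

  converges : ∀ ε → 0ℚ ℚ.< ε → ∃ λ K → ∀ k → K ℕ.≤ k → ∣ s k - limit ∣ < fromℚ ε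
  converges ε 0<ε with null h (0<½* (0<½* 0<ε))
    where h = ½ ℚ.* (½ ℚ.* ε)
  ... | K , small = K , λ k K≤k → within k (small k K≤k)
    (below-limit k h (0<½* (0<½* 0<ε))) (limit-below k h (0<½* (0<½* 0<ε)))
    where
    open ℚₚ.≤-Reasoning
    h = ½ ℚ.* (½ ℚ.* ε)
    Eventually : (ℕ → Set) → Set
    Eventually P = ∃ λ N → ∀ n → N ℕ.≤ n → P n
    within : ∀ k → t k ℚ.< h → Eventually (λ n → seq (s k) n ℚ.< a n ℚ.+ h) →
             Eventually (λ n → a n ℚ.< seq (s k) n ℚ.+ t k ℚ.+ h) → ∣ s k - limit ∣ < fromℚ ε
    within k t<h (M , f) (N , g) = ½ ℚ.* ε , 0<½* 0<ε , M ℕ.⊔ N , λ n le → begin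
      ℚ.∣ seq (s k) n ℚ.- a n ∣ ℚ.+ ½ ℚ.* ε   ≤⟨ ℚₚ.+-monoˡ-≤ (½ ℚ.* ε) (∣∣-lub
          (lo n (ℕₚ.m⊔n≤o⇒m≤o M N le)) (hi n (ℕₚ.m⊔n≤o⇒n≤o M N le))) ⟩
      h ℚ.+ h ℚ.+ ½ ℚ.* ε                      ≡⟨ cong (λ e → e ℚ.+ ½ ℚ.* ε) (½+½ (½ ℚ.* ε)) ⟩
      ½ ℚ.* ε ℚ.+ ½ ℚ.* ε                      ≡⟨ ½+½ ε ⟩
      ε                                        ∎
      where
      lo : ∀ n → M ℕ.≤ n → seq (s k) n ℚ.- a n ℚ.≤ h ℚ.+ h
      lo n M≤n = begin
        seq (s k) n ℚ.- a n     ≤⟨ ℚₚ.+-monoˡ-≤ (ℚ.- a n) (ℚₚ.<⇒≤ (f n M≤n)) ⟩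
        a n ℚ.+ h ℚ.- a n       ≡⟨ solve 2 (λ a h → a :+ h :- a := h :+ con 0ℚ) refl (a n) h ⟩
        h ℚ.+ 0ℚ                ≤⟨ ℚₚ.+-monoʳ-≤ h (ℚₚ.<⇒≤ (0<½* (0<½* 0<ε))) ⟩
        h ℚ.+ h                 ∎
      hi : ∀ n → N ℕ.≤ n → ℚ.- (seq (s k) n ℚ.- a n) ℚ.≤ h ℚ.+ h
      hi n N≤n = begin
        ℚ.- (seq (s k) n ℚ.- a n)                      ≡⟨ solve 2 (λ s a → :- (s :- a) := a :- s) refl (seq (s k) n) (a n) ⟩
        a n ℚ.- seq (s k) n                            ≤⟨ ℚₚ.+-monoˡ-≤ (ℚ.- seq (s k) n) (ℚₚ.<⇒≤ (g n N≤n)) ⟩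
        seq (s k) n ℚ.+ t k ℚ.+ h ℚ.- seq (s k) n      ≡⟨ solve 3 (λ s t h → s :+ t :+ h :- s := t :+ h) refl (seq (s k) n) (t k) h ⟩
        t k ℚ.+ h                                      ≤⟨ ℚₚ.+-monoˡ-≤ h (ℚₚ.<⇒≤ t<h) ⟩
        h ℚ.+ h                                        ∎

-- Null sequences, binary scales and finite sums

-- Bernoulli's inequality, in the form x k (1 + k δ) <= x 0, shows that a
-- geometric sequence of ratio at most 1 / (1 + δ) is null.
module _ (x : ℕ → ℚ) (0≤x : ∀ k → 0ℚ ℚ.≤ x k) (ρ δ : ℚ) (0≤ρ : 0ℚ ℚ.≤ ρ) (0<δ : 0ℚ ℚ.< δ)
  (ρ≤ : ρ ℚ.* (1ℚ ℚ.+ δ) ℚ.≤ 1ℚ) (x-suc : ∀ k → x (suc k) ≡ ρ ℚ.* x k) where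

  private
    0≤δ : 0ℚ ℚ.≤ δ
    0≤δ = ℚₚ.<⇒≤ 0<δ

    bernoulli : ∀ k → x k ℚ.* (1ℚ ℚ.+ ι k ℚ.* δ) ℚ.≤ x 0
    bernoulli zero    = ℚₚ.≤-reflexive (solve 2 (λ x d → x :* (con 1ℚ :+ con 0ℚ :* d) := x) refl (x 0) δ)
    bernoulli (suc k) = begin
      x (suc k) ℚ.* (1ℚ ℚ.+ ι (suc k) ℚ.* δ)
        ≡⟨ cong₂ (λ y i → y ℚ.* (1ℚ ℚ.+ i ℚ.* δ)) (x-suc k) (ι-suc k) ⟩
      ρ ℚ.* x k ℚ.* (1ℚ ℚ.+ (1ℚ ℚ.+ ι k) ℚ.* δ)
        ≤⟨ ≤-by (ρ ℚ.* x k ℚ.* (δ ℚ.* (ι k ℚ.* δ))) (0≤* (0≤* 0≤ρ (0≤x k)) (0≤* 0≤δ (0≤* (0≤ι k) 0≤δ)))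
             (solve 4 (λ r x k d → r :* x :* (con 1ℚ :+ (con 1ℚ :+ k) :* d) :+ r :* x :* (d :* (k :* d))
                := r :* (con 1ℚ :+ d) :* (x :* (con 1ℚ :+ k :* d))) refl ρ (x k) (ι k) δ) ⟩
      ρ ℚ.* (1ℚ ℚ.+ δ) ℚ.* (x k ℚ.* (1ℚ ℚ.+ ι k ℚ.* δ))
        ≤⟨ *-monoʳ _ (0≤* (0≤x k) (0≤+ (0≤ι 1) (0≤* (0≤ι k) 0≤δ))) ρ≤ ⟩
      1ℚ ℚ.* (x k ℚ.* (1ℚ ℚ.+ ι k ℚ.* δ))
        ≡⟨ ℚₚ.*-identityˡ _ ⟩
      x k ℚ.* (1ℚ ℚ.+ ι k ℚ.* δ)
        ≤⟨ bernoulli k ⟩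
      x 0 ∎
      where open ℚₚ.≤-Reasoning

  geometric-null : Null x
  geometric-null ε 0<ε = N , small
    where
    open ℚₚ.≤-Reasoning
    εδ = ε ℚ.* δ
    0<εδ : 0ℚ ℚ.< εδ
    0<εδ = 0<* 0<ε 0<δ
    instance
      εδ≢0 : ℚ.NonZero εδ
      εδ≢0 = ℚ.>-nonZero 0<εδ
    arch = archimedean (x 0 ℚ.* ℚ.1/ εδ)
    N = proj₁ arch
    small : ∀ k → N ℕ.≤ k → x k ℚ.< ε
    small k N≤k = ℚₚ.*-cancelʳ-<-nonNeg y {{ℚ.nonNegative 0≤y}} (begin-strict
      x k ℚ.* y                   ≤⟨ bernoulli k ⟩
      x 0                         ≡⟨ ℚₚ.*-identityʳ (x 0) ⟨
      x 0 ℚ.* 1ℚ                  ≡⟨ cong (x 0 ℚ.*_) (ℚₚ.*-inverseˡ εδ) ⟨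
      x 0 ℚ.* (ℚ.1/ εδ ℚ.* εδ)    ≡⟨ ℚₚ.*-assoc (x 0) (ℚ.1/ εδ) εδ ⟨
      x 0 ℚ.* ℚ.1/ εδ ℚ.* εδ      ≤⟨ *-monoʳ εδ (ℚₚ.<⇒≤ 0<εδ) (ℚₚ.≤-trans (proj₂ arch) (ι-mono-≤ N≤k)) ⟩
      ι k ℚ.* εδ                  <⟨ p<p+ε (ι k ℚ.* εδ) 0<ε ⟩
      ι k ℚ.* εδ ℚ.+ ε            ≡⟨ solve 3 (λ k e d → k :* (e :* d) :+ e := e :* (con 1ℚ :+ k :* d)) refl (ι k) ε δ ⟩
      ε ℚ.* y                     ∎)
      where
      y = 1ℚ ℚ.+ ι k ℚ.* δ
      0≤y : 0ℚ ℚ.≤ y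
      0≤y = 0≤+ (0≤ι 1) (0≤* (0≤ι k) 0≤δ)

0<2^- : ∀ k → 0ℚ ℚ.< 2^- k
0<2^- zero    = ℚₚ.positive⁻¹ 1ℚ
0<2^- (suc k) = 0<½* (0<2^- k)

2^-≤1 : ∀ k → 2^- k ℚ.≤ 1ℚ
2^-≤1 zero    = ℚₚ.≤-refl
2^-≤1 (suc k) = ℚₚ.≤-trans (≤-by (½ ℚ.* 2^- k) (ℚₚ.<⇒≤ (0<½* (0<2^- k))) (½+½ (2^- k))) (2^-≤1 k)

2^*2^- : ∀ e k → ι (2 ℕ.^ e) ℚ.* 2^- (e ℕ.+ k) ≡ 2^- k
2^*2^- zero    k = ℚₚ.*-identityˡ (2^- k)
2^*2^- (suc e) k = trans (cong (ℚ._* (½ ℚ.* 2^- (e ℕ.+ k))) (ι-* 2 (2 ℕ.^ e)))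
  (trans (solve 2 (λ x y → con (ι 2) :* x :* (con ½ :* y) := x :* y) refl (ι (2 ℕ.^ e)) (2^- (e ℕ.+ k)))
         (2^*2^- e k))

-- Finite sums of rationals over Fin n.
∑F : ∀ {n} → Vector ℚ n → ℚ
∑F = foldr ℚ._+_ 0ℚ

∑F-mono : ∀ {n} {f g : Vector ℚ n} → (∀ i → f i ℚ.≤ g i) → ∑F f ℚ.≤ ∑F g
∑F-mono {zero}  le = ℚₚ.≤-refl
∑F-mono {suc n} le = ℚₚ.+-mono-≤ (le zero) (∑F-mono (le ∘ suc))

∑F-cong : ∀ {n} {f g : Vector ℚ n} → (∀ i → f i ≡ g i) → ∑F f ≡ ∑F g
∑F-cong {zero}  eq = refl
∑F-cong {suc n} eq = cong₂ ℚ._+_ (eq zero) (∑F-cong (eq ∘ suc))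

∑F-+const : ∀ n (f : Vector ℚ n) c → ∑F (λ i → f i ℚ.+ c) ≡ ∑F f ℚ.+ ι n ℚ.* c
∑F-+const zero    f c = sym (trans (ℚₚ.+-identityˡ _) (ℚₚ.*-zeroˡ c))
∑F-+const (suc n) f c = trans (cong (f zero ℚ.+ c ℚ.+_) (∑F-+const n (tail f) c))
  (trans (solve 4 (λ a c s n → a :+ c :+ (s :+ n :* c) := a :+ s :+ (con 1ℚ :+ n) :* c) refl (f zero) c (∑F (tail f)) (ι n))
         (cong (λ k → f zero ℚ.+ ∑F (tail f) ℚ.+ k ℚ.* c) (sym (ι-suc n))))

∑F-*ʳ : ∀ n (f : Vector ℚ n) c → ∑F (λ i → f i ℚ.* c) ≡ ∑F f ℚ.* c
∑F-*ʳ zero    f c = sym (ℚₚ.*-zeroˡ c)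
∑F-*ʳ (suc n) f c = trans (cong (λ s → f zero ℚ.* c ℚ.+ s) (∑F-*ʳ n (tail f) c))
  (sym (ℚₚ.*-distribʳ-+ c (f zero) (∑F (tail f))))

∣ι-ι∣-ordered : ∀ {m n} → m ℕ.≤ n → ℚ.∣ ι n ℚ.- ι m ∣ ≡ ι ℕ.∣ m - n ∣
∣ι-ι∣-ordered {m} {n} m≤n = begin
  ℚ.∣ ι n ℚ.- ι m ∣                    ≡⟨ cong (λ k → ℚ.∣ ι k ℚ.- ι m ∣) (ℕₚ.m+[n∸m]≡n m≤n) ⟨
  ℚ.∣ ι (m ℕ.+ (n ℕ.∸ m)) ℚ.- ι m ∣    ≡⟨ cong (λ x → ℚ.∣ x ℚ.- ι m ∣) (ι-+ m (n ℕ.∸ m)) ⟩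
  ℚ.∣ ι m ℚ.+ ι (n ℕ.∸ m) ℚ.- ι m ∣    ≡⟨ cong ℚ.∣_∣ (solve 2 (λ a b → a :+ b :- a := b) refl (ι m) (ι (n ℕ.∸ m))) ⟩
  ℚ.∣ ι (n ℕ.∸ m) ∣                    ≡⟨ ℚₚ.0≤p⇒∣p∣≡p (0≤ι (n ℕ.∸ m)) ⟩
  ι (n ℕ.∸ m)                          ≡⟨ cong ι (ℕₚ.m≤n⇒∣m-n∣≡n∸m m≤n) ⟨
  ι ℕ.∣ m - n ∣                        ∎
  where open ≡-Reasoning

∣ι-ι∣ : ∀ m n → ℚ.∣ ι n ℚ.- ι m ∣ ≡ ι ℕ.∣ m - n ∣
∣ι-ι∣ m n with ℕₚ.≤-total m n
... | inj₁ m≤n = ∣ι-ι∣-ordered m≤n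
... | inj₂ n≤m = trans (∣p-q∣≡∣q-p∣ (ι n) (ι m)) (trans (∣ι-ι∣-ordered n≤m) (cong ι (ℕₚ.∣-∣-comm n m)))
ι-dist₁ : ∀ {n} (u v : Vector ℕ n) → ∑F (λ i → ℚ.∣ ι (v i) ℚ.- ι (u i) ∣) ≡ ι (dist₁ u v)
ι-dist₁ {zero}  u v = refl
ι-dist₁ {suc n} u v = trans (cong₂ ℚ._+_ (∣ι-ι∣ (u zero) (v zero)) (ι-dist₁ (tail u) (tail v)))
  (sym (ι-+ ℕ.∣ u zero - v zero ∣ (dist₁ (tail u) (tail v))))

commonDenominator : ∀ {n} (a : Vector ℚ n) → ∃ λ Q → ℕ.NonZero Q × ∃ λ (b : Vector ℤ n) →
                    ∀ i → a i ℚ.* ι Q ≡ ιℤ (b i)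
commonDenominator {zero}  a = 1 , _ , (λ ()) , λ ()
commonDenominator {suc n} a with commonDenominator (tail a)
... | Q , Q≢0 , b , eq = d ℕ.* Q , ℕₚ.m*n≢0 d Q {{_}} {{Q≢0}} ,
  (λ { zero → ℚ.↥ a zero ℤ.* + Q ; (suc i) → + d ℤ.* b i }) ,
  λ { zero → begin
        a zero ℚ.* ι (d ℕ.* Q)          ≡⟨ cong (a zero ℚ.*_) (ι-* d Q) ⟩
        a zero ℚ.* (ι d ℚ.* ι Q)        ≡⟨ ℚₚ.*-assoc (a zero) (ι d) (ι Q) ⟨
        a zero ℚ.* ι d ℚ.* ι Q          ≡⟨ cong (ℚ._* ι Q) (clear-denominator (a zero)) ⟩
        ιℤ (ℚ.↥ a zero) ℚ.* ι Q         ≡⟨ ιℤ-* (ℚ.↥ a zero) (+ Q) ⟨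
        ιℤ (ℚ.↥ a zero ℤ.* + Q)         ∎
    ; (suc i) → begin
        a (suc i) ℚ.* ι (d ℕ.* Q)       ≡⟨ cong (a (suc i) ℚ.*_) (ι-* d Q) ⟩
        a (suc i) ℚ.* (ι d ℚ.* ι Q)     ≡⟨ solve 3 (λ a d Q → a :* (d :* Q) := d :* (a :* Q)) refl (a (suc i)) (ι d) (ι Q) ⟩
        ι d ℚ.* (a (suc i) ℚ.* ι Q)     ≡⟨ cong (ι d ℚ.*_) (eq i) ⟩
        ι d ℚ.* ιℤ (b i)                ≡⟨ ιℤ-* (+ d) (b i) ⟨
        ιℤ (+ d ℤ.* b i)                ∎ }
  where
  open ≡-Reasoning
  d = ℚ.↧ₙ a zero

-- Rational approximation of the distance function

norm-≤ : ∀ {n} (v : Vector ℝ n) (r : Vector ℚ n) → (∀ i → ∣ v i ∣ ≤ fromℚ (r i)) → ‖ v ‖₁ ≤ fromℚ (∑F r)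
norm-≤ {zero}  v r le = ≤-refl {0ℝ}
norm-≤ {suc n} v r le = +-mono-≤ {∣ v zero ∣} {fromℚ (r zero)} {‖ tail v ‖₁} {fromℚ (∑F (tail r))}
  (le zero) (norm-≤ (tail v) (tail r) (le ∘ suc))

0≤norm : ∀ {n} (v : Vector ℝ n) → 0ℝ ≤ ‖ v ‖₁
0≤norm {zero}  v = ≤-refl {0ℝ}
0≤norm {suc n} v = +-mono-≤ {0ℝ} {∣ v zero ∣} {0ℝ} {‖ tail v ‖₁}
  (eventually-≤ {0ℝ} {∣ v zero ∣} 0 (λ p _ → ℚₚ.0≤∣p∣ (seq (v zero) p))) (0≤norm (tail v))

coordinate-≤ : ∀ x a δ τ z → 0ℚ ℚ.≤ τ → Near x a δ →
               ∣ fromℚ τ * x - fromℤ z ∣ ≤ fromℚ (ℚ.∣ τ ℚ.* a ℚ.- ιℤ z ∣ ℚ.+ τ ℚ.* δ)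
coordinate-≤ x a δ τ z 0≤τ (N , near) = eventually-≤ {∣ fromℚ τ * x - fromℤ z ∣} {fromℚ (ℚ.∣ τ ℚ.* a ℚ.- ιℤ z ∣ ℚ.+ τ ℚ.* δ)} N λ p N≤p → begin
  ℚ.∣ τ ℚ.* seq x p ℚ.- ιℤ z ∣
    ≡⟨ cong ℚ.∣_∣ (solve 4 (λ t x z a → t :* x :- z := (t :* a :- z) :+ t :* (x :- a)) refl τ (seq x p) (ιℤ z) a) ⟩
  ℚ.∣ (τ ℚ.* a ℚ.- ιℤ z) ℚ.+ τ ℚ.* (seq x p ℚ.- a) ∣
    ≤⟨ ℚₚ.∣p+q∣≤∣p∣+∣q∣ (τ ℚ.* a ℚ.- ιℤ z) (τ ℚ.* (seq x p ℚ.- a)) ⟩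
  ℚ.∣ τ ℚ.* a ℚ.- ιℤ z ∣ ℚ.+ ℚ.∣ τ ℚ.* (seq x p ℚ.- a) ∣
    ≡⟨ cong (ℚ.∣ τ ℚ.* a ℚ.- ιℤ z ∣ ℚ.+_) (trans (ℚₚ.∣p*q∣≡∣p∣*∣q∣ τ (seq x p ℚ.- a)) (cong (ℚ._* ℚ.∣ seq x p ℚ.- a ∣) (ℚₚ.0≤p⇒∣p∣≡p 0≤τ))) ⟩
  ℚ.∣ τ ℚ.* a ℚ.- ιℤ z ∣ ℚ.+ τ ℚ.* ℚ.∣ seq x p ℚ.- a ∣
    ≤⟨ ℚₚ.+-monoʳ-≤ ℚ.∣ τ ℚ.* a ℚ.- ιℤ z ∣ (*-monoˡ τ 0≤τ (near p N≤p)) ⟩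
  ℚ.∣ τ ℚ.* a ℚ.- ιℤ z ∣ ℚ.+ τ ℚ.* δ ∎
  where open ℚₚ.≤-Reasoning

distance-≤ : ∀ {n} (c : Vector ℝ n) (a : Vector ℚ n) δ → (∀ i → Near (c i) (a i) δ) →
             ∀ τ → 0ℚ ℚ.≤ τ → ∀ z →
             ‖ fromℚ τ • c ⊖ z ‖₁ ≤ fromℚ (∑F (λ i → ℚ.∣ τ ℚ.* a i ℚ.- ιℤ (z i) ∣ ℚ.+ τ ℚ.* δ))
distance-≤ c a δ near τ 0≤τ z = norm-≤ (fromℚ τ • c ⊖ z) _
  (λ i → coordinate-≤ (c i) (a i) δ τ (z i) 0≤τ (near i))

-- Let a = B / Q₁, τ = d / 2^K and Q = Q₁ 2^K, and let b be the residue of B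
-- modulo Q.  If u and v differ by d F b modulo Q F, then τ a - z = (v - u) / (Q F)
-- for some integer z.
represented : ∀ a Q₁ (B : ℤ) → a ℚ.* ι Q₁ ≡ ιℤ B → ∀ K F d u v →
  let Q = Q₁ ℕ.* 2 ℕ.^ K in .{{_ : ℕ.NonZero Q}} →
  v ≡ u ℕ.+ d ℕ.* (F ℕ.* (B %ℕ Q)) mod (Q ℕ.* F) →
  ∃ λ z → (ι d ℚ.* 2^- K ℚ.* a ℚ.- ιℤ z) ℚ.* ι (Q ℕ.* F) ≡ ι v ℚ.- ι u
represented a Q₁ B aQ₁≡B K F d u v (w , w′ , eq) = z , (begin
  (ι d ℚ.* 2^- K ℚ.* a ℚ.- ιℤ z) ℚ.* ι (Q ℕ.* F)
    ≡⟨ cong₂ (λ y s → (ι d ℚ.* 2^- K ℚ.* a ℚ.- s) ℚ.* y) ιQF ιz ⟩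
  (ι d ℚ.* 2^- K ℚ.* a ℚ.- (W ℚ.- W′ ℚ.+ ι d ℚ.* H)) ℚ.* (ι Q ℚ.* ι F)
    ≡⟨ solve 8 (λ d h a W W′ H Q F → (d :* h :* a :- (W :- W′ :+ d :* H)) :* (Q :* F)
         := d :* F :* (a :* h :* Q) :- (W :- W′ :+ d :* H) :* (Q :* F)) refl (ι d) (2^- K) a W W′ H (ι Q) (ι F) ⟩
  ι d ℚ.* ι F ℚ.* (a ℚ.* 2^- K ℚ.* ι Q) ℚ.- (W ℚ.- W′ ℚ.+ ι d ℚ.* H) ℚ.* (ι Q ℚ.* ι F)
    ≡⟨ cong (λ y → ι d ℚ.* ι F ℚ.* y ℚ.- (W ℚ.- W′ ℚ.+ ι d ℚ.* H) ℚ.* (ι Q ℚ.* ι F)) ahQ ⟩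
  ι d ℚ.* ι F ℚ.* (R ℚ.+ H ℚ.* ι Q) ℚ.- (W ℚ.- W′ ℚ.+ ι d ℚ.* H) ℚ.* (ι Q ℚ.* ι F)
    ≡⟨ solve 8 (λ d F R H Q W W′ u → d :* F :* (R :+ H :* Q) :- (W :- W′ :+ d :* H) :* (Q :* F)
         := u :+ d :* (F :* R) :+ W′ :* (Q :* F) :- W :* (Q :* F) :- u) refl (ι d) (ι F) R H (ι Q) W W′ (ι u) ⟩
  ι u ℚ.+ ι d ℚ.* (ι F ℚ.* R) ℚ.+ W′ ℚ.* (ι Q ℚ.* ι F) ℚ.- W ℚ.* (ι Q ℚ.* ι F) ℚ.- ι u
    ≡⟨ cong (λ y → y ℚ.- W ℚ.* (ι Q ℚ.* ι F) ℚ.- ι u) (sym ιeq) ⟩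
  ι v ℚ.+ W ℚ.* (ι Q ℚ.* ι F) ℚ.- W ℚ.* (ι Q ℚ.* ι F) ℚ.- ι u
    ≡⟨ solve 3 (λ v y u → v :+ y :- y :- u := v :- u) refl (ι v) (W ℚ.* (ι Q ℚ.* ι F)) (ι u) ⟩
  ι v ℚ.- ι u ∎)
  where
  open ≡-Reasoning
  Q = Q₁ ℕ.* 2 ℕ.^ K
  r = B %ℕ Q
  h = B /ℕ Q
  z = + w ℤ.- + w′ ℤ.+ + d ℤ.* h
  R = ι r
  H = ιℤ h
  W = ι w
  W′ = ι w′
  ιQF : ι (Q ℕ.* F) ≡ ι Q ℚ.* ι F
  ιQF = ι-* Q F
  ιz : ιℤ z ≡ W ℚ.- W′ ℚ.+ ι d ℚ.* H
  ιz = trans (ιℤ-+ (+ w ℤ.- + w′) (+ d ℤ.* h))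
    (cong₂ ℚ._+_ (trans (ιℤ-+ (+ w) (ℤ.- + w′)) (cong (W ℚ.+_) (ιℤ-neg (+ w′)))) (ιℤ-* (+ d) h))
  ahQ : a ℚ.* 2^- K ℚ.* ι Q ≡ R ℚ.+ H ℚ.* ι Q
  ahQ = begin
    a ℚ.* 2^- K ℚ.* ι Q                       ≡⟨ cong (a ℚ.* 2^- K ℚ.*_) (ι-* Q₁ (2 ℕ.^ K)) ⟩
    a ℚ.* 2^- K ℚ.* (ι Q₁ ℚ.* ι (2 ℕ.^ K))    ≡⟨ solve 4 (λ a h q p → a :* h :* (q :* p) := a :* q :* (p :* h)) refl a (2^- K) (ι Q₁) (ι (2 ℕ.^ K)) ⟩
    a ℚ.* ι Q₁ ℚ.* (ι (2 ℕ.^ K) ℚ.* 2^- K)    ≡⟨ cong₂ ℚ._*_ aQ₁≡B (trans (cong (λ k → ι (2 ℕ.^ K) ℚ.* 2^- k) (sym (ℕₚ.+-identityʳ K))) (2^*2^- K 0)) ⟩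
    ιℤ B ℚ.* 1ℚ                               ≡⟨ ℚₚ.*-identityʳ (ιℤ B) ⟩
    ιℤ B                                      ≡⟨ cong ιℤ (a≡a%ℕn+[a/ℕn]*n B Q) ⟩
    ιℤ (+ r ℤ.+ h ℤ.* + Q)                    ≡⟨ trans (ιℤ-+ (+ r) (h ℤ.* + Q)) (cong (R ℚ.+_) (ιℤ-* h (+ Q))) ⟩
    R ℚ.+ H ℚ.* ι Q                           ∎
  ιeq : ι v ℚ.+ W ℚ.* (ι Q ℚ.* ι F) ≡ ι u ℚ.+ ι d ℚ.* (ι F ℚ.* R) ℚ.+ W′ ℚ.* (ι Q ℚ.* ι F)
  ιeq = begin
    ι v ℚ.+ W ℚ.* (ι Q ℚ.* ι F)                           ≡⟨ cong (λ y → ι v ℚ.+ W ℚ.* y) ιQF ⟨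
    ι v ℚ.+ W ℚ.* ι (Q ℕ.* F)                             ≡⟨ trans (ι-+ v (w ℕ.* (Q ℕ.* F))) (cong (ι v ℚ.+_) (ι-* w (Q ℕ.* F))) ⟨
    ι (v ℕ.+ w ℕ.* (Q ℕ.* F))                             ≡⟨ cong ι eq ⟩
    ι (u ℕ.+ d ℕ.* (F ℕ.* r) ℕ.+ w′ ℕ.* (Q ℕ.* F))        ≡⟨ ι-+ (u ℕ.+ d ℕ.* (F ℕ.* r)) (w′ ℕ.* (Q ℕ.* F)) ⟩
    ι (u ℕ.+ d ℕ.* (F ℕ.* r)) ℚ.+ ι (w′ ℕ.* (Q ℕ.* F))    ≡⟨ cong₂ ℚ._+_
      (trans (ι-+ u (d ℕ.* (F ℕ.* r))) (cong (ι u ℚ.+_) (trans (ι-* d (F ℕ.* r)) (cong (ι d ℚ.*_) (ι-* F r)))))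
      (trans (ι-* w′ (Q ℕ.* F)) (cong (W′ ℚ.*_) ιQF)) ⟩
    ι u ℚ.+ ι d ℚ.* (ι F ℚ.* R) ℚ.+ W′ ℚ.* (ι Q ℚ.* ι F)  ∎

-- The series of minima

level-null : ∀ n → Null (level n)
level-null n = geometric-null (level n) (0≤level n) ⅚ (+ 1 ℚ./ 5) (ℚₚ.nonNegative⁻¹ ⅚)
  (ℚₚ.positive⁻¹ (+ 1 ℚ./ 5)) ℚₚ.≤-refl (λ _ → refl)

module _ {n : ℕ} (c : Vector ℝ n) (D : ℝ → ℝ) (isDist : IsDist c D)
  (m : ℕ → ℝ) (isMin : ∀ j → IsMin (I j) D (m j)) where

  m≤distance : ∀ j τ (z : Vector ℤ n) → 2^- suc j ℚ.≤ τ → τ ℚ.≤ 2^- j → m j ≤ ‖ fromℚ τ • c ⊖ z ‖₁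
  m≤distance j τ z lo hi = ≤-trans {m j} {D (fromℚ τ)} {‖ fromℚ τ • c ⊖ z ‖₁}
    (IsMin.lowerBound (isMin j) (fromℚ τ) (fromℚ-mono lo , fromℚ-mono hi))
    (IsMin.lowerBound (isDist (fromℚ τ)) z _)

  -- The minima are attained only in the classical sense, which suffices by
  -- ≤-stable.
  0≤m : ∀ j → 0ℝ ≤ m j
  0≤m j = ≤-stable {0ℝ} {m j} λ ¬0≤m → IsMin.attained (isMin j) λ { (τ , _ , Dτ≈m) →
    IsMin.attained (isDist τ) λ { (z , _ , norm≈Dτ) → ¬0≤m
      (≤-trans {0ℝ} {D τ} {m j}
        (≤-trans {0ℝ} {‖ τ • c ⊖ z ‖₁} {D τ} (0≤norm (τ • c ⊖ z)) (≈⇒≤ {‖ τ • c ⊖ z ‖₁} {D τ} norm≈Dτ))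
        (≈⇒≤ {D τ} {m j} Dτ≈m)) } }

  private
    a₁ : Vector ℚ n
    a₁ i = proj₁ (nearby (c i) 1ℚ (ℚₚ.positive⁻¹ 1ℚ))

    -- An upper bound for the l1-norm of c.
    size : ℚ
    size = ∑F (λ i → ℚ.∣ a₁ i ∣ ℚ.+ 1ℚ) ℚ.+ 1ℚ

    0<size : 0ℚ ℚ.< size
    0<size = ℚₚ.+-mono-≤-< 0≤sum (ℚₚ.positive⁻¹ 1ℚ)
      where
      0≤sum : 0ℚ ℚ.≤ ∑F (λ i → ℚ.∣ a₁ i ∣ ℚ.+ 1ℚ)
      0≤sum = ℚₚ.≤-trans (ℚₚ.≤-reflexive (sym (trans (∑F-*ʳ n (λ _ → 0ℚ) 0ℚ) (ℚₚ.*-zeroʳ (∑F {n} (λ _ → 0ℚ))))))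
        (∑F-mono (λ i → 0≤+ (ℚₚ.0≤∣p∣ (a₁ i)) (0≤ι 1)))

    m-decay : ∀ j → m j ≤ fromℚ (size ℚ.* 2^- j)
    m-decay j = ≤-trans {m j} {‖ fromℚ τ • c ⊖ (λ _ → + 0) ‖₁} {fromℚ (size ℚ.* 2^- j)}
      (m≤distance j τ (λ _ → + 0) half ℚₚ.≤-refl)
      (≤-trans {‖ fromℚ τ • c ⊖ (λ _ → + 0) ‖₁} {fromℚ sum} {fromℚ (size ℚ.* 2^- j)}
        (distance-≤ c a₁ 1ℚ (λ i → proj₂ (nearby (c i) 1ℚ (ℚₚ.positive⁻¹ 1ℚ))) τ 0≤τ (λ _ → + 0))
        (fromℚ-mono sum≤))
      where
      τ = 2^- j
      0≤τ : 0ℚ ℚ.≤ τ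
      0≤τ = ℚₚ.<⇒≤ (0<2^- j)
      half : 2^- suc j ℚ.≤ τ
      half = ≤-by (½ ℚ.* τ) (ℚₚ.<⇒≤ (0<½* (0<2^- j))) (½+½ τ)
      sum = ∑F (λ i → ℚ.∣ τ ℚ.* a₁ i ℚ.- ιℤ (+ 0) ∣ ℚ.+ τ ℚ.* 1ℚ)
      term : ∀ i → ℚ.∣ τ ℚ.* a₁ i ℚ.- ιℤ (+ 0) ∣ ℚ.+ τ ℚ.* 1ℚ ≡ (ℚ.∣ a₁ i ∣ ℚ.+ 1ℚ) ℚ.* τ
      term i = trans (cong (ℚ._+ τ ℚ.* 1ℚ) (trans (cong ℚ.∣_∣ (ℚₚ.+-identityʳ (τ ℚ.* a₁ i)))
          (trans (ℚₚ.∣p*q∣≡∣p∣*∣q∣ τ (a₁ i)) (cong (ℚ._* ℚ.∣ a₁ i ∣) (ℚₚ.0≤p⇒∣p∣≡p 0≤τ)))))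
        (solve 2 (λ t x → t :* x :+ t :* con 1ℚ := (x :+ con 1ℚ) :* t) refl τ ℚ.∣ a₁ i ∣)
      sum≤ : sum ℚ.≤ size ℚ.* τ
      sum≤ = ℚₚ.≤-trans (ℚₚ.≤-reflexive (trans (∑F-cong term) (∑F-*ʳ n (λ i → ℚ.∣ a₁ i ∣ ℚ.+ 1ℚ) τ)))
        (*-monoʳ τ 0≤τ (≤-by {∑F (λ i → ℚ.∣ a₁ i ∣ ℚ.+ 1ℚ)} {size} 1ℚ (0≤ι 1) refl))

    -- The geometric bound on the tail of the series from index k on.
    t : ℕ → ℚ
    t k = ι 2 ℚ.* size ℚ.* 2^- k

    0<2size : 0ℚ ℚ.< ι 2 ℚ.* size
    0<2size = 0<* (0<ι 2) 0<size

    0<t : ∀ k → 0ℚ ℚ.< t k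
    0<t k = 0<* 0<2size (0<2^- k)

    t-null : Null t
    t-null = geometric-null t (λ k → ℚₚ.<⇒≤ (0<t k)) ½ 1ℚ (ℚₚ.nonNegative⁻¹ ½) (ℚₚ.positive⁻¹ 1ℚ) ℚₚ.≤-refl
      (λ k → solve 2 (λ s x → s :* (con ½ :* x) := con ½ :* (s :* x)) refl (ι 2 ℚ.* size) (2^- k))

    partial : ℕ → ℝ
    partial k = ∑ k m

    partial-mono′ : ∀ {k l} → k ℕ.≤′ l → partial k ≤ partial l
    partial-mono′ {k} (ℕ.≤′-reflexive refl) = ≤-refl {partial k}
    partial-mono′ {k} (ℕ.≤′-step {l} k≤l) = ≤-trans {partial k} {partial k + 0ℝ} {partial (suc l)}
      (eventually-≤ {partial k} {partial k + 0ℝ} 0 (λ p _ → ℚₚ.≤-reflexive (sym (ℚₚ.+-identityʳ _))))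
      (+-mono-≤ {partial k} {partial l} {0ℝ} {m l} (partial-mono′ k≤l) (0≤m l))

    partial-growth′ : ∀ {k l} → k ℕ.≤′ l → partial l ≤ partial k + fromℚ (t k ℚ.- t l)
    partial-growth′ {k} (ℕ.≤′-reflexive refl) = eventually-≤ {partial k} {partial k + fromℚ (t k ℚ.- t k)} 0
      (λ p _ → ℚₚ.≤-reflexive (sym (trans (cong (λ e → seq (partial k) p ℚ.+ e) (ℚₚ.+-inverseʳ (t k))) (ℚₚ.+-identityʳ _))))
    partial-growth′ {k} (ℕ.≤′-step {l} k≤l) =
      ≤-trans {partial (suc l)} {partial k + fromℚ (t k ℚ.- t l) + fromℚ (size ℚ.* 2^- l)} {partial k + fromℚ (t k ℚ.- t (suc l))}
        (+-mono-≤ {partial l} {partial k + fromℚ (t k ℚ.- t l)} {m l} {fromℚ (size ℚ.* 2^- l)} (partial-growth′ k≤l) (m-decay l))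
        (eventually-≤ {partial k + fromℚ (t k ℚ.- t l) + fromℚ (size ℚ.* 2^- l)} {partial k + fromℚ (t k ℚ.- t (suc l))} 0
          (λ p _ → ℚₚ.≤-reflexive (solve 4
            (λ s x b h → s :+ (x :- con (ι 2) :* b :* h) :+ b :* h := s :+ (x :- con (ι 2) :* b :* (con ½ :* h)))
            refl (seq (partial k) p) (t k) size (2^- l))))

    partial-growth : ∀ {k l} → k ℕ.≤ l → partial l ≤ partial k + fromℚ (t k)
    partial-growth {k} {l} k≤l = ≤-trans {partial l} {partial k + fromℚ (t k ℚ.- t l)} {partial k + fromℚ (t k)}
      (partial-growth′ (ℕₚ.≤⇒≤′ k≤l))
      (+-mono-≤ {partial k} {partial k} {fromℚ (t k ℚ.- t l)} {fromℚ (t k)} (≤-refl {partial k})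
        (fromℚ-mono (≤-by (t l) (ℚₚ.<⇒≤ (0<t l)) (solve 2 (λ x y → x :- y :+ y := x) refl (t k) (t l)))))

  -- The first K terms, with an error of θ in each coordinate of c and in each
  -- minimum.
  module _ (K : ℕ) (θ : ℚ) (0<θ : 0ℚ ℚ.< θ) where
    private
      a : Vector ℚ n
      a i = proj₁ (nearby (c i) θ 0<θ)

      q : ℕ → ℚ
      q j = proj₁ (bracket (m j) θ 0<θ)

      Q₁ : ℕ
      Q₁ = proj₁ (commonDenominator a)

      instance
        Q₁≢0 : ℕ.NonZero Q₁
        Q₁≢0 = proj₁ (proj₂ (commonDenominator a))
        2^≢0 : ℕ.NonZero (2 ℕ.^ K)
        2^≢0 = ℕₚ.m^n≢0 2 K
        Q₀≢0 : ℕ.NonZero (Q₁ ℕ.* 2 ℕ.^ K)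
        Q₀≢0 = ℕₚ.m*n≢0 Q₁ (2 ℕ.^ K)

      B : Vector ℤ n
      B = proj₁ (proj₂ (proj₂ (commonDenominator a)))

      Q₀ : ℕ
      Q₀ = Q₁ ℕ.* 2 ℕ.^ K

      b : Vector ℕ n
      b i = B i %ℕ Q₀

      -- The error of c changes the distance function by at most n θ on [0, 1].
      q′ : ℕ → ℚ
      q′ j = q j ℚ.- ι n ℚ.* θ

      rational-bound : ∀ F .{{_ : ℕ.NonZero F}} e → e ℕ.< K → ∀ d → 2 ℕ.^ e ℕ.≤ d → d ℕ.≤ 2 ℕ.^ suc e →
           ∀ u v → Represents (Q₀ ℕ.* F) (λ i → F ℕ.* b i) d u v →
           q′ (K ℕ.∸ suc e) ℚ.* ι (Q₀ ℕ.* F) ℚ.≤ ι (dist₁ u v)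
      rational-bound F e e<K d lo hi u v rep = begin
        q′ j ℚ.* ι (Q₀ ℕ.* F)
          ≤⟨ *-monoʳ (ι (Q₀ ℕ.* F)) 0≤QF q′≤ ⟩
        ∑F dist ℚ.* ι (Q₀ ℕ.* F)
          ≡⟨ ∑F-*ʳ n dist (ι (Q₀ ℕ.* F)) ⟨
        ∑F (λ i → dist i ℚ.* ι (Q₀ ℕ.* F))
          ≡⟨ ∑F-cong scaled ⟩
        ∑F (λ i → ℚ.∣ ι (v i) ℚ.- ι (u i) ∣)
          ≡⟨ ι-dist₁ u v ⟩
        ι (dist₁ u v) ∎
        where
        open ℚₚ.≤-Reasoning
        j = K ℕ.∸ suc e
        h = 2^- K
        0≤h : 0ℚ ℚ.≤ h
        0≤h = ℚₚ.<⇒≤ (0<2^- K)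
        τ = ι d ℚ.* h
        0≤τ : 0ℚ ℚ.≤ τ
        0≤τ = 0≤* (0≤ι d) 0≤h
        0≤QF : 0ℚ ℚ.≤ ι (Q₀ ℕ.* F)
        0≤QF = 0≤ι (Q₀ ℕ.* F)
        K≡ : suc e ℕ.+ j ≡ K
        K≡ = ℕₚ.m+[n∸m]≡n e<K
        point : ∀ i → ∃ λ z → (τ ℚ.* a i ℚ.- ιℤ z) ℚ.* ι (Q₀ ℕ.* F) ≡ ι (v i) ℚ.- ι (u i)
        point i = represented (a i) Q₁ (B i) (proj₂ (proj₂ (proj₂ (commonDenominator a))) i) K F d (u i) (v i) (rep i)
        z : Vector ℤ n
        z i = proj₁ (point i)
        dist : Vector ℚ n
        dist i = ℚ.∣ τ ℚ.* a i ℚ.- ιℤ (z i) ∣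
        scaled : ∀ i → dist i ℚ.* ι (Q₀ ℕ.* F) ≡ ℚ.∣ ι (v i) ℚ.- ι (u i) ∣
        scaled i = trans (cong (dist i ℚ.*_) (sym (ℚₚ.0≤p⇒∣p∣≡p 0≤QF)))
          (trans (sym (ℚₚ.∣p*q∣≡∣p∣*∣q∣ (τ ℚ.* a i ℚ.- ιℤ (z i)) (ι (Q₀ ℕ.* F)))) (cong ℚ.∣_∣ (proj₂ (point i))))
        τ≥ : 2^- suc j ℚ.≤ τ
        τ≥ = subst (ℚ._≤ τ) (trans (cong (λ k → ι (2 ℕ.^ e) ℚ.* 2^- k) (trans (sym K≡) (sym (ℕₚ.+-suc e j)))) (2^*2^- e (suc j)))
          (*-monoʳ h 0≤h (ι-mono-≤ lo))
        τ≤ : τ ℚ.≤ 2^- j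
        τ≤ = subst (τ ℚ.≤_) (trans (cong (λ k → ι (2 ℕ.^ suc e) ℚ.* 2^- k) (sym K≡)) (2^*2^- (suc e) j))
          (*-monoʳ h 0≤h (ι-mono-≤ hi))
        q≤ : q j ℚ.≤ ∑F (λ i → dist i ℚ.+ τ ℚ.* θ)
        q≤ = fromℚ-cancel (≤-trans {fromℚ (q j)} {m j} {fromℚ (∑F (λ i → dist i ℚ.+ τ ℚ.* θ))}
          (proj₁ (proj₂ (bracket (m j) θ 0<θ)))
          (≤-trans {m j} {‖ fromℚ τ • c ⊖ z ‖₁} {fromℚ (∑F (λ i → dist i ℚ.+ τ ℚ.* θ))}
            (m≤distance j τ z τ≥ τ≤)
            (distance-≤ c a θ (λ i → proj₂ (nearby (c i) θ 0<θ)) τ 0≤τ z)))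
        q′≤ : q′ j ℚ.≤ ∑F dist
        q′≤ = begin
          q j ℚ.- ι n ℚ.* θ                                     ≤⟨ ℚₚ.+-monoˡ-≤ (ℚ.- (ι n ℚ.* θ)) q≤ ⟩
          ∑F (λ i → dist i ℚ.+ τ ℚ.* θ) ℚ.- ι n ℚ.* θ           ≡⟨ cong (ℚ._- ι n ℚ.* θ) (∑F-+const n dist (τ ℚ.* θ)) ⟩
          ∑F dist ℚ.+ ι n ℚ.* (τ ℚ.* θ) ℚ.- ι n ℚ.* θ           ≤⟨ ℚₚ.+-monoˡ-≤ (ℚ.- (ι n ℚ.* θ)) (ℚₚ.+-monoʳ-≤ (∑F dist)
                                                                     (*-monoˡ (ι n) (0≤ι n) (*-monoʳ θ (ℚₚ.<⇒≤ 0<θ) (ℚₚ.≤-trans τ≤ (2^-≤1 j))))) ⟩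
          ∑F dist ℚ.+ ι n ℚ.* (1ℚ ℚ.* θ) ℚ.- ι n ℚ.* θ          ≡⟨ solve 3 (λ s n t → s :+ n :* (con 1ℚ :* t) :- n :* t := s) refl (∑F dist) (ι n) θ ⟩
          ∑F dist                                               ∎

      partial-≤ : ∀ k → partial k ≤ fromℚ (∑ℚ k (λ j → q j ℚ.+ θ))
      partial-≤ zero    = ≤-refl {0ℝ}
      partial-≤ (suc k) = +-mono-≤ {partial k} {fromℚ (∑ℚ k (λ j → q j ℚ.+ θ))} {m k} {fromℚ (q k ℚ.+ θ)}
        (partial-≤ k) (proj₂ (proj₂ (bracket (m k) θ 0<θ)))

    approximate-bound : ∀ i → ∑ K m ≤ fromℚ ((+ 6 ℚ./ 5) ℚ.* (ι n ℚ.* ι n) ℚ.+ (ι K ℚ.* level n i ℚ.+ ι K ℚ.* (ι (suc n)) ℚ.* θ))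
    approximate-bound i = ≤-trans {partial K} {fromℚ (∑ℚ K (λ j → q j ℚ.+ θ))} {fromℚ ((+ 6 ℚ./ 5) ℚ.* (ι n ℚ.* ι n) ℚ.+ (ι K ℚ.* level n i ℚ.+ ι K ℚ.* (ι (suc n)) ℚ.* θ))}
      (partial-≤ K) (fromℚ-mono (begin
        ∑ℚ K (λ j → q j ℚ.+ θ)
          ≡⟨ ∑ℚ-cong K (λ j _ → trans (solve 3 (λ q n t → q :+ t := q :- n :* t :+ (con 1ℚ :+ n) :* t) refl (q j) (ι n) θ)
               (cong (λ y → q′ j ℚ.+ y ℚ.* θ) (sym (ι-suc n)))) ⟩
        ∑ℚ K (λ j → q′ j ℚ.+ ι (suc n) ℚ.* θ)
          ≡⟨ trans (∑ℚ-+ K q′ (λ _ → ι (suc n) ℚ.* θ)) (cong (∑ℚ K q′ ℚ.+_) (trans (∑ℚ-const K (ι (suc n) ℚ.* θ)) (sym (ℚₚ.*-assoc (ι K) (ι (suc n)) θ)))) ⟩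
        ∑ℚ K q′ ℚ.+ ι K ℚ.* ι (suc n) ℚ.* θ
          ≡⟨ cong (ℚ._+ ι K ℚ.* ι (suc n) ℚ.* θ) (∑ℚ-reverse K q′) ⟨
        ∑ℚ K (λ e → q′ (K ℕ.∸ suc e)) ℚ.+ ι K ℚ.* ι (suc n) ℚ.* θ
          ≤⟨ ℚₚ.+-monoˡ-≤ (ι K ℚ.* ι (suc n) ℚ.* θ) (minima-sum n Q₀ K b (λ e → q′ (K ℕ.∸ suc e)) rational-bound i) ⟩
        (+ 6 ℚ./ 5) ℚ.* (ι n ℚ.* ι n) ℚ.+ ι K ℚ.* level n i ℚ.+ ι K ℚ.* ι (suc n) ℚ.* θ
          ≡⟨ ℚₚ.+-assoc ((+ 6 ℚ./ 5) ℚ.* (ι n ℚ.* ι n)) _ _ ⟩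
        (+ 6 ℚ./ 5) ℚ.* (ι n ℚ.* ι n) ℚ.+ (ι K ℚ.* level n i ℚ.+ ι K ℚ.* ι (suc n) ℚ.* θ) ∎))
      where open ℚₚ.≤-Reasoning

  partial-bound : ∀ K → ∑ K m ≤ fromℚ ((+ 6 ℚ./ 5) ℚ.* (ι n ℚ.* ι n))
  partial-bound K = ≤-by-eps {∑ K m} {fromℚ X} λ η 0<η →
      go η 0<η (level-null n (½ ℚ.* η ℚ.* 1/suc K) (0<* (0<½* 0<η) (0<1/suc K)))
    where
    open ℚₚ.≤-Reasoning
    X = (+ 6 ℚ./ 5) ℚ.* (ι n ℚ.* ι n)
    go : ∀ η → 0ℚ ℚ.< η → (∃ λ i → ∀ k → i ℕ.≤ k → level n k ℚ.< ½ ℚ.* η ℚ.* 1/suc K) →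
         ∑ K m ≤ fromℚ X + fromℚ η
    go η 0<η (i , small) = ≤-trans {∑ K m} {fromℚ (X ℚ.+ (ι K ℚ.* level n i ℚ.+ ι K ℚ.* ι (suc n) ℚ.* θ))} {fromℚ X + fromℚ η}
      (approximate-bound K θ 0<θ i)
      (fromℚ-mono (ℚₚ.+-monoʳ-≤ X (begin
        ι K ℚ.* level n i ℚ.+ ι K ℚ.* ι (suc n) ℚ.* θ
          ≤⟨ ℚₚ.+-mono-≤ (*-monoˡ (ι K) (0≤ι K) (ℚₚ.<⇒≤ (small i ℕₚ.≤-refl)))
               (ℚₚ.≤-reflexive (cong (ℚ._* θ) (sym (ι-* K (suc n))))) ⟩
        ι K ℚ.* (½ ℚ.* η ℚ.* 1/suc K) ℚ.+ ι M ℚ.* (½ ℚ.* η ℚ.* 1/suc M)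
          ≤⟨ ℚₚ.+-mono-≤ (share K) (share M) ⟩
        ½ ℚ.* η ℚ.+ ½ ℚ.* η
          ≡⟨ ½+½ η ⟩
        η ∎)))
      where
      M = K ℕ.* suc n
      θ = ½ ℚ.* η ℚ.* 1/suc M
      0<θ : 0ℚ ℚ.< θ
      0<θ = 0<* (0<½* 0<η) (0<1/suc M)
      share : ∀ k → ι k ℚ.* (½ ℚ.* η ℚ.* 1/suc k) ℚ.≤ ½ ℚ.* η
      share k = begin
        ι k ℚ.* (½ ℚ.* η ℚ.* 1/suc k)    ≡⟨ solve 3 (λ k e x → k :* (e :* x) := e :* (k :* x)) refl (ι k) (½ ℚ.* η) (1/suc k) ⟩
        ½ ℚ.* η ℚ.* (ι k ℚ.* 1/suc k)    ≤⟨ *-monoˡ (½ ℚ.* η) (ℚₚ.<⇒≤ (0<½* 0<η)) (ι*1/suc≤1 k) ⟩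
        ½ ℚ.* η ℚ.* 1ℚ                   ≡⟨ ℚₚ.*-identityʳ (½ ℚ.* η) ⟩
        ½ ℚ.* η                          ∎

  sum-exists : ∃ λ S → HasSum m S × S ≤ fromℚ ((+ 6 ℚ./ 5) ℚ.* (ι n ℚ.* ι n))
  sum-exists = limit partial t 0<t t-null (λ k≤l → partial-mono′ (ℕₚ.≤⇒≤′ k≤l)) partial-growth ,
    converges partial t 0<t t-null (λ k≤l → partial-mono′ (ℕₚ.≤⇒≤′ k≤l)) partial-growth ,
    limit-lub partial t 0<t t-null (λ k≤l → partial-mono′ (ℕₚ.≤⇒≤′ k≤l)) partial-growth
      {fromℚ ((+ 6 ℚ./ 5) ℚ.* (ι n ℚ.* ι n))} partial-bound

-- The constant

-- The p-th term of C is 1/2 + y with x y = 1, where x is twice a Riemann sum.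
module _ (p : ℕ) (1000≤p : 1000 ℕ.≤ p) where
  private
    x y : ℚ
    x = ι 2 ℚ.* riemannSum (suc p)
    y = seq (recip (fromℕ 2 * ln2) 0<2ln2) p

    1000≤1+p : 1000 ℕ.≤ suc p
    1000≤1+p = ℕₚ.m≤n⇒m≤1+n 1000≤p

    x≥ : (+ 3463 / 2500) ℚ.≤ x
    x≥ = *-monoˡ (ι 2) (0≤ι 2) (riemannSum-≥ (suc p) 1000≤1+p)

    x≤ : x ℚ.≤ + 10 / 7
    x≤ = *-monoˡ (ι 2) (0≤ι 2) (riemannSum-≤ (suc p) (ℕₚ.≤-trans (ℕₚ.≤ᵇ⇒≤ 12 1000 _) 1000≤1+p))

    0<x : 0ℚ ℚ.< x
    0<x = ℚₚ.<-≤-trans (ℚₚ.positive⁻¹ (+ 3463 / 2500)) x≥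

    xy≡1 : x ℚ.* y ≡ 1ℚ
    xy≡1 = ℚₚ.*-inverseʳ x {{ℚ.>-nonZero 0<x}}

    0≤y : 0ℚ ℚ.≤ y
    0≤y = ℚₚ.<⇒≤ (ℚₚ.positive⁻¹ y {{ℚₚ.1/pos⇒pos x {{ℚ.positive 0<x}}}})

  C-≥ : + 6 / 5 ℚ.≤ seq C p
  C-≥ = ℚₚ.+-monoʳ-≤ ½ (begin
    + 7 / 10                          ≡⟨ ℚₚ.*-identityʳ (+ 7 / 10) ⟨
    (+ 7 / 10) ℚ.* 1ℚ                 ≡⟨ cong ((+ 7 / 10) ℚ.*_) xy≡1 ⟨
    (+ 7 / 10) ℚ.* (x ℚ.* y)          ≤⟨ *-monoˡ (+ 7 / 10) (ℚₚ.nonNegative⁻¹ (+ 7 / 10)) (*-monoʳ y 0≤y x≤) ⟩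
    (+ 7 / 10) ℚ.* ((+ 10 / 7) ℚ.* y) ≡⟨ solve 1 (λ y → con (+ 7 / 10) :* (con (+ 10 / 7) :* y) := y) refl y ⟩
    y                                 ∎)
    where open ℚₚ.≤-Reasoning

  C-≤ : seq C p ℚ.+ + 1 / 20000 ℚ.≤ + 1222 / 1000
  C-≤ = ℚₚ.≤-trans (ℚₚ.+-monoˡ-≤ (+ 1 / 20000) (ℚₚ.+-monoʳ-≤ ½ (begin
    y                                         ≡⟨ solve 1 (λ y → y := con (+ 2500 / 3463) :* (con (+ 3463 / 2500) :* y)) refl y ⟩
    (+ 2500 / 3463) ℚ.* ((+ 3463 / 2500) ℚ.* y)  ≤⟨ *-monoˡ (+ 2500 / 3463) (ℚₚ.nonNegative⁻¹ (+ 2500 / 3463)) (*-monoʳ y 0≤y x≥) ⟩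
    (+ 2500 / 3463) ℚ.* (x ℚ.* y)             ≡⟨ cong ((+ 2500 / 3463) ℚ.*_) xy≡1 ⟩
    (+ 2500 / 3463) ℚ.* 1ℚ                    ∎)))
    (ℚₚ.≤ᵇ⇒≤ {½ ℚ.+ (+ 2500 / 3463) ℚ.* 1ℚ ℚ.+ + 1 / 20000} {+ 1222 / 1000} _)
    where open ℚₚ.≤-Reasoning
corollary6 : (n : ℕ) .{{_ : NonZero n}} (c : Vector ℝ n)
    (D : ℝ → ℝ) → IsDist c D →
    (m : ℕ → ℝ) → (∀ j → IsMin (I j) D (m j)) →
    (∃ λ S → HasSum m S × S ≤ C * fromℕ (n ^ 2))
    × C * fromℕ (n ^ 2) < fromℚ (+ 1222 / 1000) * fromℕ (n ^ 2)
corollary6 n c D isDist m isMin = series (sum-exists c D isDist m isMin) ,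
  (+ 1 / 20000) ℚ.* n² , 0<* (ℚₚ.positive⁻¹ (+ 1 / 20000)) 0<n² , 1000 , λ p 1000≤p →
    subst (ℚ._≤ (+ 1222 / 1000) ℚ.* n²) (ℚₚ.*-distribʳ-+ n² (seq C p) (+ 1 / 20000))
      (*-monoʳ n² (ℚₚ.<⇒≤ 0<n²) (C-≤ p 1000≤p))
  where
  n² : ℚ
  n² = ι (n ^ 2)
  n²≡ : n² ≡ ι n ℚ.* ι n
  n²≡ = trans (cong (λ k → ι (n ℕ.* k)) (ℕₚ.*-identityʳ n)) (ι-* n n)
  0<n² : 0ℚ ℚ.< n²
  0<n² = subst (0ℚ ℚ.<_) (sym n²≡) (0<* (0<ι n) (0<ι n))
  series : (∃ λ S → HasSum m S × S ≤ fromℚ ((+ 6 / 5) ℚ.* (ι n ℚ.* ι n))) →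
           ∃ λ S → HasSum m S × S ≤ C * fromℕ (n ^ 2)
  series (S , hasSum , S≤) = S , hasSum ,
    ≤-trans {S} {fromℚ ((+ 6 / 5) ℚ.* (ι n ℚ.* ι n))} {C * fromℕ (n ^ 2)} S≤
      (eventually-≤ {fromℚ ((+ 6 / 5) ℚ.* (ι n ℚ.* ι n))} {C * fromℕ (n ^ 2)} 1000 λ p 1000≤p →
        subst (λ s → (+ 6 / 5) ℚ.* s ℚ.≤ seq C p ℚ.* n²) n²≡
          (*-monoʳ n² (ℚₚ.<⇒≤ 0<n²) (C-≥ p 1000≤p)))
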